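{- For every non-negative integer $n$ and each $t\in\{42,66\}$, $$\overline{b}(72n+t)\equiv 0 \pmod{256},$$ where $\overline{b}(n)$ denotes the number of overcubic partition pairs of $n$, i.e. the coefficients defined by $\sum_{n=0}^{\infty}\overline{b}(n)q^n=\dfrac{(-q;q)_\infty^2\,(-q^2;q^2)_\infty^2}{(q;q)_\infty^2\,(q^2;q^2)_\infty^2}$.
   Context: For $|q|<1$, $(a;q)_\infty:=\prod_{n\ge 0}(1-aq^n)$; thus, for a positive integer $j$, $(q^j;q^j)_\infty=\prod_{n\ge 1}(1-q^{jn})$ and $(-q^j;q^j)_\infty=\prod_{n\ge 1}(1+q^{jn})$. The integers $\overline{b}(n)$, $n\ge 0$, are the coefficients of the power series $\sum_{n=0}^{\infty}\overline{b}(n)q^n=\frac{(-q;q)_\infty^2(-q^2;q^2)_\infty^2}{(q;q)_\infty^2(q^2;q^2)_\infty^2}$. -}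

module Defs where

open import Data.Bool.Base using (true; false; if_then_else_)
open import Data.Nat.Base as ℕ using (ℕ; zero; suc; _∸_; _≡ᵇ_; NonZero)
import Data.Nat.Properties as ℕ
open import Data.Integer.Base using (ℤ; 0ℤ; 1ℤ; -1ℤ; _+_; _*_; _-_; -_)
open import Data.Integer.Properties
open import Data.Fin.Base using (Fin; zero; suc; toℕ)
open import Data.Fin.Properties using (toℕ≤pred[n])
open import Relation.Binary.PropositionalEquality
open import Relation.Nullary.Negation using (contradiction)
open import Algebra.Properties.Semiring.Sum +-*-semiring
  using (sum-syntax; sum⁺-syntax; sum-cong-≗; sum-replicate-zero)

-- Formal power series in q over ℤ: f n is the coefficient of qⁿ, and
-- equality of series is pointwise equality _≗_.
Series : Set
Series = ℕ → ℤ

infixl 7 _·_ _÷_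
infixl 6 _⊖_
infix  9 _·q^_ _²

_·q^_ : ℤ → ℕ → Series
(c ·q^ k) n = if n ≡ᵇ k then c else 0ℤ

one : Series
one = 1ℤ ·q^ 0

_⊖_ : Series → Series → Series
(f ⊖ g) n = f n - g n

_·_ : Series → Series → Series
(f · g) n = ∑[ i ≤ n ] (f (toℕ i) * g (n ∸ toℕ i))

_² : Series → Series
f ² = f · f

-- The factor 1 - c q^j (q^j)^n of (c q^j ; q^j)_∞.
factor : ℤ → ℕ → ℕ → Series
factor c j n = one ⊖ (c ·q^ (j ℕ.+ j ℕ.* n))

-- The product of the factors with index 0, …, N-1.
partialProduct : ℤ → ℕ → ℕ → Series
partialProduct c j zero    = one
partialProduct c j (suc N) = factor c j N · partialProduct c j N

-- (c q^j ; q^j)_∞.  For j ≥ 1 the factors with index n ≥ m are 1 modulo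
-- q^(m+1), so the coefficient of q^m is already that of the product of the
-- first m factors; see partialProduct-stable below.
[_q^_]∞ : ℤ → (j : ℕ) → .{{NonZero j}} → Series
[ c q^ j ]∞ m = partialProduct c j m m

-- Long division by a series with constant term 1 (meaningless otherwise):
-- if f = d · c and d 0 = 1, then c n = f n - Σ_{i<n} d (i+1) c (n-1-i).
-- quotients f d n lists the coefficients c n, c (n-1), …, c 0.
quotients : Series → Series → (n : ℕ) → Fin (suc n) → ℤ
quotients f d zero    _       = f 0
quotients f d (suc n) zero    =
  f (suc n) - ∑[ i ≤ n ] (d (suc (toℕ i)) * quotients f d n i)
quotients f d (suc n) (suc i) = quotients f d n i

_÷_ : Series → Series → Series
(f ÷ d) n = quotients f d n zero

numerator : Series
numerator = [ -1ℤ q^ 1 ]∞ ² · [ -1ℤ q^ 2 ]∞ ²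

denominator : Series
denominator = [ 1ℤ q^ 1 ]∞ ² · [ 1ℤ q^ 2 ]∞ ²

b̄ : ℕ → ℤ
b̄ = numerator ÷ denominator

quotients-÷ : ∀ f d n i → quotients f d n i ≡ (f ÷ d) (n ∸ toℕ i)
quotients-÷ f d n       zero    = refl
quotients-÷ f d (suc n) (suc i) = quotients-÷ f d n i

·-÷ : ∀ f d → d 0 ≡ 1ℤ → d · (f ÷ d) ≗ f
·-÷ f d d₀≡1 zero = begin
  d 0 * f 0 + 0ℤ  ≡⟨ +-identityʳ _ ⟩
  d 0 * f 0       ≡⟨ cong (_* f 0) d₀≡1 ⟩
  1ℤ * f 0        ≡⟨ *-identityˡ _ ⟩
  f 0             ∎
  where open ≡-Reasoning
·-÷ f d d₀≡1 (suc n) = begin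
  d 0 * (f (suc n) - s) + s′  ≡⟨ cong (λ x → x * (f (suc n) - s) + s′) d₀≡1 ⟩
  1ℤ * (f (suc n) - s) + s′   ≡⟨ cong₂ _+_ (*-identityˡ (f (suc n) - s)) (sym s≡s′) ⟩
  f (suc n) - s + s           ≡⟨ +-assoc (f (suc n)) (- s) s ⟩
  f (suc n) + (- s + s)       ≡⟨ cong (λ x → f (suc n) + x) (+-inverseˡ s) ⟩
  f (suc n) + 0ℤ              ≡⟨ +-identityʳ _ ⟩
  f (suc n)                   ∎
  where
  open ≡-Reasoning
  s  = ∑[ i ≤ n ] (d (suc (toℕ i)) * quotients f d n i)
  s′ = ∑[ i ≤ n ] (d (suc (toℕ i)) * (f ÷ d) (n ∸ toℕ i))
  s≡s′ : s ≡ s′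
  s≡s′ = sum-cong-≗ (λ i → cong (d (suc (toℕ i)) *_) (quotients-÷ f d n i))

denominator·b̄ : denominator · b̄ ≗ numerator
denominator·b̄ = ·-÷ numerator denominator refl

·q^-≢ : ∀ c {k n} → n ≢ k → (c ·q^ k) n ≡ 0ℤ
·q^-≢ c {k} {n} n≢k with n ≡ᵇ k | ℕ.≡ᵇ⇒≡ n k
... | true  | eq = contradiction (eq _) n≢k
... | false | _  = refl

factor-low : ∀ c j .{{_ : NonZero j}} N k → k ℕ.≤ N → factor c j N k ≡ one k
factor-low c j N k k≤N = begin
  one k - (c ·q^ (j ℕ.+ j ℕ.* N)) k  ≡⟨ cong (λ x → one k - x) (·q^-≢ c (ℕ.<⇒≢ k<)) ⟩
  one k + 0ℤ                         ≡⟨ +-identityʳ _ ⟩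
  one k                              ∎
  where
  open ≡-Reasoning
  k< : k ℕ.< j ℕ.+ j ℕ.* N
  k< = ℕ.+-mono-≤ (ℕ.>-nonZero⁻¹ j) (ℕ.≤-trans k≤N (ℕ.m≤n*m N j))

partialProduct-step : ∀ c j .{{_ : NonZero j}} {N m} → m ℕ.≤ N →
                      partialProduct c j (suc N) m ≡ partialProduct c j N m
partialProduct-step c j {N} {m} m≤N = begin
  ∑[ i ≤ m ] (factor c j N (toℕ i) * p (m ∸ toℕ i))
    ≡⟨ sum-cong-≗ {suc m} (λ i → cong (_* p (m ∸ toℕ i))
         (factor-low c j N (toℕ i) (ℕ.≤-trans (toℕ≤pred[n] i) m≤N))) ⟩
  1ℤ * p m + ∑[ i < m ] (0ℤ * p (m ∸ suc (toℕ i)))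
    ≡⟨ cong₂ _+_ (*-identityˡ (p m)) (sum-replicate-zero m) ⟩
  p m + 0ℤ
    ≡⟨ +-identityʳ (p m) ⟩
  p m ∎
  where
  open ≡-Reasoning
  p = partialProduct c j N

partialProduct-stable : ∀ c j .{{_ : NonZero j}} m k →
                        partialProduct c j (k ℕ.+ m) m ≡ [ c q^ j ]∞ m
partialProduct-stable c j m zero    = refl
partialProduct-stable c j m (suc k) =
  trans (partialProduct-step c j (ℕ.m≤n+m m k)) (partialProduct-stable c j m k)

{-# OPTIONS --safe #-}

-- Write φ = Σ q^(n²) over n ∈ ℤ and ψ = Σ q^(n(n+1)/2) over n ≥ 0. By Gauss's
-- identity φ(-q) = (q;q)_∞ / (-q;q)_∞, the series of b̄ is the inverse of
-- φ(-q)² φ(-q²)². Taking the coefficients of index 8m+2 with the help of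
-- φ(q) φ(-q) = φ(-q²)² and φ(q) = φ(q⁴) + 2 q ψ(q⁸) leaves 16 φ² ψ² modulo 256.
-- Dissecting φ(q) = φ(q⁹) + 2 q w(q³) and ψ(q) = A(q³) + q ψ(q⁹) by 3, the part
-- of φ² ψ² of index 3k+2 is 4 (w A + φ(q³) ψ(q³))² - 3 (φ(q³) ψ(q³))², whose
-- coefficients with 3 ∤ k are divisible by 16 if those of w A are even. The
-- coefficient of q^N in w A counts the representations 24 N + 9 = 8 x² + y² by
-- positive x and y, and with y = ± (3 z - x) the form becomes symmetric in x and
-- z, so that the representations come in pairs when 3 ∤ N.

module Submission where

-- Both residues are 2 modulo 8: 72 n + 42 and 72 n + 66 are 8 m + 2 with m = 3 k + 2 and k = 3 n +
-- 1 or 3 n + 2, which is why only 3 ∤ k matters. The inverse of φ(-q)² φ(-q²)² is never expanded.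
-- The series of `b̄` is multiplied by a power of φ(-q) taken at q², which passes unchanged through
-- the choice of even or odd coefficients; the exponent is such that φ(q) φ(-q) = φ(-q²)² turns the
-- product into a power of φ. After two rounds φ(-q)^12 remains on the left and the odd part of φ^8
-- on the right. That odd part supplies a factor 16, so the remaining powers matter only modulo 16,
-- where φ^8 ≡ 1. The square in the dissection by 3 is completed in order that w A occurs only
-- inside 4 times a square: knowing w A modulo 2 then gives 4 (...)² modulo 16. The pairing x ↔ z
-- could fail in three ways: z = 0 or a second z for the same x, both of which would force 9 ∣ 24 N
-- + 9 and hence 3 ∣ N, and x = ± z, which would make 24 N + 9 a multiple of 12. Infinite products
-- are known here through their truncations, so Gauss's identity is derived from a finite identity
-- whose error term lies beyond the truncation.

open import Defs
open import Algebra.Bundles using (CommutativeRing)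
import Algebra.Solver.Ring as RingSolver
open import Algebra.Solver.Ring.AlmostCommutativeRing
  using (fromCommutativeRing; _-Raw-AlmostCommutative⟶_)
open import Data.Bool.Base using (if_then_else_)
open import Data.Fin.Base as Fin using (Fin; toℕ; fromℕ<) renaming (zero to fzero; suc to fsuc)
import Data.Fin.Properties as Fin
open import Data.Integer.Base as ℤ using (ℤ; +_; -[1+_]; 0ℤ; 1ℤ; -1ℤ; ∣_∣)
open import Data.Integer.Divisibility using (_∣_)
open import Data.Integer.Divisibility.Signed as Signed using (divides)
import Data.Integer.Properties as ℤ
open import Data.Integer.Solver using () renaming (module +-*-Solver to ℤ-Solver)
open import Data.Maybe.Base using (Maybe; just; nothing)
open import Data.Nat.Base as ℕ using (ℕ; zero; suc; _+_; _*_; _≤_; _<_; z≤n; s≤s)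
import Data.Nat.Divisibility as ℕ
open import Data.Nat.Primality using (prime?; euclidsLemma)
import Data.Nat.Properties as ℕ
open import Data.Nat.Solver using () renaming (module +-*-Solver to ℕ-Solver)
open import Data.Product.Base using (∃; _×_; _,_; proj₁; proj₂)
open import Data.Sum.Base using (_⊎_; inj₁; inj₂; [_,_]′)
open import Relation.Binary.Definitions using (tri<; tri≈; tri>)
open import Relation.Binary.PropositionalEquality
  using (_≡_; _≢_; _≗_; refl; sym; trans; cong; cong₂; subst; module ≡-Reasoning)
import Relation.Binary.Reasoning.Setoid as SetoidReasoning
open import Relation.Nullary using (Dec; yes; no; does; ¬_; contradiction)
open import Relation.Nullary.Decidable using (map′; _×-dec_; _⊎-dec_; from-yes; from-no)
open import Algebra.Properties.Semiring.Sum ℤ.+-*-semiring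
  using (sum-syntax; sum⁺-syntax; sum-cong-≗; sum-replicate-zero; ∑-comm; ∑-distrib-+; *-distribʳ-sum)

-- Squares

𝟙 : ∀ {A : Set} → Dec A → ℤ
𝟙 a? = if does a? then 1ℤ else 0ℤ

𝟙-yes : ∀ {A : Set} (a? : Dec A) → A → 𝟙 a? ≡ 1ℤ
𝟙-yes (yes _) a = refl
𝟙-yes (no ¬a) a = contradiction a ¬a

𝟙-no : ∀ {A : Set} (a? : Dec A) → ¬ A → 𝟙 a? ≡ 0ℤ
𝟙-no (yes a) ¬a = contradiction a ¬a
𝟙-no (no _)  ¬a = refl

𝟙-cong : ∀ {A B : Set} (a? : Dec A) (b? : Dec B) → (A → B) → (B → A) → 𝟙 a? ≡ 𝟙 b?
𝟙-cong (yes a) b? f g = sym (𝟙-yes b? (f a))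
𝟙-cong (no ¬a) b? f g = sym (𝟙-no b? (λ b → ¬a (g b)))

Square⁺ : ℕ → Set
Square⁺ n = ∃ λ x → suc x * suc x ≡ n

-- Abstract, because the search would unfold at every successor.
abstract
  square⁺? : ∀ n → Dec (Square⁺ n)
  square⁺? n = map′ (λ (x , _ , eq) → x , eq)
                    (λ (x , eq) → x , subst (x <_) eq (ℕ.m≤m*n (suc x) (suc x)) , eq)
                    (ℕ.anyUpTo? (λ x → suc x * suc x ℕ.≟ n) n)

sq : Series
sq n = 𝟙 (square⁺? n)

-- 8 · k(k+1)/2 + 1 = (2k+1)².
ψ : Series
ψ n = sq (suc (n * 8))

sq-cong : ∀ {m n} → (Square⁺ m → Square⁺ n) → (Square⁺ n → Square⁺ m) → sq m ≡ sq n
sq-cong {m} {n} = 𝟙-cong (square⁺? m) (square⁺? n)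

sq-no : ∀ {n} → ¬ Square⁺ n → sq n ≡ 0ℤ
sq-no {n} = 𝟙-no (square⁺? n)

module _ where
  open ℕ-Solver using (solve; _:=_; _:+_; _:*_; con)

  even≢odd : ∀ m n → m * 2 ≢ suc (n * 2)
  even≢odd (suc m) (suc n) eq = even≢odd m n (ℕ.suc-injective (ℕ.suc-injective eq))

  parity : ∀ x → (∃ λ k → x ≡ k * 2) ⊎ (∃ λ m → x ≡ suc (m * 2))
  parity zero          = inj₁ (0 , refl)
  parity (suc zero)    = inj₂ (0 , refl)
  parity (suc (suc x)) with parity x
  ... | inj₁ (k , refl) = inj₁ (suc k , refl)
  ... | inj₂ (m , refl) = inj₂ (suc m , refl)

  -- The witness is the triangular number m (m + 1) / 2, because consecutive odd squares differ by 8
  -- (m + 1).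
  odd-square : ∀ m → ∃ λ t → suc (m * 2) * suc (m * 2) ≡ suc (t * 2 * 2 * 2)
  odd-square zero    = 0 , refl
  odd-square (suc m) with odd-square m
  ... | t , eq = t + suc m , (begin
    suc (suc (suc (m * 2))) * suc (suc (suc (m * 2)))
      ≡⟨ solve 1 (λ m → (con 3 :+ m :* con 2) :* (con 3 :+ m :* con 2) :=
           (con 1 :+ m :* con 2) :* (con 1 :+ m :* con 2) :+ (con 1 :+ m) :* con 2 :* con 2 :* con 2) refl m ⟩
    suc (m * 2) * suc (m * 2) + suc m * 2 * 2 * 2
      ≡⟨ cong (λ s → s + suc m * 2 * 2 * 2) eq ⟩
    suc (t * 2 * 2 * 2) + suc m * 2 * 2 * 2
      ≡⟨ solve 2 (λ t m → con 1 :+ t :* con 2 :* con 2 :* con 2 :+ m :* con 2 :* con 2 :* con 2 :=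
           con 1 :+ (t :+ m) :* con 2 :* con 2 :* con 2) refl t (suc m) ⟩
    suc ((t + suc m) * 2 * 2 * 2) ∎)
    where open ≡-Reasoning

  square-mod-2 : ∀ x → (∃ λ k → x ≡ k * 2) ⊎ (∃ λ t → x * x ≡ suc (t * 2 * 2 * 2))
  square-mod-2 x with parity x
  ... | inj₁ x-even     = inj₁ x-even
  ... | inj₂ (m , refl) = inj₂ (odd-square m)

  square-mod-3 : ∀ x → (∃ λ k → x ≡ k * 3) ⊎ (∃ λ t → x * x ≡ suc (t * 3))
  square-mod-3 zero                = inj₁ (0 , refl)
  square-mod-3 (suc zero)          = inj₂ (0 , refl)
  square-mod-3 (suc (suc zero))    = inj₂ (1 , refl)
  square-mod-3 (suc (suc (suc x))) with square-mod-3 x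
  ... | inj₁ (k , refl) = inj₁ (suc k , refl)
  ... | inj₂ (t , eq)   = inj₂ (t + (3 + 2 * x) , (begin
    suc (suc (suc x)) * suc (suc (suc x))
      ≡⟨ solve 1 (λ x → (con 3 :+ x) :* (con 3 :+ x) := x :* x :+ (con 3 :+ con 2 :* x) :* con 3) refl x ⟩
    x * x + (3 + 2 * x) * 3
      ≡⟨ cong (_+ (3 + 2 * x) * 3) eq ⟩
    suc (t * 3) + (3 + 2 * x) * 3
      ≡⟨ cong suc (sym (ℕ.*-distribʳ-+ 3 t (3 + 2 * x))) ⟩
    suc ((t + (3 + 2 * x)) * 3) ∎))
    where open ≡-Reasoning

  suc-injective³ : ∀ {m n} → suc (suc (suc m)) ≡ suc (suc (suc n)) → m ≡ n
  suc-injective³ refl = refl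

  3m≢3n+1 : ∀ m n → m * 3 ≢ suc (n * 3)
  3m≢3n+1 (suc m) (suc n) eq = 3m≢3n+1 m n (suc-injective³ eq)

  3m≢3n+2 : ∀ m n → m * 3 ≢ suc (suc (n * 3))
  3m≢3n+2 (suc m) (suc n) eq = 3m≢3n+2 m n (suc-injective³ eq)

  3m+1≢3n+2 : ∀ m n → suc (m * 3) ≢ suc (suc (n * 3))
  3m+1≢3n+2 m n eq = 3m≢3n+1 m n (ℕ.suc-injective eq)

  square-of-multiple : ∀ k p {x n} → x ≡ k * p → x * x ≡ n → k * k * p * p ≡ n
  square-of-multiple k p refl eq =
    trans (solve 2 (λ k p → k :* k :* p :* p := k :* p :* (k :* p)) refl k p) eq

  square-*² : ∀ n p → Square⁺ n → Square⁺ (n * suc p * suc p)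
  square-*² n p (x , refl) = p + x * suc p , sym (square-of-multiple (suc x) (suc p) refl refl)

  square-÷² : ∀ n p k {x} → suc x ≡ k * suc p → suc x * suc x ≡ n * suc p * suc p → Square⁺ n
  square-÷² n p (suc k) x≡ eq = k , ℕ.*-cancelʳ-≡ (suc k * suc k) n (suc p)
    (ℕ.*-cancelʳ-≡ (suc k * suc k * suc p) (n * suc p) (suc p) (square-of-multiple (suc k) (suc p) x≡ eq))

  -- The indices here and below are nested as `even`, `odd` and the thirds of a series produce them,
  -- so that the dissections of `sq` can quote these facts directly.
  sq-4n : ∀ n → sq (n * 2 * 2) ≡ sq n
  sq-4n n = sq-cong to (square-*² n 1)
    where
    to : Square⁺ (n * 2 * 2) → Square⁺ n
    to (x , eq) with square-mod-2 (suc x)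
    ... | inj₁ (k , x≡)  = square-÷² n 1 k x≡ eq
    ... | inj₂ (t , eq′) = contradiction (trans (sym eq) eq′) (even≢odd (n * 2) (t * 2 * 2))

  sq-4n+2 : ∀ n → sq (suc (n * 2) * 2) ≡ 0ℤ
  sq-4n+2 n = sq-no no-root
    where
    no-root : ¬ Square⁺ (suc (n * 2) * 2)
    no-root (x , eq) with square-mod-2 (suc x)
    ... | inj₁ (k , x≡)  = even≢odd (k * k) n (ℕ.*-cancelʳ-≡ (k * k * 2) (suc (n * 2)) 2
      (square-of-multiple k 2 x≡ eq))
    ... | inj₂ (t , eq′) = even≢odd (suc (n * 2)) (t * 2 * 2) (trans (sym eq) eq′)

  sq-4n+3 : ∀ n → sq (suc (suc (n * 2) * 2)) ≡ 0ℤ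
  sq-4n+3 n = sq-no no-root
    where
    no-root : ¬ Square⁺ (suc (suc (n * 2) * 2))
    no-root (x , eq) with square-mod-2 (suc x)
    ... | inj₁ (k , x≡)  = even≢odd (k * k * 2) (suc (n * 2))
      (square-of-multiple k 2 x≡ eq)
    ... | inj₂ (t , eq′) = even≢odd (t * 2) n (ℕ.*-cancelʳ-≡ (t * 2 * 2) (suc (n * 2)) 2
      (ℕ.suc-injective (trans (sym eq′) eq)))

  sq-8n+5 : ∀ n → sq (suc (suc (n * 2) * 2 * 2)) ≡ 0ℤ
  sq-8n+5 n = sq-no no-root
    where
    no-root : ¬ Square⁺ (suc (suc (n * 2) * 2 * 2))
    no-root (x , eq) with square-mod-2 (suc x)
    ... | inj₁ (k , x≡)  = even≢odd (k * k * 2) (suc (n * 2) * 2)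
      (square-of-multiple k 2 x≡ eq)
    ... | inj₂ (t , eq′) = even≢odd t n (ℕ.*-cancelʳ-≡ (t * 2) (suc (n * 2)) 2
      (ℕ.*-cancelʳ-≡ (t * 2 * 2) (suc (n * 2) * 2) 2 (ℕ.suc-injective (trans (sym eq′) eq))))

  sq-9n : ∀ n → sq (n * 3 * 3) ≡ sq n
  sq-9n n = sq-cong to (square-*² n 2)
    where
    to : Square⁺ (n * 3 * 3) → Square⁺ n
    to (x , eq) with square-mod-3 (suc x)
    ... | inj₁ (k , x≡)  = square-÷² n 2 k x≡ eq
    ... | inj₂ (t , eq′) = contradiction (trans (sym eq) eq′) (3m≢3n+1 (n * 3) t)

  sq-3n : ∀ n → (∀ k → k * 3 ≢ n) → sq (n * 3) ≡ 0ℤ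
  sq-3n n 3∤n = sq-no no-root
    where
    no-root : ¬ Square⁺ (n * 3)
    no-root (x , eq) with square-mod-3 (suc x)
    ... | inj₁ (k , x≡)  = 3∤n (k * k) (ℕ.*-cancelʳ-≡ (k * k * 3) n 3
      (square-of-multiple k 3 x≡ eq))
    ... | inj₂ (t , eq′) = 3m≢3n+1 n t (trans (sym eq) eq′)

  sq-3n+2 : ∀ n → sq (suc (suc (n * 3))) ≡ 0ℤ
  sq-3n+2 n = sq-no no-root
    where
    no-root : ¬ Square⁺ (suc (suc (n * 3)))
    no-root (x , eq) with square-mod-3 (suc x)
    ... | inj₁ (k , x≡)  = 3m≢3n+2 (k * k * 3) n
      (square-of-multiple k 3 x≡ eq)
    ... | inj₂ (t , eq′) = 3m+1≢3n+2 t n (trans (sym eq′) eq)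

  -- At the index 3 j + 1, `ψ` asks whether 24 j + 9 is a square. For j = 3 n this is 9 (8 n + 1),
  -- which leads back to `ψ`; for the other j it is 3 times a number prime to 3, hence no square.
  24[3n]+9 : ∀ n → suc (suc (n * 3 * 3) * 8) ≡ suc (n * 8) * 3 * 3
  24[3n]+9 = solve 1 (λ n → con 1 :+ (con 1 :+ n :* con 3 :* con 3) :* con 8 := (con 1 :+ n :* con 8) :* con 3 :* con 3) refl

  24[3n+1]+9 : ∀ n → suc (suc (suc (n * 3) * 3) * 8) ≡ suc (suc ((3 + 8 * n) * 3)) * 3
  24[3n+1]+9 = solve 1 (λ n → con 1 :+ (con 1 :+ (con 1 :+ n :* con 3) :* con 3) :* con 8 :=
    (con 2 :+ (con 3 :+ con 8 :* n) :* con 3) :* con 3) refl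

  24[3n+2]+9 : ∀ n → suc (suc (suc (suc (n * 3)) * 3) * 8) ≡ suc ((6 + 8 * n) * 3) * 3
  24[3n+2]+9 = solve 1 (λ n → con 1 :+ (con 1 :+ (con 2 :+ n :* con 3) :* con 3) :* con 8 :=
    (con 1 :+ (con 6 :+ con 8 :* n) :* con 3) :* con 3) refl

  24n+17 : ∀ n → suc (suc (suc (n * 3)) * 8) ≡ suc (suc ((5 + 8 * n) * 3))
  24n+17 = solve 1 (λ n → con 1 :+ (con 2 :+ n :* con 3) :* con 8 := con 2 :+ (con 5 :+ con 8 :* n) :* con 3) refl

  -- The left side is 8 m + 2 at m = 3 k + 2 and k = 3 n + 1, as the successive dissections leave
  -- it; the next lemma has k = 3 n + 2.
  72n+42 : ∀ n → suc (suc (suc (suc (n * 3) * 3)) * 2 * 2) * 2 ≡ 72 * n + 42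
  72n+42 = solve 1 (λ n → (con 1 :+ (con 2 :+ (con 1 :+ n :* con 3) :* con 3) :* con 2 :* con 2) :* con 2 :=
    con 72 :* n :+ con 42) refl

  72n+66 : ∀ n → suc (suc (suc (suc (suc (n * 3)) * 3)) * 2 * 2) * 2 ≡ 72 * n + 66
  72n+66 = solve 1 (λ n → (con 1 :+ (con 2 :+ (con 2 :+ n :* con 3) :* con 3) :* con 2 :* con 2) :* con 2 :=
    con 72 :* n :+ con 66) refl

  n+n+m : ∀ n m → n + (n + m) ≡ n * 2 + m
  n+n+m = solve 2 (λ n m → n :+ (n :+ m) := n :* con 2 :+ m) refl

-- Counting representations

-- Serves to compare sums over different index sets: two of them agree as soon as both reduce to the
-- same `b?`.
count-unique : ∀ {n} {B : Set} {C : Fin n → Set} (c? : ∀ i → Dec (C i)) (b? : Dec B) →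
               (∀ {i j} → C i → C j → i ≡ j) → (∀ {i} → C i → B) → (B → ∃ C) →
               ∑[ i < n ] 𝟙 (c? i) ≡ 𝟙 b?
count-unique {n} {B} {C} c? (no ¬b) unique to from =
  trans (sum-cong-≗ {n} (λ i → 𝟙-no (c? i) (λ c → ¬b (to c)))) (sum-replicate-zero n)
count-unique {n} {B} {C} c? (yes b) unique to from = one-hit c? unique (from b)
  where
  one-hit : ∀ {n} {C : Fin n → Set} (c? : ∀ i → Dec (C i)) → (∀ {i j} → C i → C j → i ≡ j) → ∃ C →
            ∑[ i < n ] 𝟙 (c? i) ≡ 1ℤ
  one-hit {suc n} c? unique (fzero , c) = cong₂ ℤ._+_ (𝟙-yes (c? fzero) c)
    (trans (sum-cong-≗ {n} (λ i → 𝟙-no (c? (fsuc i)) (λ c′ → Fin.0≢1+n (unique c c′)))) (sum-replicate-zero n))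
  one-hit {suc n} c? unique (fsuc i , c) = cong₂ ℤ._+_ (𝟙-no (c? fzero) (λ c′ → Fin.0≢1+n (unique c′ c)))
    (one-hit (λ i → c? (fsuc i)) (λ p r → Fin.suc-injective (unique p r)) (i , c))

𝟙-× : ∀ {B C : Set} (b? : Dec B) (c? : Dec C) → 𝟙 b? ℤ.* 𝟙 c? ≡ 𝟙 (b? ×-dec c?)
𝟙-× (yes _) (yes _) = refl
𝟙-× (yes _) (no _)  = refl
𝟙-× (no _)  c?      = refl

-- Without the corner, which is zero, the first row and the first column have the same sum; what
-- remains is a smaller symmetric square.
symmetric-sum-even : ∀ n (f : Fin n → Fin n → ℤ) → (∀ i j → f i j ≡ f j i) → (∀ i → f i i ≡ 0ℤ) →
                     ∃ λ c → ∑[ i < n ] ∑[ j < n ] f i j ≡ + 2 ℤ.* c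
symmetric-sum-even zero    f f-sym f-diag = 0ℤ , refl
symmetric-sum-even (suc n) f f-sym f-diag
  with c , eq ← symmetric-sum-even n (λ i j → f (fsuc i) (fsuc j)) (λ i j → f-sym _ _) (λ i → f-diag _) = s ℤ.+ c , (begin
  f fzero fzero ℤ.+ s ℤ.+ ∑[ i < n ] (f (fsuc i) fzero ℤ.+ ∑[ j < n ] f (fsuc i) (fsuc j))
    ≡⟨ cong₂ (λ x y → x ℤ.+ s ℤ.+ y) (f-diag fzero) (∑-distrib-+ (λ i → f (fsuc i) fzero) (λ i →
         ∑[ j < n ] f (fsuc i) (fsuc j))) ⟩
  0ℤ ℤ.+ s ℤ.+ (∑[ i < n ] f (fsuc i) fzero ℤ.+ ∑[ i < n ] ∑[ j < n ] f (fsuc i) (fsuc j))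
    ≡⟨ cong₂ (λ x y → 0ℤ ℤ.+ s ℤ.+ (x ℤ.+ y)) (sum-cong-≗ {n} (λ i → f-sym (fsuc i) fzero)) eq ⟩
  0ℤ ℤ.+ s ℤ.+ (s ℤ.+ + 2 ℤ.* c)
    ≡⟨ ℤ-Solver.solve 2 (λ s c → con 0ℤ :+ s :+ (s :+ con (+ 2) :* c) := con (+ 2) :* (s :+ c)) refl s c ⟩
  + 2 ℤ.* (s ℤ.+ c) ∎)
  where
  open ≡-Reasoning
  open ℤ-Solver using (_:=_; _:+_; _:*_; con)
  s = ∑[ j < n ] f fzero (fsuc j)

square-abs : ∀ i → i ℤ.* i ≡ + (∣ i ∣ * ∣ i ∣)
square-abs (+ n)    = sym (ℤ.pos-* n n)
square-abs -[1+ n ] = refl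

square-injective : ∀ m n → m * m ≡ n * n → m ≡ n
square-injective m n eq with ℕ.<-cmp m n
... | tri< m<n _ _ = contradiction eq (ℕ.<⇒≢ (ℕ.*-mono-< m<n m<n))
... | tri≈ _ m≡n _ = m≡n
... | tri> _ _ n<m = contradiction (sym eq) (ℕ.<⇒≢ (ℕ.*-mono-< n<m n<m))

-- The form 8 x² + y² at y = 3 z - x.
opaque
  F : ℤ → ℤ → ℤ
  F x z = + 9 ℤ.* (x ℤ.* x) ℤ.- + 6 ℤ.* (x ℤ.* z) ℤ.+ + 9 ℤ.* (z ℤ.* z)

module _ where
  open ℤ-Solver using (solve; _:=_; _:+_; _:*_; _:-_; :-_; con; Polynomial)

  opaque
    unfolding F

    private
      :F : ∀ {n} → Polynomial n → Polynomial n → Polynomial n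
      :F x z = con (+ 9) :* (x :* x) :- con (+ 6) :* (x :* z) :+ con (+ 9) :* (z :* z)

    F-sym : ∀ x z → F x z ≡ F z x
    F-sym = solve 2 (λ x z → :F x z := :F z x) refl

    -- For z of negative sign the swap moves the sign to the other variable, so that the absolute
    -- values are still exchanged and the first one stays positive.
    F-neg-sym : ∀ x z → F x (ℤ.- z) ≡ F z (ℤ.- x)
    F-neg-sym = solve 2 (λ x z → :F x (:- z) := :F z (:- x)) refl

    F-norm : ∀ x z → F x z ≡ (+ 3 ℤ.* z ℤ.- x) ℤ.* (+ 3 ℤ.* z ℤ.- x) ℤ.+ + 8 ℤ.* (x ℤ.* x)
    F-norm = solve 2 (λ x z → :F x z := (con (+ 3) :* z :- x) :* (con (+ 3) :* z :- x) :+ con (+ 8) :* (x :* x)) refl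

    F-*3 : ∀ c z → F (+ 3 ℤ.* c) z ≡ + 9 ℤ.* (+ 9 ℤ.* (c ℤ.* c) ℤ.- + 2 ℤ.* (c ℤ.* z) ℤ.+ z ℤ.* z)
    F-*3 = solve 2 (λ c z → :F (con (+ 3) :* c) z := con (+ 9) :* (con (+ 9) :* (c :* c) :- con (+ 2) :* (c :* z) :+ z :* z)) refl

    F-0 : ∀ x → F x 0ℤ ≡ + 9 ℤ.* (x ℤ.* x)
    F-0 = solve 1 (λ x → :F x (con 0ℤ) := con (+ 9) :* (x :* x)) refl

    F-diag : ∀ x → F x x ≡ + 12 ℤ.* (x ℤ.* x)
    F-diag = solve 1 (λ x → :F x x := con (+ 12) :* (x :* x)) refl

    F-antidiag : ∀ x → F x (ℤ.- x) ≡ + 12 ℤ.* (+ 2 ℤ.* (x ℤ.* x))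
    F-antidiag = solve 1 (λ x → :F x (:- x) := con (+ 12) :* (con (+ 2) :* (x :* x))) refl

    -- For fixed x the form is quadratic in z, and two different z with the same value add up to 2 x
    -- / 3, which is an integer only if 3 divides x.
    F-difference : ∀ x z z′ → + 3 ℤ.* (z ℤ.- z′) ℤ.* (+ 3 ℤ.* (z ℤ.+ z′) ℤ.- + 2 ℤ.* x) ≡ F x z ℤ.- F x z′
    F-difference = solve 3 (λ x z z′ → con (+ 3) :* (z :- z′) :* (con (+ 3) :* (z :+ z′) :- con (+ 2) :* x) :=
      :F x z :- :F x z′) refl

24k+24i : ∀ k i → suc (24 * (k + i)) ≡ suc (k * 3 * 8) + 24 * i
24k+24i = solve 2 (λ k i → con 1 :+ con 24 :* (k :+ i) := con 1 :+ k :* con 3 :* con 8 :+ con 24 :* i) refl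
  where open ℕ-Solver using (solve; _:=_; _:+_; _:*_; con)

module Representations (N : ℕ) (3∤N : ¬ 3 ℕ.∣ N) where
  open ℤ-Solver using (solve; _:=_; _:+_; _:*_; _:-_; :-_; con)
  open ≡-Reasoning

  opaque
    M : ℤ
    M = + 24 ℤ.* + N ℤ.+ + 9

    M≡ : M ≡ + 24 ℤ.* + N ℤ.+ + 9
    M≡ = refl

  M-9 : ∀ t → + 9 ℤ.* t ≡ M → + 24 ℤ.* + N ≡ + 9 ℤ.* (t ℤ.- 1ℤ)
  M-9 t eq = begin
    + 24 ℤ.* + N                   ≡⟨ solve 1 (λ n → n := n :+ con (+ 9) :- con (+ 9)) refl (+ 24 ℤ.* + N) ⟩
    + 24 ℤ.* + N ℤ.+ + 9 ℤ.- + 9   ≡⟨ cong (ℤ._- + 9) (trans eq M≡) ⟨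
    + 9 ℤ.* t ℤ.- + 9              ≡⟨ solve 1 (λ t → con (+ 9) :* t :- con (+ 9) := con (+ 9) :* (t :- con 1ℤ)) refl t ⟩
    + 9 ℤ.* (t ℤ.- 1ℤ)             ∎

  -- From 9 ∣ 24 N would follow 9 ∣ 27 N - 24 N = 3 N, against 3 ∤ N.
  9∤M : ∀ t → + 9 ℤ.* t ≢ M
  9∤M t eq = 3∤N (Signed.∣⇒∣ᵤ {+ 3} {+ N} (divides (+ 3 ℤ.* + N ℤ.- t′) (ℤ.*-cancelˡ-≡ (+ 3) (+ N) _ (begin
    + 3 ℤ.* + N
      ≡⟨ solve 1 (λ n → con (+ 3) :* n := con (+ 27) :* n :- con (+ 24) :* n) refl (+ N) ⟩
    + 27 ℤ.* + N ℤ.- + 24 ℤ.* + N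
      ≡⟨ cong (λ y → + 27 ℤ.* + N ℤ.- y) (M-9 t eq) ⟩
    + 27 ℤ.* + N ℤ.- + 9 ℤ.* t′
      ≡⟨ solve 2 (λ n t → con (+ 27) :* n :- con (+ 9) :* t := con (+ 3) :* ((con (+ 3) :* n :- t) :* con (+ 3))) refl (+ N) t′ ⟩
    + 3 ℤ.* ((+ 3 ℤ.* + N ℤ.- t′) ℤ.* + 3) ∎))))
    where t′ = t ℤ.- 1ℤ

  12∤M : ∀ t → + 12 ℤ.* t ≢ M
  12∤M t eq = from-no (12 ℕ.∣? 9) (Signed.∣⇒∣ᵤ {+ 12} {+ 9} (divides (t ℤ.- + 2 ℤ.* + N) (begin
    + 9
      ≡⟨ solve 1 (λ n → con (+ 9) := con (+ 24) :* n :+ con (+ 9) :- con (+ 24) :* n) refl (+ N) ⟩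
    + 24 ℤ.* + N ℤ.+ + 9 ℤ.- + 24 ℤ.* + N
      ≡⟨ cong (λ y → y ℤ.- + 24 ℤ.* + N) (trans eq M≡) ⟨
    + 12 ℤ.* t ℤ.- + 24 ℤ.* + N
      ≡⟨ solve 2 (λ t n → con (+ 12) :* t :- con (+ 24) :* n := (t :- con (+ 2) :* n) :* con (+ 12)) refl t (+ N) ⟩
    (t ℤ.- + 2 ℤ.* + N) ℤ.* + 12 ∎)))

  F-3∤ : ∀ x z c → F x z ≡ M → x ≢ + 3 ℤ.* c
  F-3∤ x z c eq refl = 9∤M (+ 9 ℤ.* (c ℤ.* c) ℤ.- + 2 ℤ.* (c ℤ.* z) ℤ.+ z ℤ.* z) (trans (sym (F-*3 c z)) eq)

  F-functional : ∀ x z z′ → F x z ≡ M → F x z′ ≡ M → z ≡ z′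
  F-functional x z z′ eq eq′ with ℤ.i*j≡0⇒i≡0∨j≡0 (+ 3 ℤ.* (z ℤ.- z′)) {+ 3 ℤ.* (z ℤ.+ z′) ℤ.- + 2 ℤ.* x}
    (trans (F-difference x z z′) (trans (cong₂ ℤ._-_ eq eq′) (ℤ.+-inverseʳ M)))
  ... | inj₁ 3[z-z′]≡0 = ℤ.i-j≡0⇒i≡j z z′ (ℤ.*-cancelˡ-≡ (+ 3) (z ℤ.- z′) 0ℤ 3[z-z′]≡0)
  -- With s = z + z′, the identity x = 3 (x - s) + (3 s - 2 x) exhibits x as a multiple of 3.
  ... | inj₂ 3[z+z′]≡2x = contradiction (begin
    x
      ≡⟨ solve 2 (λ x s → x := con (+ 3) :* (x :- s) :+ (con (+ 3) :* s :- con (+ 2) :* x)) refl x (z ℤ.+ z′) ⟩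
    + 3 ℤ.* (x ℤ.- (z ℤ.+ z′)) ℤ.+ (+ 3 ℤ.* (z ℤ.+ z′) ℤ.- + 2 ℤ.* x)
      ≡⟨ cong (λ y → + 3 ℤ.* (x ℤ.- (z ℤ.+ z′)) ℤ.+ y) 3[z+z′]≡2x ⟩
    + 3 ℤ.* (x ℤ.- (z ℤ.+ z′)) ℤ.+ 0ℤ
      ≡⟨ ℤ.+-identityʳ _ ⟩
    + 3 ℤ.* (x ℤ.- (z ℤ.+ z′)) ∎) (F-3∤ x z (x ℤ.- (z ℤ.+ z′)) eq)

  -- The sign of z is forgotten so that x and z range over the same set and the relation can be
  -- symmetric; `F-R` rules out z = 0.
  R : ℕ → ℕ → Set
  R x z = F (+ suc x) (+ suc z) ≡ M ⊎ F (+ suc x) -[1+ z ] ≡ M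

  R? : ∀ x z → Dec (R x z)
  R? x z = (F (+ suc x) (+ suc z) ℤ.≟ M) ⊎-dec (F (+ suc x) -[1+ z ] ℤ.≟ M)

  R-sym : ∀ x z → R x z → R z x
  R-sym x z (inj₁ eq) = inj₁ (trans (F-sym (+ suc z) (+ suc x)) eq)
  R-sym x z (inj₂ eq) = inj₂ (trans (F-neg-sym (+ suc z) (+ suc x)) eq)

  R-irreflexive : ∀ x → ¬ R x x
  R-irreflexive x (inj₁ eq) = 12∤M (+ suc x ℤ.* + suc x) (trans (sym (F-diag (+ suc x))) eq)
  R-irreflexive x (inj₂ eq) = 12∤M (+ 2 ℤ.* (+ suc x ℤ.* + suc x)) (trans (sym (F-antidiag (+ suc x))) eq)

  R-root : ∀ x z → R x z → ∃ λ ζ → ∣ ζ ∣ ≡ suc z × F (+ suc x) ζ ≡ M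
  R-root x z (inj₁ eq) = + suc z , refl , eq
  R-root x z (inj₂ eq) = -[1+ z ] , refl , eq

  R-functional : ∀ x z z′ → R x z → R x z′ → z ≡ z′
  R-functional x z z′ r r′
    with ζ , ∣ζ∣ , eq ← R-root x z r | ζ′ , ∣ζ′∣ , eq′ ← R-root x z′ r′
    with refl ← F-functional (+ suc x) ζ ζ′ eq eq′ = ℕ.suc-injective (trans (sym ∣ζ∣) ∣ζ′∣)

  -- A nonzero term of the coefficient of q^N in w A: x² = 3 i + 1 and y² = 24 (N - i) + 1, so that
  -- 8 x² + y² = 24 N + 9. The positive root y is determined by i and stays hidden in `Square⁺`.
  E : ℕ → ℕ → Set
  E x i = suc x * suc x ≡ suc (i * 3) × Square⁺ (suc ((N ℕ.∸ i) * 3 * 8))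

  ℤ-square : ∀ x n → suc x * suc x ≡ suc n → + suc x ℤ.* + suc x ≡ 1ℤ ℤ.+ + n
  ℤ-square x n eq = trans (sym (ℤ.pos-* (suc x) (suc x))) (cong +_ eq)

  ℤ-square-3 : ∀ x i → suc x * suc x ≡ suc (i * 3) → + suc x ℤ.* + suc x ≡ 1ℤ ℤ.+ + i ℤ.* + 3
  ℤ-square-3 x i eq = trans (ℤ-square x (i * 3) eq) (cong (λ y → 1ℤ ℤ.+ y) (ℤ.pos-* i 3))

  -- With y = 3 z - x the value of the form is 8 x² + y²; as 3 ∤ x, there is an i with x² = 3 i + 1,
  -- and y² = 24 (N - i) + 1 is what remains.
  F-E : ∀ x z → F (+ suc x) z ≡ M → ∃ λ i → i ≤ N × E x i
  F-E x z eq with square-mod-3 (suc x)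
  ... | inj₁ (k , x≡) = contradiction (trans (cong +_ (trans x≡ (ℕ.*-comm k 3))) (ℤ.pos-* 3 k)) (F-3∤ (+ suc x) z (+ k) eq)
  ... | inj₂ (i , x²) = i , i≤N , x² , positive-root ∣ y ∣ root
    where
    X y : ℤ
    X = + suc x
    y = + 3 ℤ.* z ℤ.- X
    y² : ∣ y ∣ * ∣ y ∣ + 24 * i ≡ suc (24 * N)
    y² = ℤ.+-injective (begin
      + (∣ y ∣ * ∣ y ∣ + 24 * i)
        ≡⟨ ℤ.pos-+ (∣ y ∣ * ∣ y ∣) (24 * i) ⟩
      + (∣ y ∣ * ∣ y ∣) ℤ.+ + (24 * i)
        ≡⟨ cong₂ ℤ._+_ (sym (square-abs y)) (ℤ.pos-* 24 i) ⟩
      y ℤ.* y ℤ.+ + 24 ℤ.* + i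
        ≡⟨ solve 3 (λ x y i → y :+ con (+ 24) :* i :=
             y :+ con (+ 8) :* x :+ con (+ 8) :* (con 1ℤ :+ i :* con (+ 3) :- x) :- con (+ 8)) refl (X ℤ.* X) (y ℤ.* y) (+ i) ⟩
      y ℤ.* y ℤ.+ + 8 ℤ.* (X ℤ.* X) ℤ.+ + 8 ℤ.* (1ℤ ℤ.+ + i ℤ.* + 3 ℤ.- X ℤ.* X) ℤ.- + 8
        ≡⟨ cong₂ (λ s t → s ℤ.+ + 8 ℤ.* (1ℤ ℤ.+ + i ℤ.* + 3 ℤ.- t) ℤ.- + 8)
             (trans (sym (F-norm X z)) (trans eq M≡)) (ℤ-square-3 x i x²) ⟩
      + 24 ℤ.* + N ℤ.+ + 9 ℤ.+ + 8 ℤ.* (1ℤ ℤ.+ + i ℤ.* + 3 ℤ.- (1ℤ ℤ.+ + i ℤ.* + 3)) ℤ.- + 8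
        ≡⟨ solve 2 (λ n i → con (+ 24) :* n :+ con (+ 9) :+ con (+ 8) :*
             (con 1ℤ :+ i :* con (+ 3) :- (con 1ℤ :+ i :* con (+ 3))) :- con (+ 8) :=
               con 1ℤ :+ con (+ 24) :* n) refl (+ N) (+ i) ⟩
      1ℤ ℤ.+ + 24 ℤ.* + N
        ≡⟨ cong (λ t → 1ℤ ℤ.+ t) (ℤ.pos-* 24 N) ⟨
      + suc (24 * N) ∎)
    i≤N : i ≤ N
    -- 24 i ≤ y² + 24 i = 24 N + 1 < 24 (N + 1).
    i≤N = ℕ.s≤s⁻¹ (ℕ.*-cancelˡ-< 24 i (suc N) (ℕ.≤-<-trans (ℕ.m≤n+m (24 * i) (∣ y ∣ * ∣ y ∣))
      (subst (_< 24 * suc N) (sym y²) (subst (suc (24 * N) <_) (sym (ℕ.*-suc 24 N))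
        (ℕ.+-monoˡ-< (24 * N) {1} {24} (s≤s (s≤s z≤n)))))))
    root : ∣ y ∣ * ∣ y ∣ ≡ suc ((N ℕ.∸ i) * 3 * 8)
    root = ℕ.+-cancelʳ-≡ (24 * i) (∣ y ∣ * ∣ y ∣) (suc ((N ℕ.∸ i) * 3 * 8)) (trans y² (trans
      (cong (λ n → suc (24 * n)) (sym (ℕ.m∸n+n≡m i≤N)))
      (24k+24i (N ℕ.∸ i) i)))
    positive-root : ∀ m {n} → m * m ≡ suc n → Square⁺ (suc n)
    positive-root (suc m) eq = m , eq

  R-E : ∀ x z → R x z → ∃ λ i → i ≤ N × E x i
  R-E x z r with ζ , _ , eq ← R-root x z r = F-E x ζ eq

  -- By symmetry z can take the place of x, and then (z + 1)² = 3 i + 1 ≤ 3 N + 1.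
  R-bound : ∀ x z → R x z → z < suc (N * 3)
  R-bound x z r with i , i≤N , z² , _ ← R-E z x (R-sym x z r) =
    ℕ.≤-trans (subst (suc z ≤_) z² (ℕ.m≤m*n (suc z) (suc z))) (s≤s (ℕ.*-monoˡ-≤ 3 i≤N))

  F-R : ∀ x z → F (+ suc x) z ≡ M → ∃ λ z′ → R x z′
  F-R x (+ suc z)  eq = z , inj₁ eq
  F-R x -[1+ z ]   eq = z , inj₂ eq
  F-R x (+ zero)   eq = contradiction (trans (sym (F-0 (+ suc x))) eq) (9∤M (+ suc x ℤ.* + suc x))

  -- x² - y² = 9 x² - (8 x² + y²) is divisible by 3, hence so is x - y or x + y, and the quotient by
  -- 3 is the signed z.
  E-R : ∀ x i → i ≤ N → E x i → ∃ λ z → R x z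
  E-R x i i≤N (x² , y , y²) = [ minus , plus ]′ (euclidsLemma ∣ X ℤ.- Y ∣ ∣ X ℤ.+ Y ∣ (from-yes (prime? 3))
    (subst (3 ℕ.∣_) (ℤ.abs-* (X ℤ.- Y) (X ℤ.+ Y)) (Signed.∣⇒∣ᵤ {+ 3}
      (divides (+ 3 ℤ.* (X ℤ.* X) ℤ.- + 8 ℤ.* + N ℤ.- + 3) difference))))
    where
    X Y : ℤ
    X = + suc x
    Y = + suc y
    k = N ℕ.∸ i
    norm : Y ℤ.* Y ℤ.+ + 8 ℤ.* (X ℤ.* X) ≡ M
    norm = begin
      Y ℤ.* Y ℤ.+ + 8 ℤ.* (X ℤ.* X)
        ≡⟨ cong₂ (λ s t → s ℤ.+ + 8 ℤ.* t) (ℤ-square y (k * 3 * 8) y²) (ℤ-square-3 x i x²) ⟩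
      1ℤ ℤ.+ + (k * 3 * 8) ℤ.+ + 8 ℤ.* (1ℤ ℤ.+ + i ℤ.* + 3)
        ≡⟨ cong (λ t → 1ℤ ℤ.+ t ℤ.+ + 8 ℤ.* (1ℤ ℤ.+ + i ℤ.* + 3)) (trans (ℤ.pos-* (k * 3) 8) (cong (ℤ._* + 8) (ℤ.pos-* k 3))) ⟩
      1ℤ ℤ.+ + k ℤ.* + 3 ℤ.* + 8 ℤ.+ + 8 ℤ.* (1ℤ ℤ.+ + i ℤ.* + 3)
        ≡⟨ solve 2 (λ k i → con 1ℤ :+ k :* con (+ 3) :* con (+ 8) :+ con (+ 8) :* (con 1ℤ :+ i :* con (+ 3)) :=
             con (+ 24) :* (k :+ i) :+ con (+ 9)) refl (+ k) (+ i) ⟩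
      + 24 ℤ.* (+ k ℤ.+ + i) ℤ.+ + 9
        ≡⟨ cong (λ t → + 24 ℤ.* t ℤ.+ + 9) (trans (sym (ℤ.pos-+ k i)) (cong +_ (ℕ.m∸n+n≡m i≤N))) ⟩
      + 24 ℤ.* + N ℤ.+ + 9
        ≡⟨ M≡ ⟨
      M ∎
    difference : (X ℤ.- Y) ℤ.* (X ℤ.+ Y) ≡ (+ 3 ℤ.* (X ℤ.* X) ℤ.- + 8 ℤ.* + N ℤ.- + 3) ℤ.* + 3
    difference = begin
      (X ℤ.- Y) ℤ.* (X ℤ.+ Y)
        ≡⟨ solve 2 (λ x y → (x :- y) :* (x :+ y) := con (+ 9) :* (x :* x) :- (y :* y :+ con (+ 8) :* (x :* x))) refl X Y ⟩
      + 9 ℤ.* (X ℤ.* X) ℤ.- (Y ℤ.* Y ℤ.+ + 8 ℤ.* (X ℤ.* X))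
        ≡⟨ cong (λ t → + 9 ℤ.* (X ℤ.* X) ℤ.- t) (trans norm M≡) ⟩
      + 9 ℤ.* (X ℤ.* X) ℤ.- (+ 24 ℤ.* + N ℤ.+ + 9)
        ≡⟨ solve 2 (λ x n → con (+ 9) :* x :- (con (+ 24) :* n :+ con (+ 9)) :=
             (con (+ 3) :* x :- con (+ 8) :* n :- con (+ 3)) :* con (+ 3)) refl (X ℤ.* X) (+ N) ⟩
      (+ 3 ℤ.* (X ℤ.* X) ℤ.- + 8 ℤ.* + N ℤ.- + 3) ℤ.* + 3 ∎
    root : ∀ z Y′ → X ℤ.+ Y′ ≡ z ℤ.* + 3 → Y′ ℤ.* Y′ ≡ Y ℤ.* Y → F X z ≡ M
    root z Y′ eq Y′² = begin
      F X z
        ≡⟨ F-norm X z ⟩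
      (+ 3 ℤ.* z ℤ.- X) ℤ.* (+ 3 ℤ.* z ℤ.- X) ℤ.+ + 8 ℤ.* (X ℤ.* X)
        ≡⟨ cong (λ t → (t ℤ.- X) ℤ.* (t ℤ.- X) ℤ.+ + 8 ℤ.* (X ℤ.* X)) (ℤ.*-comm (+ 3) z) ⟩
      (z ℤ.* + 3 ℤ.- X) ℤ.* (z ℤ.* + 3 ℤ.- X) ℤ.+ + 8 ℤ.* (X ℤ.* X)
        ≡⟨ cong (λ t → (t ℤ.- X) ℤ.* (t ℤ.- X) ℤ.+ + 8 ℤ.* (X ℤ.* X)) eq ⟨
      (X ℤ.+ Y′ ℤ.- X) ℤ.* (X ℤ.+ Y′ ℤ.- X) ℤ.+ + 8 ℤ.* (X ℤ.* X)
        ≡⟨ solve 2 (λ x y → (x :+ y :- x) :* (x :+ y :- x) :+ con (+ 8) :* (x :* x) :=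
             y :* y :+ con (+ 8) :* (x :* x)) refl X Y′ ⟩
      Y′ ℤ.* Y′ ℤ.+ + 8 ℤ.* (X ℤ.* X)
        ≡⟨ cong (ℤ._+ + 8 ℤ.* (X ℤ.* X)) Y′² ⟩
      Y ℤ.* Y ℤ.+ + 8 ℤ.* (X ℤ.* X)
        ≡⟨ norm ⟩
      M ∎
    minus : 3 ℕ.∣ ∣ X ℤ.- Y ∣ → ∃ λ z → R x z
    minus 3∣ with divides z eq ← Signed.∣ᵤ⇒∣ {+ 3} {X ℤ.- Y} 3∣ =
      F-R x z (root z (ℤ.- Y) eq (solve 1 (λ y → (:- y) :* (:- y) := y :* y) refl Y))
    plus : 3 ℕ.∣ ∣ X ℤ.+ Y ∣ → ∃ λ z → R x z
    plus 3∣ with divides z eq ← Signed.∣ᵤ⇒∣ {+ 3} {X ℤ.+ Y} 3∣ = F-R x z (root z Y eq refl)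

  private
    K : ℕ
    K = suc (N * 3)

    root? : (x : Fin K) (i : Fin (suc N)) → Dec (suc (toℕ x) * suc (toℕ x) ≡ suc (toℕ i * 3))
    root? x i = suc (toℕ x) * suc (toℕ x) ℕ.≟ suc (toℕ i * 3)

    E? : (x : Fin K) (i : Fin (suc N)) → Dec (E (toℕ x) (toℕ i))
    E? x i = root? x i ×-dec square⁺? (suc ((N ℕ.∸ toℕ i) * 3 * 8))

    partner? : (x : Fin K) → Dec (∃ λ (z : Fin K) → R (toℕ x) (toℕ z))
    partner? x = Fin.any? (λ z → R? (toℕ x) (toℕ z))

  root-count : (i : Fin (suc N)) → sq (suc (toℕ i * 3)) ≡ ∑[ x < K ] 𝟙 (root? x i)
  root-count i = sym (count-unique (λ x → root? x i) (square⁺? (suc (toℕ i * 3)))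
    (λ {x} {x′} p r → Fin.toℕ-injective (ℕ.suc-injective (square-injective (suc (toℕ x)) (suc (toℕ x′)) (trans p (sym r)))))
    (λ {x} p → toℕ x , p)
    (λ (x , p) → let x<K = ℕ.≤-trans (subst (suc x ≤_) p (ℕ.m≤m*n (suc x) (suc x))) (s≤s (ℕ.*-monoˡ-≤ 3 (Fin.toℕ≤pred[n] i))) in
      fromℕ< x<K , subst (λ y → suc y * suc y ≡ suc (toℕ i * 3)) (sym (Fin.toℕ-fromℕ< x<K)) p))

  -- For fixed x, the equation x² = 3 i + 1 determines i, and `R-functional` determines z. Both sums
  -- are therefore 0 or 1, and both are 1 exactly if x has a partner.
  partners : (x : Fin K) → ∑[ i < suc N ] 𝟙 (E? x i) ≡ ∑[ z < K ] 𝟙 (R? (toℕ x) (toℕ z))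
  partners x = trans
    (count-unique (E? x) (partner? x)
      (λ {i} {j} (p , _) (r , _) → Fin.toℕ-injective (ℕ.*-cancelʳ-≡ (toℕ i) (toℕ j) 3 (ℕ.suc-injective (trans (sym p) r))))
      (λ {i} e → let z , r = E-R (toℕ x) (toℕ i) (Fin.toℕ≤pred[n] i) e ; z<K = R-bound (toℕ x) z r in
        fromℕ< z<K , subst (R (toℕ x)) (sym (Fin.toℕ-fromℕ< z<K)) r)
      (λ (z , r) → let i , i≤N , e = R-E (toℕ x) (toℕ z) r in
        fromℕ< (s≤s i≤N) , subst (E (toℕ x)) (sym (Fin.toℕ-fromℕ< (s≤s i≤N))) e))
    (sym (count-unique (λ z → R? (toℕ x) (toℕ z)) (partner? x)
      (λ {z} {z′} r r′ → Fin.toℕ-injective (R-functional (toℕ x) (toℕ z) (toℕ z′) r r′))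
      (λ {z} r → z , r)
      (λ p → p)))

  even-count : ∃ λ c → ∑[ i ≤ N ] (sq (suc (toℕ i * 3)) ℤ.* sq (suc ((N ℕ.∸ toℕ i) * 3 * 8))) ≡ + 2 ℤ.* c
  even-count with c , even-sum ← symmetric-sum-even K (λ x z → 𝟙 (R? (toℕ x) (toℕ z)))
                (λ x z → 𝟙-cong (R? (toℕ x) (toℕ z)) (R? (toℕ z) (toℕ x)) (R-sym (toℕ x) (toℕ z)) (R-sym (toℕ z) (toℕ x)))
                (λ x → 𝟙-no (R? (toℕ x) (toℕ x)) (R-irreflexive (toℕ x))) = c , (begin
    ∑[ i ≤ N ] (sq (suc (toℕ i * 3)) ℤ.* sq (suc ((N ℕ.∸ toℕ i) * 3 * 8)))
      -- Only the first square is expanded into its roots x; the second stays an indicator, since x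
      -- alone is to be paired.
      ≡⟨ sum-cong-≗ {suc N} (λ i → trans (cong (ℤ._* sq (suc ((N ℕ.∸ toℕ i) * 3 * 8))) (root-count i))
           (trans (*-distribʳ-sum (sq (suc ((N ℕ.∸ toℕ i) * 3 * 8))) (λ x → 𝟙 (root? x i)))
             (sum-cong-≗ {K} (λ x → 𝟙-× (root? x i) (square⁺? (suc ((N ℕ.∸ toℕ i) * 3 * 8))))))) ⟩
    ∑[ i ≤ N ] ∑[ x < K ] 𝟙 (E? x i)
      ≡⟨ ∑-comm (λ i x → 𝟙 (E? x i)) ⟩
    ∑[ x < K ] ∑[ i ≤ N ] 𝟙 (E? x i)
      ≡⟨ sum-cong-≗ {K} partners ⟩
    ∑[ x < K ] ∑[ z < K ] 𝟙 (R? (toℕ x) (toℕ z))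
      ≡⟨ even-sum ⟩
    + 2 ℤ.* c ∎)

-- The ring of power series

module Identities {c ℓ} (R : CommutativeRing c ℓ)
  (morphism : CommutativeRing.rawRing ℤ.+-*-commutativeRing -Raw-AlmostCommutative⟶ fromCommutativeRing R)
  where
  open CommutativeRing R renaming (_+_ to _⊞_; _*_ to _⊠_; refl to ≈-refl; sym to ≈-sym; trans to ≈-trans)
  open _-Raw-AlmostCommutative⟶_ morphism using (⟦_⟧)

  coeff≟ : ∀ i j → Maybe (⟦ i ⟧ ≈ ⟦ j ⟧)
  coeff≟ i j with i ℤ.≟ j
  ... | yes refl = just ≈-refl
  ... | no _     = nothing

  open RingSolver (CommutativeRing.rawRing ℤ.+-*-commutativeRing) (fromCommutativeRing R) morphism coeff≟ public using
    (solve; _:=_; _:+_; _:*_; _:-_; :-_; con)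

  -- Gathers the factors that one induction step of `finite-φφ⁻` adds. Exchanging a with d and b
  -- with c turns one side of that identity into the other and, by `swap-scale`, leaves the gathered
  -- factor unchanged.
  split-finite : ∀ a b c d p p′ r → a ⊠ (b ⊠ p) ⊠ (a ⊠ (c ⊠ p′)) ⊠ ((d ⊠ r) ⊠ (d ⊠ r)) ≈
                                    (a ⊠ a ⊠ (d ⊠ d)) ⊠ (b ⊠ c) ⊠ (p ⊠ p′ ⊠ (r ⊠ r))
  split-finite = solve 7 (λ a b c d p p′ r → a :* (b :* p) :* (a :* (c :* p′)) :* ((d :* r) :* (d :* r)) :=
    (a :* a :* (d :* d)) :* (b :* c) :* (p :* p′ :* (r :* r))) ≈-refl

  swap-scale : ∀ a b c d z → (a ⊠ a ⊠ (d ⊠ d)) ⊠ (b ⊠ c) ⊠ z ≈ (d ⊠ d ⊠ (a ⊠ a)) ⊠ (c ⊠ b) ⊠ z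
  swap-scale = solve 5 (λ a b c d z → (a :* a :* (d :* d)) :* (b :* c) :* z := (d :* d :* (a :* a)) :* (c :* b) :* z) ≈-refl

  pair-factors : ∀ p p′ r f g → p ⊠ p′ ⊠ (r ⊠ r) ⊠ (f ⊠ g) ≈ (p ⊠ g) ⊠ (p′ ⊠ f) ⊠ (r ⊠ r)
  pair-factors = solve 5 (λ p p′ r f g → p :* p′ :* (r :* r) :* (f :* g) := (p :* g) :* (p′ :* f) :* (r :* r)) ≈-refl

  pull-square : ∀ p p′ r g → p ⊠ p′ ⊠ (r ⊠ g ⊠ (r ⊠ g)) ≈ p ⊠ p′ ⊠ (r ⊠ r) ⊠ (g ⊠ g)
  pull-square = solve 4 (λ p p′ r g → p :* p′ :* (r :* g :* (r :* g)) := p :* p′ :* (r :* r) :* (g :* g)) ≈-refl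

  pair-squares : ∀ p r b f g → p ⊠ p ⊠ (r ⊠ r) ⊠ (b ⊠ (f ⊠ f ⊠ (g ⊠ g))) ≈
                               (p ⊠ f) ⊠ (p ⊠ f) ⊠ ((r ⊠ g) ⊠ (r ⊠ g)) ⊠ b
  pair-squares = solve 5 (λ p r b f g → p :* p :* (r :* r) :* (b :* (f :* f :* (g :* g))) :=
          (p :* f) :* (p :* f) :* ((r :* g) :* (r :* g)) :* b) ≈-refl

  conjugates : ∀ a q b → (a ⊞ ⟦ + 2 ⟧ ⊠ (q ⊠ b)) ⊠ (a - ⟦ + 2 ⟧ ⊠ (q ⊠ b)) ≈ a ⊠ a - ⟦ + 4 ⟧ ⊠ (q ⊠ q ⊠ (b ⊠ b))
  conjugates = solve 3 (λ a q b → (a :+ con (+ 2) :* (q :* b)) :* (a :- con (+ 2) :* (q :* b)) :=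
    a :* a :- con (+ 4) :* (q :* q :* (b :* b))) ≈-refl

  square-dissected : ∀ a q b → (a ⊞ ⟦ + 2 ⟧ ⊠ (q ⊠ b)) ⊠ (a ⊞ ⟦ + 2 ⟧ ⊠ (q ⊠ b)) ≈
                     (a ⊠ a ⊞ ⟦ + 4 ⟧ ⊠ (q ⊠ q ⊠ (b ⊠ b))) ⊞ q ⊠ (⟦ + 4 ⟧ ⊠ (a ⊠ b))
  square-dissected = solve 3 (λ a q b → (a :+ con (+ 2) :* (q :* b)) :* (a :+ con (+ 2) :* (q :* b)) :=
    (a :* a :+ con (+ 4) :* (q :* q :* (b :* b))) :+ q :* (con (+ 4) :* (a :* b))) ≈-refl

  -- Each squaring gains a factor 2: f² = 1 + 4 t with t = s + s², f⁴ = 1 + 8 r with r = t + 2 t²,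
  -- and f⁸ = 1 + 16 (r + 4 r²).
  eighth-power : ∀ s → ∃ λ k → let f = ⟦ 1ℤ ⟧ ⊞ ⟦ + 2 ⟧ ⊠ s in f ⊠ f ⊠ (f ⊠ f) ⊠ (f ⊠ f ⊠ (f ⊠ f)) ≈ ⟦ 1ℤ ⟧ ⊞ ⟦ + 16 ⟧ ⊠ k
  eighth-power s = _ , solve 1 (λ s → let f = con 1ℤ :+ con (+ 2) :* s ; t = s :+ s :* s ; r = t :+ con (+ 2) :* t :* t in
    f :* f :* (f :* f) :* (f :* f :* (f :* f)) := con 1ℤ :+ con (+ 16) :* (r :+ con (+ 4) :* r :* r)) ≈-refl s

  -- u⁴ ≡ n⁴ ≡ 1 modulo 16, so multiplying by n² turns n⁶ into 1 and u³ into u.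
  mod-256 : ∀ {g u v n y k q} → u ⊠ u ⊠ (u ⊠ u) ≈ ⟦ 1ℤ ⟧ ⊞ ⟦ + 16 ⟧ ⊠ k → n ≈ u - ⟦ + 8 ⟧ ⊠ y →
            g ⊠ (n ⊠ n ⊠ n ⊠ (n ⊠ n ⊠ n)) ≈ ⟦ + 16 ⟧ ⊠ (u ⊠ u ⊠ u ⊠ v) ⊞ q ⊠ (⟦ + 256 ⟧ ⊠ (u ⊠ (v ⊠ v ⊠ v))) →
            ∃ λ h → g ≈ ⟦ + 16 ⟧ ⊠ (u ⊠ v) ⊞ ⟦ + 256 ⟧ ⊠ h
  mod-256 {g} {u} {v} {n} {y} {k} {q} u⁴ n≈ gn⁶ = _ , (begin
    g
      -- With n⁸ = 1 + 16 L, the relation g = g n⁸ - 16 L g is used twice: by itself it shows that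
      -- 16 divides g, and inserted into its own last term it makes that term a multiple of 256.
      ≈⟨ solve 2 (λ g l → g := g :* (con 1ℤ :+ con (+ 16) :* l) :- con (+ 16) :* l :* g) ≈-refl g L ⟩
    g ⊠ (⟦ 1ℤ ⟧ ⊞ ⟦ + 16 ⟧ ⊠ L) - ⟦ + 16 ⟧ ⊠ L ⊠ g
      ≈⟨ +-cong g-unit (-‿cong (*-congˡ g′)) ⟩
    ⟦ + 16 ⟧ ⊠ (u ⊠ v) ⊞ ⟦ + 256 ⟧ ⊠ M - ⟦ + 16 ⟧ ⊠ L ⊠ (⟦ + 16 ⟧ ⊠ (u ⊠ v) ⊞ ⟦ + 256 ⟧ ⊠ M - ⟦ + 16 ⟧ ⊠ L ⊠ g)
      ≈⟨ solve 4 (λ p m l g → con (+ 16) :* p :+ con (+ 256) :* m :- con (+ 16) :* l :*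
           (con (+ 16) :* p :+ con (+ 256) :* m :- con (+ 16) :* l :* g)
           := con (+ 16) :* p :+ con (+ 256) :* (m :- l :* (p :+ con (+ 16) :* m :- l :* g))) ≈-refl (u ⊠ v) M L g ⟩
    ⟦ + 16 ⟧ ⊠ (u ⊠ v) ⊞ ⟦ + 256 ⟧ ⊠ (M - L ⊠ (u ⊠ v ⊞ ⟦ + 16 ⟧ ⊠ M - L ⊠ g)) ∎)
    where
    open SetoidReasoning setoid
    -- The terms -32 u³ y, 384 u² y², -2048 u y³ and 4096 y⁴ of (u - 8 y)⁴, divided by 16.
    l = k - ⟦ + 2 ⟧ ⊠ (u ⊠ u ⊠ u ⊠ y) ⊞ ⟦ + 24 ⟧ ⊠ (u ⊠ u ⊠ y ⊠ y) - ⟦ + 128 ⟧ ⊠ (u ⊠ y ⊠ y ⊠ y) ⊞ ⟦ + 256 ⟧ ⊠ (y ⊠ y ⊠ y ⊠ y)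
    L = ⟦ + 2 ⟧ ⊠ l ⊞ ⟦ + 16 ⟧ ⊠ l ⊠ l
    m = k ⊠ u - u ⊠ u ⊠ (u ⊠ u) ⊠ y ⊞ ⟦ + 4 ⟧ ⊠ (u ⊠ u ⊠ u ⊠ (y ⊠ y))
    M = m ⊠ v ⊞ q ⊠ (u ⊠ (v ⊠ v ⊠ v)) ⊠ (n ⊠ n)
    n⁴ : n ⊠ n ⊠ (n ⊠ n) ≈ ⟦ 1ℤ ⟧ ⊞ ⟦ + 16 ⟧ ⊠ l
    n⁴ = begin
      n ⊠ n ⊠ (n ⊠ n)
        ≈⟨ *-cong (*-cong n≈ n≈) (*-cong n≈ n≈) ⟩
      (u - ⟦ + 8 ⟧ ⊠ y) ⊠ (u - ⟦ + 8 ⟧ ⊠ y) ⊠ ((u - ⟦ + 8 ⟧ ⊠ y) ⊠ (u - ⟦ + 8 ⟧ ⊠ y))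
        ≈⟨ solve 2 (λ u y → let n = u :- con (+ 8) :* y in n :* n :* (n :* n) := u :* u :* (u :* u) :+ con (+ 16) :*
             (:- (con (+ 2) :* (u :* u :* u :* y)) :+ con (+ 24) :* (u :* u :* y :* y) :- con (+ 128) :*
               (u :* y :* y :* y) :+ con (+ 256) :* (y :* y :* y :* y))) ≈-refl u y ⟩
      u ⊠ u ⊠ (u ⊠ u) ⊞ ⟦ + 16 ⟧ ⊠ (- (⟦ + 2 ⟧ ⊠ (u ⊠ u ⊠ u ⊠ y)) ⊞ ⟦ + 24 ⟧ ⊠ (u ⊠ u ⊠ y ⊠ y) - ⟦ + 128 ⟧ ⊠
        (u ⊠ y ⊠ y ⊠ y) ⊞ ⟦ + 256 ⟧ ⊠ (y ⊠ y ⊠ y ⊠ y))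
        ≈⟨ +-congʳ u⁴ ⟩
      ⟦ 1ℤ ⟧ ⊞ ⟦ + 16 ⟧ ⊠ k ⊞ ⟦ + 16 ⟧ ⊠ (- (⟦ + 2 ⟧ ⊠ (u ⊠ u ⊠ u ⊠ y)) ⊞ ⟦ + 24 ⟧ ⊠ (u ⊠ u ⊠ y ⊠ y) - ⟦ + 128 ⟧ ⊠
        (u ⊠ y ⊠ y ⊠ y) ⊞ ⟦ + 256 ⟧ ⊠ (y ⊠ y ⊠ y ⊠ y))
        ≈⟨ solve 5 (λ k a b c d → con 1ℤ :+ con (+ 16) :* k :+ con (+ 16) :* (:- a :+ b :- c :+ d) :=
             con 1ℤ :+ con (+ 16) :* (k :- a :+ b :- c :+ d)) ≈-refl k _ _ _ _ ⟩
      ⟦ 1ℤ ⟧ ⊞ ⟦ + 16 ⟧ ⊠ l ∎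
    u³n² : u ⊠ u ⊠ u ⊠ (n ⊠ n) ≈ u ⊞ ⟦ + 16 ⟧ ⊠ m
    u³n² = begin
      u ⊠ u ⊠ u ⊠ (n ⊠ n)
        ≈⟨ *-congˡ (*-cong n≈ n≈) ⟩
      u ⊠ u ⊠ u ⊠ ((u - ⟦ + 8 ⟧ ⊠ y) ⊠ (u - ⟦ + 8 ⟧ ⊠ y))
        ≈⟨ solve 2 (λ u y → let n = u :- con (+ 8) :* y ; u⁴ = u :* u :* (u :* u) in u :* u :* u :* (n :* n) :=
             u⁴ :* u :+ con (+ 16) :* (:- (u⁴ :* y) :+ con (+ 4) :* (u :* u :* u :* (y :* y)))) ≈-refl u y ⟩
      u ⊠ u ⊠ (u ⊠ u) ⊠ u ⊞ ⟦ + 16 ⟧ ⊠ (- (u ⊠ u ⊠ (u ⊠ u) ⊠ y) ⊞ ⟦ + 4 ⟧ ⊠ (u ⊠ u ⊠ u ⊠ (y ⊠ y)))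
        ≈⟨ +-congʳ (*-congʳ u⁴) ⟩
      (⟦ 1ℤ ⟧ ⊞ ⟦ + 16 ⟧ ⊠ k) ⊠ u ⊞ ⟦ + 16 ⟧ ⊠ (- (u ⊠ u ⊠ (u ⊠ u) ⊠ y) ⊞ ⟦ + 4 ⟧ ⊠ (u ⊠ u ⊠ u ⊠ (y ⊠ y)))
        ≈⟨ solve 4 (λ k u a b → (con 1ℤ :+ con (+ 16) :* k) :* u :+ con (+ 16) :* (:- a :+ b) :=
             u :+ con (+ 16) :* (k :* u :- a :+ b)) ≈-refl k u _ _ ⟩
      u ⊞ ⟦ + 16 ⟧ ⊠ m ∎
    g-unit : g ⊠ (⟦ 1ℤ ⟧ ⊞ ⟦ + 16 ⟧ ⊠ L) ≈ ⟦ + 16 ⟧ ⊠ (u ⊠ v) ⊞ ⟦ + 256 ⟧ ⊠ M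
    g-unit = begin
      g ⊠ (⟦ 1ℤ ⟧ ⊞ ⟦ + 16 ⟧ ⊠ L)
        ≈⟨ solve 2 (λ g l → g :* (con 1ℤ :+ con (+ 16) :* (con (+ 2) :* l :+ con (+ 16) :* l :* l)) :=
             g :* ((con 1ℤ :+ con (+ 16) :* l) :* (con 1ℤ :+ con (+ 16) :* l))) ≈-refl g l ⟩
      g ⊠ ((⟦ 1ℤ ⟧ ⊞ ⟦ + 16 ⟧ ⊠ l) ⊠ (⟦ 1ℤ ⟧ ⊞ ⟦ + 16 ⟧ ⊠ l))
        ≈⟨ *-congˡ (*-cong n⁴ n⁴) ⟨
      g ⊠ (n ⊠ n ⊠ (n ⊠ n) ⊠ (n ⊠ n ⊠ (n ⊠ n)))
        ≈⟨ solve 2 (λ g n → g :* (n :* n :* (n :* n) :* (n :* n :* (n :* n))) :=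
             g :* (n :* n :* n :* (n :* n :* n)) :* (n :* n)) ≈-refl g n ⟩
      g ⊠ (n ⊠ n ⊠ n ⊠ (n ⊠ n ⊠ n)) ⊠ (n ⊠ n)
        ≈⟨ *-congʳ gn⁶ ⟩
      (⟦ + 16 ⟧ ⊠ (u ⊠ u ⊠ u ⊠ v) ⊞ q ⊠ (⟦ + 256 ⟧ ⊠ (u ⊠ (v ⊠ v ⊠ v)))) ⊠ (n ⊠ n)
        ≈⟨ solve 5 (λ a v q b n → (con (+ 16) :* (a :* v) :+ q :* (con (+ 256) :* b)) :* n :=
             con (+ 16) :* (a :* n :* v) :+ con (+ 256) :* (q :* b :* n)) ≈-refl
             (u ⊠ u ⊠ u) v q (u ⊠ (v ⊠ v ⊠ v)) (n ⊠ n) ⟩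
      ⟦ + 16 ⟧ ⊠ (u ⊠ u ⊠ u ⊠ (n ⊠ n) ⊠ v) ⊞ ⟦ + 256 ⟧ ⊠ (q ⊠ (u ⊠ (v ⊠ v ⊠ v)) ⊠ (n ⊠ n))
        ≈⟨ +-congʳ (*-congˡ (*-congʳ u³n²)) ⟩
      ⟦ + 16 ⟧ ⊠ ((u ⊞ ⟦ + 16 ⟧ ⊠ m) ⊠ v) ⊞ ⟦ + 256 ⟧ ⊠ (q ⊠ (u ⊠ (v ⊠ v ⊠ v)) ⊠ (n ⊠ n))
        ≈⟨ solve 4 (λ u m v c → con (+ 16) :* ((u :+ con (+ 16) :* m) :* v) :+ con (+ 256) :* c :=
             con (+ 16) :* (u :* v) :+ con (+ 256) :* (m :* v :+ c)) ≈-refl u m v _ ⟩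
      ⟦ + 16 ⟧ ⊠ (u ⊠ v) ⊞ ⟦ + 256 ⟧ ⊠ M ∎
    g′ : g ≈ ⟦ + 16 ⟧ ⊠ (u ⊠ v) ⊞ ⟦ + 256 ⟧ ⊠ M - ⟦ + 16 ⟧ ⊠ L ⊠ g
    g′ = begin
      g                                                   ≈⟨ solve 2 (λ g l → g :=
        g :* (con 1ℤ :+ con (+ 16) :* l) :- con (+ 16) :* l :* g) ≈-refl g L ⟩
      g ⊠ (⟦ 1ℤ ⟧ ⊞ ⟦ + 16 ⟧ ⊠ L) - ⟦ + 16 ⟧ ⊠ L ⊠ g      ≈⟨ +-congʳ g-unit ⟩
      ⟦ + 16 ⟧ ⊠ (u ⊠ v) ⊞ ⟦ + 256 ⟧ ⊠ M - ⟦ + 16 ⟧ ⊠ L ⊠ g ∎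
  -- δ stands for the substitution of q² or q³ for q.
  module Endomorphism (δ : Carrier → Carrier)
    (δ-cong : ∀ {x y} → x ≈ y → δ x ≈ δ y) (δ-+ : ∀ x y → δ (x ⊞ y) ≈ δ x ⊞ δ y)
    (δ-* : ∀ x y → δ (x ⊠ y) ≈ δ x ⊠ δ y) (δ-const : ∀ c → δ ⟦ c ⟧ ≈ ⟦ c ⟧) where
    open SetoidReasoning setoid

    hom-c : ∀ {c} → ⟦ c ⟧ ≈ δ ⟦ c ⟧
    hom-c = ≈-sym (δ-const _)
    hom : ∀ {x} → δ x ≈ δ x
    hom = ≈-refl
    infixl 6 _⟨+⟩_
    infixl 7 _⟨*⟩_
    -- Following the shape of a term, these combinators bring δ from the leaves to the outside.
    _⟨+⟩_ : ∀ {x y x′ y′} → x′ ≈ δ x → y′ ≈ δ y → x′ ⊞ y′ ≈ δ (x ⊞ y)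
    p ⟨+⟩ r = ≈-trans (+-cong p r) (≈-sym (δ-+ _ _))
    _⟨*⟩_ : ∀ {x y x′ y′} → x′ ≈ δ x → y′ ≈ δ y → x′ ⊠ y′ ≈ δ (x ⊠ y)
    p ⟨*⟩ r = ≈-trans (*-cong p r) (≈-sym (δ-* _ _))

    -- Since δ(g²) = f g, the factor δ(g⁶) is f² g² δ(g)², and g² δ(g)² cancels b. Lying in the
    -- image of δ, the factor will not mix even and odd coefficients of b.
    sixth-power : ∀ b f g → b ⊠ (g ⊠ g ⊠ (δ g ⊠ δ g)) ≈ 1# → f ⊠ g ≈ δ (g ⊠ g) →
                  b ⊠ δ (g ⊠ g ⊠ (g ⊠ g) ⊠ (g ⊠ g)) ≈ f ⊠ f
    sixth-power b f g b-unit fg≈ = begin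
      b ⊠ δ (g ⊠ g ⊠ (g ⊠ g) ⊠ (g ⊠ g))
        ≈⟨ *-congˡ (≈-trans (δ-* _ _) (*-cong (δ-* _ _) (δ-* g g))) ⟩
      b ⊠ (δ (g ⊠ g) ⊠ δ (g ⊠ g) ⊠ (δ g ⊠ δ g))
        ≈⟨ *-congˡ (*-congʳ (*-cong fg≈ fg≈)) ⟨
      b ⊠ (f ⊠ g ⊠ (f ⊠ g) ⊠ (δ g ⊠ δ g))
        ≈⟨ solve 4 (λ b f g h → b :* (f :* g :* (f :* g) :* (h :* h)) :=
             b :* (g :* g :* (h :* h)) :* (f :* f)) ≈-refl b f g (δ g) ⟩
      b ⊠ (g ⊠ g ⊠ (δ g ⊠ δ g)) ⊠ (f ⊠ f)
        ≈⟨ *-congʳ b-unit ⟩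
      1# ⊠ (f ⊠ f)
        ≈⟨ *-identityˡ (f ⊠ f) ⟩
      f ⊠ f ∎

    -- The same device once more: δ(g¹²) = f⁶ g⁶, where g⁶ turns b into f².
    twelfth-power : ∀ b f g → b ⊠ (g ⊠ g ⊠ (g ⊠ g) ⊠ (g ⊠ g)) ≈ f ⊠ f → f ⊠ g ≈ δ (g ⊠ g) →
                    b ⊠ δ (g ⊠ g ⊠ (g ⊠ g) ⊠ (g ⊠ g) ⊠ (g ⊠ g ⊠ (g ⊠ g) ⊠ (g ⊠ g))) ≈
                    f ⊠ f ⊠ (f ⊠ f) ⊠ (f ⊠ f ⊠ (f ⊠ f))
    twelfth-power b f g b-g⁶ fg≈ = begin
      b ⊠ δ (g ⊠ g ⊠ (g ⊠ g) ⊠ (g ⊠ g) ⊠ (g ⊠ g ⊠ (g ⊠ g) ⊠ (g ⊠ g)))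
        ≈⟨ *-congˡ (≈-trans (δ-* _ _) (*-cong δ³ δ³)) ⟩
      b ⊠ (f ⊠ g ⊠ (f ⊠ g) ⊠ (f ⊠ g) ⊠ (f ⊠ g ⊠ (f ⊠ g) ⊠ (f ⊠ g)))
        ≈⟨ solve 3 (λ b f g → b :* (f :* g :* (f :* g) :* (f :* g) :* (f :* g :* (f :* g) :* (f :* g))) :=
             b :* (g :* g :* (g :* g) :* (g :* g)) :* (f :* f :* (f :* f) :* (f :* f))) ≈-refl b f g ⟩
      b ⊠ (g ⊠ g ⊠ (g ⊠ g) ⊠ (g ⊠ g)) ⊠ (f ⊠ f ⊠ (f ⊠ f) ⊠ (f ⊠ f))
        ≈⟨ *-congʳ b-g⁶ ⟩
      f ⊠ f ⊠ (f ⊠ f ⊠ (f ⊠ f) ⊠ (f ⊠ f))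
        ≈⟨ solve 1 (λ u → u :* (u :* u :* u) := u :* u :* (u :* u)) ≈-refl (f ⊠ f) ⟩
      f ⊠ f ⊠ (f ⊠ f) ⊠ (f ⊠ f ⊠ (f ⊠ f)) ∎
      where
      δ³ : δ (g ⊠ g ⊠ (g ⊠ g) ⊠ (g ⊠ g)) ≈ f ⊠ g ⊠ (f ⊠ g) ⊠ (f ⊠ g)
      δ³ = ≈-trans (δ-* _ _) (*-cong (≈-trans (δ-* _ _) (*-cong (≈-sym fg≈) (≈-sym fg≈))) (≈-sym fg≈))

    -- The odd terms of (U + 4 q V)⁴ are 4 · 4 q U³ V and 4 · 64 q³ U V³, which explains 16 and 256;
    -- the even terms make up `e`.
    fourth-power-dissected : ∀ q u v → q ⊠ q ≈ δ q → u ≈ δ u ⊞ q ⊠ δ (⟦ + 4 ⟧ ⊠ v) → ∃ λ e →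
      u ⊠ u ⊠ (u ⊠ u) ≈ δ e ⊞ q ⊠ δ (⟦ + 16 ⟧ ⊠ (u ⊠ u ⊠ u ⊠ v) ⊞ q ⊠ (⟦ + 256 ⟧ ⊠ (u ⊠ (v ⊠ v ⊠ v))))
    fourth-power-dissected q u v q² u≈ = _ , (begin
      u ⊠ u ⊠ (u ⊠ u)
        ≈⟨ *-cong (*-cong u≈′ u≈′) (*-cong u≈′ u≈′) ⟩
      w ⊠ w ⊠ (w ⊠ w)
        ≈⟨ solve 3 (λ u q v →
             let w = u :+ q :* (con (+ 4) :* v) in w :* w :* (w :* w) :=
             (u :* u :* (u :* u) :+ q :* q :* (con (+ 96) :* (u :* u :* (v :* v)) :+ q :* q :*
               (con (+ 256) :* (v :* v :* (v :* v)))))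
             :+ q :* (con (+ 16) :* (u :* u :* u :* v) :+ q :* q :* (con (+ 256) :* (u :* (v :* v :* v))))) ≈-refl (δ u) q (δ v) ⟩
      (δ u ⊠ δ u ⊠ (δ u ⊠ δ u) ⊞ q ⊠ q ⊠ (⟦ + 96 ⟧ ⊠ (δ u ⊠ δ u ⊠ (δ v ⊠ δ v)) ⊞ q ⊠ q ⊠ (⟦ + 256 ⟧ ⊠ (δ v ⊠ δ v ⊠ (δ v ⊠ δ v)))))
        ⊞ q ⊠ (⟦ + 16 ⟧ ⊠ (δ u ⊠ δ u ⊠ δ u ⊠ δ v) ⊞ q ⊠ q ⊠ (⟦ + 256 ⟧ ⊠ (δ u ⊠ (δ v ⊠ δ v ⊠ δ v))))
        ≈⟨ +-cong
             ((hom ⟨*⟩ hom ⟨*⟩ (hom ⟨*⟩ hom)) ⟨+⟩ (q² ⟨*⟩ ((hom-c ⟨*⟩ (hom ⟨*⟩ hom ⟨*⟩ (hom ⟨*⟩ hom))) ⟨+⟩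
               (q² ⟨*⟩ (hom-c ⟨*⟩ (hom ⟨*⟩ hom ⟨*⟩ (hom ⟨*⟩ hom)))))))
             (*-congˡ ((hom-c ⟨*⟩ (hom ⟨*⟩ hom ⟨*⟩ hom ⟨*⟩ hom)) ⟨+⟩ (q² ⟨*⟩ (hom-c ⟨*⟩ (hom ⟨*⟩ (hom ⟨*⟩ hom ⟨*⟩ hom)))))) ⟩
      δ e ⊞ q ⊠ δ (⟦ + 16 ⟧ ⊠ (u ⊠ u ⊠ u ⊠ v) ⊞ q ⊠ (⟦ + 256 ⟧ ⊠ (u ⊠ (v ⊠ v ⊠ v)))) ∎)
      where
      w e : Carrier
      w = δ u ⊞ q ⊠ (⟦ + 4 ⟧ ⊠ δ v)
      e = u ⊠ u ⊠ (u ⊠ u) ⊞ q ⊠ (⟦ + 96 ⟧ ⊠ (u ⊠ u ⊠ (v ⊠ v)) ⊞ q ⊠ (⟦ + 256 ⟧ ⊠ (v ⊠ v ⊠ (v ⊠ v))))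
      u≈′ : u ≈ w
      u≈′ = ≈-trans u≈ (+-congˡ (*-congˡ (≈-trans (δ-* _ v) (*-congʳ (δ-const (+ 4))))))

    thirds-of-square : ∀ q f g a w A B → q ⊠ q ⊠ q ≈ δ q →
      f ≈ δ a ⊞ q ⊠ δ (⟦ + 2 ⟧ ⊠ w) → g ≈ δ A ⊞ q ⊠ δ B → ∃ λ e₀ → ∃ λ e₁ →
      f ⊠ f ⊠ (g ⊠ g) ≈ δ e₀ ⊞ (q ⊠ δ e₁ ⊞ q ⊠ (q ⊠ δ
        (⟦ + 4 ⟧ ⊠ ((w ⊠ A ⊞ a ⊠ B) ⊠ (w ⊠ A ⊞ a ⊠ B)) - ⟦ + 3 ⟧ ⊠ (a ⊠ B ⊠ (a ⊠ B)))))
    thirds-of-square q f g a w A B q³ f≈ g≈ = e₀ , e₁ , (begin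
      f ⊠ f ⊠ (g ⊠ g)
        ≈⟨ *-cong (*-cong f≈ f≈) (*-cong g≈ g≈) ⟩
      (δ a ⊞ q ⊠ δ t) ⊠ (δ a ⊞ q ⊠ δ t) ⊠ ((δ A ⊞ q ⊠ δ B) ⊠ (δ A ⊞ q ⊠ δ B))
        ≈⟨ solve 5 (λ q a t A B → (a :+ q :* t) :* (a :+ q :* t) :* ((A :+ q :* B) :* (A :+ q :* B)) :=
             (a :* A :* (a :* A) :+ q :* q :* q :* (con (+ 2) :* ((t :* A :+ a :* B) :* (t :* B)))) :+
             (q :* (con (+ 2) :* (a :* A :* (t :* A :+ a :* B)) :+ q :* q :* q :* (t :* B :* (t :* B))) :+
              q :* (q :* ((t :* A :+ a :* B) :* (t :* A :+ a :* B) :+ con (+ 2) :* (a :* A :* (t :* B)))))) ≈-refl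
             q (δ a) (δ t) (δ A) (δ B) ⟩
      (δ a ⊠ δ A ⊠ (δ a ⊠ δ A) ⊞ q ⊠ q ⊠ q ⊠ (⟦ + 2 ⟧ ⊠ ((δ t ⊠ δ A ⊞ δ a ⊠ δ B) ⊠ (δ t ⊠ δ B)))) ⊞
      (q ⊠ (⟦ + 2 ⟧ ⊠ (δ a ⊠ δ A ⊠ (δ t ⊠ δ A ⊞ δ a ⊠ δ B)) ⊞ q ⊠ q ⊠ q ⊠ (δ t ⊠ δ B ⊠ (δ t ⊠ δ B))) ⊞
       q ⊠ (q ⊠ ((δ t ⊠ δ A ⊞ δ a ⊠ δ B) ⊠ (δ t ⊠ δ A ⊞ δ a ⊠ δ B) ⊞ ⟦ + 2 ⟧ ⊠ (δ a ⊠ δ A ⊠ (δ t ⊠ δ B)))))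
        ≈⟨ +-cong (p ⟨*⟩ p ⟨+⟩ q³ ⟨*⟩ (hom-c ⟨*⟩ (r ⟨*⟩ s)))
             (+-cong (*-congˡ (hom-c ⟨*⟩ (p ⟨*⟩ r) ⟨+⟩ q³ ⟨*⟩ (s ⟨*⟩ s)))
                     (*-congˡ (*-congˡ (r ⟨*⟩ r ⟨+⟩ hom-c ⟨*⟩ (p ⟨*⟩ s))))) ⟩
      δ e₀ ⊞ (q ⊠ δ e₁ ⊞ q ⊠ (q ⊠ δ ((t ⊠ A ⊞ a ⊠ B) ⊠ (t ⊠ A ⊞ a ⊠ B) ⊞ ⟦ + 2 ⟧ ⊠ (a ⊠ A ⊠ (t ⊠ B)))))
        -- At t = 2 w the two cross terms are both 4 w A a B, as in the expansion of 4 (w A + a B)²,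
        -- which exceeds the rest by 3 (a B)².
        ≈⟨ +-congˡ (+-congˡ (*-congˡ (*-congˡ (δ-cong (solve 4 (λ a w A B → let t = con (+ 2) :* w in
             (t :* A :+ a :* B) :* (t :* A :+ a :* B) :+ con (+ 2) :* (a :* A :* (t :* B)) :=
             con (+ 4) :* ((w :* A :+ a :* B) :* (w :* A :+ a :* B)) :- con (+ 3) :* (a :* B :* (a :* B))) ≈-refl a w A B))))) ⟩
      δ e₀ ⊞ (q ⊠ δ e₁ ⊞ q ⊠ (q ⊠ δ
        (⟦ + 4 ⟧ ⊠ ((w ⊠ A ⊞ a ⊠ B) ⊠ (w ⊠ A ⊞ a ⊠ B)) - ⟦ + 3 ⟧ ⊠ (a ⊠ B ⊠ (a ⊠ B))))) ∎)
      where
      t e₀ e₁ : Carrier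
      t  = ⟦ + 2 ⟧ ⊠ w
      e₀ = a ⊠ A ⊠ (a ⊠ A) ⊞ q ⊠ (⟦ + 2 ⟧ ⊠ ((t ⊠ A ⊞ a ⊠ B) ⊠ (t ⊠ B)))
      e₁ = ⟦ + 2 ⟧ ⊠ (a ⊠ A ⊠ (t ⊠ A ⊞ a ⊠ B)) ⊞ q ⊠ (t ⊠ B ⊠ (t ⊠ B))
      p : δ a ⊠ δ A ≈ δ (a ⊠ A)
      p = hom ⟨*⟩ hom
      r : δ t ⊠ δ A ⊞ δ a ⊠ δ B ≈ δ (t ⊠ A ⊞ a ⊠ B)
      r = hom ⟨*⟩ hom ⟨+⟩ hom ⟨*⟩ hom
      s : δ t ⊠ δ B ≈ δ (t ⊠ B)
      s = hom ⟨*⟩ hom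

-- Ring operations on series

infixl 7 _⊛_
infix  9 _^2
infixl 6 _⊕_
infix 8 ⊝_

_⊕_ : Series → Series → Series
(f ⊕ g) n = f n ℤ.+ g n

⊝_ : Series → Series
(⊝ f) n = ℤ.- f n

0ₛ : Series
0ₛ _ = 0ℤ

tail : Series → Series
tail f n = f (suc n)

_•_ : ℤ → Series → Series
(c • f) n = c ℤ.* f n

const : ℤ → Series
const c = c ·q^ 0

-- Opaque, because unification would otherwise unfold products into sums.
opaque
  _⊛_ : Series → Series → Series
  _⊛_ = _·_

  ·-⊛ : ∀ f g → f · g ≗ f ⊛ g
  ·-⊛ f g n = refl

  ⊛-zero : ∀ f g → (f ⊛ g) 0 ≡ f 0 ℤ.* g 0
  ⊛-zero f g = ℤ.+-identityʳ (f 0 ℤ.* g 0)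

  ⊛-cong-≤ : ∀ {f g h k} n → (∀ m → m ≤ n → f m ≡ g m) → (∀ m → m ≤ n → h m ≡ k m) →
             (f ⊛ h) n ≡ (g ⊛ k) n
  ⊛-cong-≤ n f≡g h≡k = sum-cong-≗ {suc n} (λ i →
    cong₂ ℤ._*_ (f≡g (toℕ i) (Fin.toℕ≤pred[n] i)) (h≡k (n ℕ.∸ toℕ i) (ℕ.m∸n≤m n (toℕ i))))

  ⊛-cong : ∀ {f g h k} → f ≗ g → h ≗ k → f ⊛ h ≗ g ⊛ k
  ⊛-cong f≗g h≗k n = sum-cong-≗ {suc n} (λ i → cong₂ ℤ._*_ (f≗g (toℕ i)) (h≗k (n ℕ.∸ toℕ i)))

  ⊛-zeroˡ : ∀ f → 0ₛ ⊛ f ≗ 0ₛ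
  ⊛-zeroˡ f n = sum-replicate-zero (suc n)

module _ where
  open ℤ-Solver using (solve; _:=_; _:+_; _:*_; con)

  opaque
    unfolding _⊛_

    ⊛-distribʳ-⊕ : ∀ h f g → (f ⊕ g) ⊛ h ≗ f ⊛ h ⊕ g ⊛ h
    ⊛-distribʳ-⊕ h f g zero = solve 3 (λ x y z →
      (x :+ y) :* z :+ con 0ℤ := (x :* z :+ con 0ℤ) :+ (y :* z :+ con 0ℤ)) refl (f 0) (g 0) (h 0)
    ⊛-distribʳ-⊕ h f g (suc n) = trans
      (cong (λ s → (f 0 ℤ.+ g 0) ℤ.* h (suc n) ℤ.+ s) (⊛-distribʳ-⊕ h (tail f) (tail g) n))
      (solve 5 (λ x y z s t →
        (x :+ y) :* z :+ (s :+ t) := (x :* z :+ s) :+ (y :* z :+ t)) refl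
        (f 0) (g 0) (h (suc n)) ((tail f ⊛ h) n) ((tail g ⊛ h) n))

    •-⊛ : ∀ c f g → (c • f) ⊛ g ≗ c • (f ⊛ g)
    •-⊛ c f g zero = solve 3 (λ c x y →
      (c :* x) :* y :+ con 0ℤ := c :* (x :* y :+ con 0ℤ)) refl c (f 0) (g 0)
    •-⊛ c f g (suc n) = trans
      (cong (λ s → c ℤ.* f 0 ℤ.* g (suc n) ℤ.+ s) (•-⊛ c (tail f) g n))
      (solve 4 (λ c x y s → (c :* x) :* y :+ c :* s := c :* (x :* y :+ s)) refl
        c (f 0) (g (suc n)) ((tail f ⊛ g) n))

    -- By definition a product splits off the constant term of its left factor; splitting off that
    -- of the right factor is what commutativity needs.
    ⊛-sucʳ : ∀ f g n → (f ⊛ g) (suc n) ≡ (f ⊛ tail g) n ℤ.+ f (suc n) ℤ.* g 0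
    ⊛-sucʳ f g zero = solve 4 (λ x₀ x₁ y₀ y₁ →
      x₀ :* y₁ :+ (x₁ :* y₀ :+ con 0ℤ) := (x₀ :* y₁ :+ con 0ℤ) :+ x₁ :* y₀) refl
      (f 0) (f 1) (g 0) (g 1)
    ⊛-sucʳ f g (suc n) = trans
      (cong (λ s → f 0 ℤ.* g (suc (suc n)) ℤ.+ s) (⊛-sucʳ (tail f) g n))
      (sym (ℤ.+-assoc (f 0 ℤ.* g (suc (suc n))) _ _))

    ⊛-comm : ∀ f g → f ⊛ g ≗ g ⊛ f
    ⊛-comm f g zero    = cong (ℤ._+ 0ℤ) (ℤ.*-comm (f 0) (g 0))
    ⊛-comm f g (suc n) = trans (⊛-sucʳ f g n) (trans
      (cong₂ ℤ._+_ (⊛-comm f (tail g) n) (ℤ.*-comm (f (suc n)) (g 0)))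
      (ℤ.+-comm ((tail g ⊛ f) n) (g 0 ℤ.* f (suc n))))

    ⊛-assoc : ∀ f g h → (f ⊛ g) ⊛ h ≗ f ⊛ (g ⊛ h)
    ⊛-assoc f g h zero = solve 3 (λ x y z →
      (x :* y :+ con 0ℤ) :* z :+ con 0ℤ := x :* (y :* z :+ con 0ℤ) :+ con 0ℤ) refl (f 0) (g 0) (h 0)
    ⊛-assoc f g h (suc n) = begin
      (f 0 ℤ.* g 0 ℤ.+ 0ℤ) ℤ.* h (suc n) ℤ.+ ((f 0 • tail g ⊕ tail f ⊛ g) ⊛ h) n
        ≡⟨ cong₂ ℤ._+_ (cong (ℤ._* h (suc n)) (ℤ.+-identityʳ (f 0 ℤ.* g 0)))
             (trans (⊛-distribʳ-⊕ h (f 0 • tail g) (tail f ⊛ g) n)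
               (cong₂ ℤ._+_ (•-⊛ (f 0) (tail g) h n) (⊛-assoc (tail f) g h n))) ⟩
      f 0 ℤ.* g 0 ℤ.* h (suc n) ℤ.+ (f 0 ℤ.* (tail g ⊛ h) n ℤ.+ (tail f ⊛ (g ⊛ h)) n)
        ≡⟨ solve 5 (λ x y z s t →
             x :* y :* z :+ (x :* s :+ t) := x :* (y :* z :+ s) :+ t) refl
             (f 0) (g 0) (h (suc n)) ((tail g ⊛ h) n) ((tail f ⊛ (g ⊛ h)) n) ⟩
      f 0 ℤ.* (g ⊛ h) (suc n) ℤ.+ (tail f ⊛ (g ⊛ h)) n ∎
      where open ≡-Reasoning

    const-⊛ : ∀ c f → const c ⊛ f ≗ c • f
    const-⊛ c f zero    = ℤ.+-identityʳ _
    const-⊛ c f (suc n) = trans (cong (λ s → c ℤ.* f (suc n) ℤ.+ s) (⊛-zeroˡ f n)) (ℤ.+-identityʳ _)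

    ⊛-identityˡ : ∀ f → one ⊛ f ≗ f
    ⊛-identityˡ f n = trans (const-⊛ 1ℤ f n) (ℤ.*-identityˡ (f n))

_^2 : Series → Series
f ^2 = f ⊛ f

seriesRing : CommutativeRing _ _
seriesRing = record
  { Carrier = Series ; _≈_ = _≗_ ; _+_ = _⊕_ ; _*_ = _⊛_ ; -_ = ⊝_ ; 0# = 0ₛ ; 1# = one
  ; isCommutativeRing = record
    { isRing = record
      { +-isAbelianGroup = record
        { isGroup = record
          { isMonoid = record
            { isSemigroup = record
              { isMagma = record
                { isEquivalence = record
                  { refl = λ _ → refl ; sym = λ p n → sym (p n) ; trans = λ p q n → trans (p n) (q n) }
                ; ∙-cong = λ p q n → cong₂ ℤ._+_ (p n) (q n) }
              ; assoc = λ f g h n → ℤ.+-assoc (f n) (g n) (h n) }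
            ; identity = (λ f n → ℤ.+-identityˡ (f n)) , (λ f n → ℤ.+-identityʳ (f n)) }
          ; inverse = (λ f n → ℤ.+-inverseˡ (f n)) , (λ f n → ℤ.+-inverseʳ (f n))
          ; ⁻¹-cong = λ p n → cong ℤ.-_ (p n) }
        ; comm = λ f g n → ℤ.+-comm (f n) (g n) }
      ; *-cong = ⊛-cong
      ; *-assoc = ⊛-assoc
      ; *-identity = ⊛-identityˡ , (λ f n → trans (⊛-comm f one n) (⊛-identityˡ f n))
      ; distrib = (λ h f g n → trans (⊛-comm h (f ⊕ g) n) (trans (⊛-distribʳ-⊕ h f g n)
                     (cong₂ ℤ._+_ (⊛-comm f h n) (⊛-comm g h n))))
                , ⊛-distribʳ-⊕ }
    ; *-comm = ⊛-comm }
  }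

open CommutativeRing seriesRing using (setoid)
  renaming (sym to ≗-sym; trans to ≗-trans; refl to ≗-refl;
            +-cong to ⊕-cong; -‿cong to ⊝-cong; *-congˡ to ⊛-congˡ)

constMorphism : CommutativeRing.rawRing ℤ.+-*-commutativeRing -Raw-AlmostCommutative⟶ fromCommutativeRing seriesRing
constMorphism = record
  { ⟦_⟧    = const
  ; +-homo = λ { x y zero → refl ; x y (suc n) → refl }
  ; *-homo = λ { x y zero → sym (const-⊛ x (const y) 0)
               ; x y (suc n) → sym (trans (const-⊛ x (const y) (suc n)) (ℤ.*-zeroʳ x)) }
  ; -‿homo = λ { x zero → refl ; x (suc n) → refl }
  ; 0-homo = λ { zero → refl ; (suc n) → refl }
  ; 1-homo = λ _ → refl
  }

open Identities seriesRing constMorphism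
  using (solve; _:=_; _:+_; _:*_; _:-_; :-_; con; split-finite; swap-scale; pair-factors; pull-square; pair-squares;
         conjugates; square-dissected; eighth-power; mod-256; module Endomorphism)

module ≗-Reasoning = SetoidReasoning setoid

-- Long division of `one` by a series with constant term 1 gives its inverse.
⊛-cancelˡ : ∀ c {f g} → c 0 ≡ 1ℤ → c ⊛ f ≗ c ⊛ g → f ≗ g
⊛-cancelˡ c {f} {g} c₀≡1 cf≗cg = begin
  f                ≈⟨ expand f ⟩
  c⁻¹ ⊛ (c ⊛ f)    ≈⟨ ⊛-congˡ {c⁻¹} cf≗cg ⟩
  c⁻¹ ⊛ (c ⊛ g)    ≈⟨ expand g ⟨
  g                ∎
  where
  open ≗-Reasoning
  c⁻¹ = one ÷ c
  expand : ∀ h → h ≗ c⁻¹ ⊛ (c ⊛ h)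
  expand h = begin
    h                ≈⟨ ⊛-identityˡ h ⟨
    one ⊛ h          ≈⟨ ⊛-cong {h = h} (≗-trans (≗-sym (·-⊛ c c⁻¹)) (·-÷ one c c₀≡1)) ≗-refl ⟨
    c ⊛ c⁻¹ ⊛ h      ≈⟨ solve 3 (λ c d h → c :* d :* h := d :* (c :* h)) ≗-refl c c⁻¹ h ⟩
    c⁻¹ ⊛ (c ⊛ h)    ∎

-- spread k c f is q^c f(q^(k+1)).
spread : ℕ → ℕ → Series → Series
spread k zero    f zero    = f 0
spread k zero    f (suc n) = spread k k (tail f) n
spread k (suc c) f zero    = 0ℤ
spread k (suc c) f (suc n) = spread k c f n

spread-cong : ∀ k c {f g} → f ≗ g → spread k c f ≗ spread k c g
spread-cong k zero    f≗g zero    = f≗g 0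
spread-cong k zero    f≗g (suc n) = spread-cong k k (λ m → f≗g (suc m)) n
spread-cong k (suc c) f≗g zero    = refl
spread-cong k (suc c) f≗g (suc n) = spread-cong k c f≗g n

-- The combination `x • f ⊕ g` has the shape of the tail of a product, `f 0 • tail g ⊕ tail f ⊛ g`;
-- additivity is the case x = 1.
spread-linear : ∀ k c x f g → spread k c (x • f ⊕ g) ≗ x • spread k c f ⊕ spread k c g
spread-linear k zero    x f g zero    = refl
spread-linear k zero    x f g (suc n) = spread-linear k k x (tail f) (tail g) n
spread-linear k (suc c) x f g zero    = sym (trans (ℤ.+-identityʳ _) (ℤ.*-zeroʳ x))
spread-linear k (suc c) x f g (suc n) = spread-linear k c x f g n

spread-0 : ∀ k c → spread k c 0ₛ ≗ 0ₛ
spread-0 k zero    zero    = refl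
spread-0 k zero    (suc n) = spread-0 k k n
spread-0 k (suc c) zero    = refl
spread-0 k (suc c) (suc n) = spread-0 k c n

spread-const : ∀ k x → spread k 0 (const x) ≗ const x
spread-const k x zero    = refl
spread-const k x (suc n) = spread-0 k k n

opaque
  unfolding _⊛_

  -- General offsets keep the induction going: a step at offset 0 leaves the tail at offset k.
  spread-⊛ : ∀ k c d f g → spread k c f ⊛ spread k d g ≗ spread k (c + d) (f ⊛ g)
  spread-⊛ k zero zero f g zero = refl
  spread-⊛ k zero zero f g (suc n) = begin
    f 0 ℤ.* spread k k (tail g) n ℤ.+ (spread k k (tail f) ⊛ spread k 0 g) n
      ≡⟨ cong (λ y → f 0 ℤ.* spread k k (tail g) n ℤ.+ y)
           (trans (spread-⊛ k k 0 (tail f) g n) (cong (λ e → spread k e (tail f ⊛ g) n) (ℕ.+-identityʳ k))) ⟩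
    f 0 ℤ.* spread k k (tail g) n ℤ.+ spread k k (tail f ⊛ g) n
      ≡⟨ spread-linear k k (f 0) (tail g) (tail f ⊛ g) n ⟨
    spread k k (tail (f ⊛ g)) n ∎
    where open ≡-Reasoning
  spread-⊛ k zero (suc d) f g zero    = trans (ℤ.+-identityʳ _) (ℤ.*-zeroʳ (f 0))
  spread-⊛ k zero (suc d) f g (suc n) = begin
    (spread k 0 f ⊛ spread k (suc d) g) (suc n)
      ≡⟨ ⊛-sucʳ (spread k 0 f) (spread k (suc d) g) n ⟩
    (spread k 0 f ⊛ spread k d g) n ℤ.+ spread k 0 f (suc n) ℤ.* 0ℤ
      ≡⟨ cong (λ y → (spread k 0 f ⊛ spread k d g) n ℤ.+ y) (ℤ.*-zeroʳ (spread k 0 f (suc n))) ⟩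
    (spread k 0 f ⊛ spread k d g) n ℤ.+ 0ℤ
      ≡⟨ ℤ.+-identityʳ _ ⟩
    (spread k 0 f ⊛ spread k d g) n
      ≡⟨ spread-⊛ k 0 d f g n ⟩
    spread k d (f ⊛ g) n ∎
    where open ≡-Reasoning
  spread-⊛ k (suc c) d f g zero    = refl
  spread-⊛ k (suc c) d f g (suc n) = trans (ℤ.+-identityˡ _) (spread-⊛ k c d f g n)

dilate : ℕ → Series → Series
dilate k = spread k 0

δ₂ δ₃ : Series → Series
δ₂ = dilate 1
δ₃ = dilate 2

q : Series
q = 1ℤ ·q^ 1

opaque
  unfolding _⊛_

  q⊛-zero : ∀ f → (q ⊛ f) 0 ≡ 0ℤ
  q⊛-zero f = refl

  q⊛-suc : ∀ f n → (q ⊛ f) (suc n) ≡ f n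
  q⊛-suc f n = trans (ℤ.+-identityˡ _) (⊛-identityˡ f n)

dilate-⊕ : ∀ k f g → dilate k (f ⊕ g) ≗ dilate k f ⊕ dilate k g
dilate-⊕ k f g n = begin
  dilate k (f ⊕ g) n                    ≡⟨ spread-cong k 0 (λ m → cong (ℤ._+ g m) (sym (ℤ.*-identityˡ (f m)))) n ⟩
  dilate k (1ℤ • f ⊕ g) n               ≡⟨ spread-linear k 0 1ℤ f g n ⟩
  1ℤ ℤ.* dilate k f n ℤ.+ dilate k g n  ≡⟨ cong (ℤ._+ dilate k g n) (ℤ.*-identityˡ (dilate k f n)) ⟩
  dilate k f n ℤ.+ dilate k g n         ∎
  where open ≡-Reasoning

dilate-⊛ : ∀ k f g → dilate k (f ⊛ g) ≗ dilate k f ⊛ dilate k g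
dilate-⊛ k f g = ≗-sym (spread-⊛ k 0 0 f g)

dilate-const· : ∀ k x f → dilate k (const x ⊛ f) ≗ const x ⊛ dilate k f
dilate-const· k x f = ≗-trans (dilate-⊛ k (const x) f) (⊛-cong {h = dilate k f} (spread-const k x) ≗-refl)

-- The substitution of -q for q

twist : Series → Series
twist f zero    = f 0
twist f (suc n) = ℤ.- twist (tail f) n

twist-cong : ∀ {f g} → f ≗ g → twist f ≗ twist g
twist-cong f≗g zero    = f≗g 0
twist-cong f≗g (suc n) = cong ℤ.-_ (twist-cong (λ m → f≗g (suc m)) n)

twist-linear : ∀ x f g → twist (x • f ⊕ g) ≗ x • twist f ⊕ twist g
twist-linear x f g zero    = refl
twist-linear x f g (suc n) = trans (cong ℤ.-_ (twist-linear x (tail f) (tail g) n))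
  (trans (ℤ.neg-distrib-+ (x ℤ.* twist (tail f) n) _)
    (cong (ℤ._+ ℤ.- twist (tail g) n) (ℤ.neg-distribʳ-* x (twist (tail f) n))))

twist-⊕ : ∀ f g → twist (f ⊕ g) ≗ twist f ⊕ twist g
twist-⊕ f g zero    = refl
twist-⊕ f g (suc n) = trans (cong ℤ.-_ (twist-⊕ (tail f) (tail g) n)) (ℤ.neg-distrib-+ (twist (tail f) n) _)

opaque
  unfolding _⊛_

  twist-⊛ : ∀ f g → twist (f ⊛ g) ≗ twist f ⊛ twist g
  twist-⊛ f g zero    = refl
  twist-⊛ f g (suc n) = begin
    ℤ.- twist (f 0 • tail g ⊕ tail f ⊛ g) n
      ≡⟨ cong ℤ.-_ (trans (twist-linear (f 0) (tail g) (tail f ⊛ g) n)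
           (cong (λ y → f 0 ℤ.* twist (tail g) n ℤ.+ y) (twist-⊛ (tail f) g n))) ⟩
    ℤ.- (f 0 ℤ.* twist (tail g) n ℤ.+ (twist (tail f) ⊛ twist g) n)
      ≡⟨ ℤ.neg-distrib-+ (f 0 ℤ.* twist (tail g) n) _ ⟩
    ℤ.- (f 0 ℤ.* twist (tail g) n) ℤ.+ ℤ.- (twist (tail f) ⊛ twist g) n
      ≡⟨ cong₂ ℤ._+_ (ℤ.neg-distribʳ-* (f 0) (twist (tail g) n)) (neg-⊛ (twist (tail f)) (twist g) n) ⟩
    f 0 ℤ.* ℤ.- twist (tail g) n ℤ.+ ((⊝ twist (tail f)) ⊛ twist g) n ∎
    where
    open ≡-Reasoning
    neg-⊛ : ∀ f g → ⊝ (f ⊛ g) ≗ (⊝ f) ⊛ g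
    neg-⊛ = solve 2 (λ f g → :- (f :* g) := (:- f) :* g) ≗-refl

twist-0 : twist 0ₛ ≗ 0ₛ
twist-0 zero    = refl
twist-0 (suc n) = cong ℤ.-_ (twist-0 n)

twist-const : ∀ x → twist (const x) ≗ const x
twist-const x zero    = refl
twist-const x (suc n) = cong ℤ.-_ (twist-0 n)

twist-const· : ∀ x f → twist (const x ⊛ f) ≗ const x ⊛ twist f
twist-const· x f = ≗-trans (twist-⊛ (const x) f) (⊛-cong {h = twist f} (twist-const x) ≗-refl)

twist-q : twist q ≗ ⊝ q
twist-q zero    = refl
twist-q (suc n) = cong ℤ.-_ (twist-const 1ℤ n)

twist-dilate : ∀ f → twist (δ₂ f) ≗ δ₂ f
twist-dilate f zero          = refl
twist-dilate f (suc zero)    = refl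
twist-dilate f (suc (suc n)) = trans (ℤ.neg-involutive _) (twist-dilate (tail f) n)

twist-⊝ : ∀ f → twist (⊝ f) ≗ ⊝ twist f
twist-⊝ f zero    = refl
twist-⊝ f (suc n) = cong ℤ.-_ (twist-⊝ (tail f) n)

twist-twist : ∀ f → twist (twist f) ≗ f
twist-twist f zero    = refl
twist-twist f (suc n) = trans (cong ℤ.-_ (twist-⊝ (twist (tail f)) n))
  (trans (ℤ.neg-involutive _) (twist-twist (tail f) n))

-- Even and odd parts

even odd : Series → Series
even f n = f (n * 2)
odd  f n = f (suc (n * 2))

even-dilate : ∀ f → even (δ₂ f) ≗ f
even-dilate f zero    = refl
even-dilate f (suc n) = even-dilate (tail f) n

odd-dilate : ∀ f → odd (δ₂ f) ≗ 0ₛ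
odd-dilate f zero    = refl
odd-dilate f (suc n) = odd-dilate (tail f) n

even-q·dilate : ∀ f → even (q ⊛ δ₂ f) ≗ 0ₛ
even-q·dilate f zero    = q⊛-zero (δ₂ f)
even-q·dilate f (suc n) = trans (q⊛-suc (δ₂ f) (suc (n * 2))) (odd-dilate f n)

odd-q·dilate : ∀ f → odd (q ⊛ δ₂ f) ≗ f
odd-q·dilate f n = trans (q⊛-suc (δ₂ f) (n * 2)) (even-dilate f n)

parity-ext : ∀ {f g} → even f ≗ even g → odd f ≗ odd g → f ≗ g
parity-ext e o zero          = e 0
parity-ext e o (suc zero)    = o 0
parity-ext {f} {g} e o (suc (suc n)) = parity-ext {tail (tail f)} {tail (tail g)} (λ m → e (suc m)) (λ m → o (suc m)) n

2-dissect : ∀ {f g h} → even f ≗ g → odd f ≗ h → f ≗ δ₂ g ⊕ q ⊛ δ₂ h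
2-dissect {f} {g} {h} e o = parity-ext
  (λ n → trans (e n) (sym (trans (cong₂ ℤ._+_ (even-dilate g n) (even-q·dilate h n)) (ℤ.+-identityʳ _))))
  (λ n → trans (o n) (sym (trans (cong₂ ℤ._+_ (odd-dilate g n) (odd-q·dilate h n)) (ℤ.+-identityˡ _))))

even-dissected : ∀ g h → even (δ₂ g ⊕ q ⊛ δ₂ h) ≗ g
even-dissected g h n = trans (cong₂ ℤ._+_ (even-dilate g n) (even-q·dilate h n)) (ℤ.+-identityʳ _)

odd-dissected : ∀ g h → odd (δ₂ g ⊕ q ⊛ δ₂ h) ≗ h
odd-dissected g h n = trans (cong₂ ℤ._+_ (odd-dilate g n) (odd-q·dilate h n)) (ℤ.+-identityˡ _)

-- A factor that is a series in q² preserves the parity of exponents, so that taking even or odd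
-- parts is linear over such factors.
⊛-dilate-dissected : ∀ f g → f ⊛ δ₂ g ≗ δ₂ (even f ⊛ g) ⊕ q ⊛ δ₂ (odd f ⊛ g)
⊛-dilate-dissected f g = begin
  f ⊛ δ₂ g
    ≈⟨ ⊛-cong {h = δ₂ g} (2-dissect {f} ≗-refl ≗-refl) ≗-refl ⟩
  (δ₂ (even f) ⊕ q ⊛ δ₂ (odd f)) ⊛ δ₂ g
    ≈⟨ solve 4 (λ a q b c → (a :+ q :* b) :* c := a :* c :+ q :* (b :* c)) ≗-refl
         (δ₂ (even f)) q (δ₂ (odd f)) (δ₂ g) ⟩
  δ₂ (even f) ⊛ δ₂ g ⊕ q ⊛ (δ₂ (odd f) ⊛ δ₂ g)
    ≈⟨ ⊕-cong (dilate-⊛ 1 (even f) g) (⊛-congˡ {q} (dilate-⊛ 1 (odd f) g)) ⟨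
  δ₂ (even f ⊛ g) ⊕ q ⊛ δ₂ (odd f ⊛ g) ∎
  where open ≗-Reasoning

even-⊛-dilate : ∀ f g → even (f ⊛ δ₂ g) ≗ even f ⊛ g
even-⊛-dilate f g n = trans (⊛-dilate-dissected f g (n * 2)) (even-dissected (even f ⊛ g) (odd f ⊛ g) n)

odd-⊛-dilate : ∀ f g → odd (f ⊛ δ₂ g) ≗ odd f ⊛ g
odd-⊛-dilate f g n = trans (⊛-dilate-dissected f g (suc (n * 2))) (odd-dissected (even f ⊛ g) (odd f ⊛ g) n)

-- Gauss's theta series

⊛-cong-≤-all : ∀ {f g h k} N → (∀ m → m ≤ N → f m ≡ g m) → (∀ m → m ≤ N → h m ≡ k m) →
           ∀ m → m ≤ N → (f ⊛ h) m ≡ (g ⊛ k) m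
⊛-cong-≤-all N f≡g h≡k m m≤N =
  ⊛-cong-≤ m (λ i i≤m → f≡g i (ℕ.≤-trans i≤m m≤N)) (λ i i≤m → h≡k i (ℕ.≤-trans i≤m m≤N))

∞-coeff : ∀ c j .{{_ : ℕ.NonZero j}} {N} m → m ≤ N → [ c q^ j ]∞ m ≡ partialProduct c j N m
∞-coeff c j {N} m m≤N = trans (sym (partialProduct-stable c j m (N ℕ.∸ m)))
  (cong (λ k → partialProduct c j k m) (ℕ.m∸n+n≡m m≤N))

·q^-neg : ∀ c k → (ℤ.- c) ·q^ k ≗ ⊝ (c ·q^ k)
·q^-neg c zero    zero    = refl
·q^-neg c zero    (suc n) = refl
·q^-neg c (suc k) zero    = refl
·q^-neg c (suc k) (suc n) = ·q^-neg c k n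

q^_ : ℕ → Series
q^ n = 1ℤ ·q^ n

opaque
  unfolding _⊛_

  q^-low : ∀ k f m → m < k → (q^ k ⊛ f) m ≡ 0ℤ
  q^-low (suc k) f zero    _         = refl
  q^-low (suc k) f (suc m) (s≤s m<k) = trans (ℤ.+-identityˡ _) (q^-low k f m m<k)

  q^-+ : ∀ m n → q^ (m + n) ≗ q^ m ⊛ q^ n
  q^-+ zero    n i       = sym (⊛-identityˡ (q^ n) i)
  q^-+ (suc m) n zero    = refl
  q^-+ (suc m) n (suc i) = trans (q^-+ m n i) (sym (ℤ.+-identityˡ _))

ε : ℕ → ℤ
ε zero    = 1ℤ
ε (suc n) = ℤ.- ε n

ε-+ : ∀ m n → ε (m + n) ≡ ε m ℤ.* ε n
ε-+ zero    n = sym (ℤ.*-identityˡ _)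
ε-+ (suc m) n = trans (cong ℤ.-_ (ε-+ m n)) (ℤ.neg-distribˡ-* (ε m) (ε n))

ε-double : ∀ n → ε (n * 2) ≡ 1ℤ
ε-double zero    = refl
ε-double (suc n) = trans (ℤ.neg-involutive _) (ε-double n)

ε-square : ∀ n → ε (n * n) ≡ ε n
ε-square zero    = refl
ε-square (suc n) = cong ℤ.-_ (begin
  ε (n + n * suc n)          ≡⟨ cong (λ k → ε (n + k)) (ℕ.*-suc n n) ⟩
  ε (n + (n + n * n))        ≡⟨ cong ε (n+n+m n (n * n)) ⟩
  ε (n * 2 + n * n)          ≡⟨ ε-+ (n * 2) (n * n) ⟩
  ε (n * 2) ℤ.* ε (n * n)    ≡⟨ cong₂ ℤ._*_ (ε-double n) (ε-square n) ⟩
  1ℤ ℤ.* ε n                 ≡⟨ ℤ.*-identityˡ _ ⟩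
  ε n                        ∎)
  where open ≡-Reasoning

twist-coeff : ∀ f n → twist f n ≡ ε n ℤ.* f n
twist-coeff f zero    = sym (ℤ.*-identityˡ _)
twist-coeff f (suc n) = trans (cong ℤ.-_ (twist-coeff (tail f) n)) (ℤ.neg-distribˡ-* (ε n) (f (suc n)))

twist-q^ : ∀ n → twist (q^ n) ≗ const (ε n) ⊛ q^ n
twist-q^ n m = begin
  twist (q^ n) m       ≡⟨ twist-coeff (q^ n) m ⟩
  ε m ℤ.* (q^ n) m     ≡⟨ same ⟩
  ε n ℤ.* (q^ n) m     ≡⟨ const-⊛ (ε n) (q^ n) m ⟨
  (const (ε n) ⊛ q^ n) m ∎
  where
  open ≡-Reasoning
  same : ε m ℤ.* (q^ n) m ≡ ε n ℤ.* (q^ n) m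
  same with m ℕ.≟ n
  ... | yes refl = refl
  ... | no  m≢n  = trans (cong (ε m ℤ.*_) (·q^-≢ 1ℤ m≢n)) (trans (ℤ.*-zeroʳ (ε m))
                     (sym (trans (cong (ε n ℤ.*_) (·q^-≢ 1ℤ m≢n)) (ℤ.*-zeroʳ (ε n)))))

θ : ℕ → Series
θ zero    = 0ₛ
θ (suc K) = θ K ⊕ q^ (suc K * suc K)

θ-coeff : ∀ K m → θ K m ≡ 𝟙 (ℕ.anyUpTo? (λ x → suc x * suc x ℕ.≟ m) K)
θ-coeff zero    m = refl
θ-coeff (suc K) m with m ℕ.≟ suc K * suc K
... | yes refl = begin
  θ K m ℤ.+ (q^ m) m  ≡⟨ cong₂ ℤ._+_ (trans (θ-coeff K m) (𝟙-no (ℕ.anyUpTo? P? K) none)) (at m) ⟩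
  1ℤ                  ≡⟨ 𝟙-yes (ℕ.anyUpTo? P? (suc K)) (K , ℕ.≤-refl , refl) ⟨
  𝟙 (ℕ.anyUpTo? P? (suc K)) ∎
  where
  open ≡-Reasoning
  P? = λ x → suc x * suc x ℕ.≟ m
  none : ¬ (∃ λ x → x < K × suc x * suc x ≡ m)
  none (x , x<K , eq) = ℕ.<⇒≢ (ℕ.*-mono-< (s≤s x<K) (s≤s x<K)) eq
  at : ∀ n → (q^ n) n ≡ 1ℤ
  at zero    = refl
  at (suc n) = at n
... | no m≢ = begin
  θ K m ℤ.+ (q^ (suc K * suc K)) m  ≡⟨ cong₂ ℤ._+_ (θ-coeff K m) (·q^-≢ 1ℤ m≢) ⟩
  𝟙 (ℕ.anyUpTo? P? K) ℤ.+ 0ℤ          ≡⟨ ℤ.+-identityʳ _ ⟩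
  𝟙 (ℕ.anyUpTo? P? K)                 ≡⟨ 𝟙-cong (ℕ.anyUpTo? P? K) (ℕ.anyUpTo? P? (suc K)) up down ⟩
  𝟙 (ℕ.anyUpTo? P? (suc K))           ∎
  where
  open ≡-Reasoning
  P? = λ x → suc x * suc x ℕ.≟ m
  up : (∃ λ x → x < K × suc x * suc x ≡ m) → (∃ λ x → x < suc K × suc x * suc x ≡ m)
  up (x , x<K , eq) = x , ℕ.m<n⇒m<1+n x<K , eq
  down : (∃ λ x → x < suc K × suc x * suc x ≡ m) → (∃ λ x → x < K × suc x * suc x ≡ m)
  down (x , s≤s x≤K , eq) = x , ℕ.≤∧≢⇒< x≤K (λ { refl → m≢ (sym eq) }) , eq

-- A square (x + 1)² ≤ K has x < K, so K roots suffice up to q^K.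
θ-sq : ∀ K m → m ≤ K → θ K m ≡ sq m
θ-sq K m m≤K = trans (θ-coeff K m) (𝟙-cong (ℕ.anyUpTo? (λ x → suc x * suc x ℕ.≟ m) K) (square⁺? m)
  (λ (x , _ , eq) → x , eq)
  (λ (x , eq) → x , ℕ.<-≤-trans (subst (x <_) eq (ℕ.m≤m*n (suc x) (suc x))) m≤K , eq))

φ φ⁻ : Series
φ   = one ⊕ const (+ 2) ⊛ sq
φ⁻  = twist φ

-- The sum of (-1)^x q^(x²) over the integers x with |x| ≤ K, because (-1)^(x²) = (-1)^x.
T : ℕ → Series
T K = twist (one ⊕ const (+ 2) ⊛ θ K)

T-suc : ∀ K → T (suc K) ≗ T K ⊕ const (+ 2) ⊛ (const (ε (suc K)) ⊛ q^ (suc K * suc K))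
T-suc K = begin
  twist (one ⊕ two ⊛ (θ K ⊕ z))
    ≈⟨ twist-cong (solve 2 (λ t z → con 1ℤ :+ con (+ 2) :* (t :+ z) :=
         (con 1ℤ :+ con (+ 2) :* t) :+ con (+ 2) :* z) ≗-refl (θ K) z) ⟩
  twist ((one ⊕ two ⊛ θ K) ⊕ two ⊛ z)
    ≈⟨ twist-⊕ (one ⊕ two ⊛ θ K) (two ⊛ z) ⟩
  T K ⊕ twist (two ⊛ z)
    ≈⟨ ⊕-cong {T K} ≗-refl (≗-trans (twist-const· (+ 2) z) (⊛-congˡ {two} twist-z)) ⟩
  T K ⊕ two ⊛ (const (ε (suc K)) ⊛ z) ∎
  where
  open ≗-Reasoning
  two = const (+ 2)
  z = q^ (suc K * suc K)
  twist-z : twist z ≗ const (ε (suc K)) ⊛ z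
  twist-z = ≗-trans (twist-q^ (suc K * suc K))
    (λ n → cong (λ s → (const s ⊛ z) n) (ε-square (suc K)))

T-φ⁻ : ∀ K m → m ≤ K → φ⁻ m ≡ T K m
T-φ⁻ K m m≤K = begin
  twist φ m          ≡⟨ twist-coeff φ m ⟩
  ε m ℤ.* (one m ℤ.+ (const (+ 2) ⊛ sq) m)   ≡⟨ cong (λ x → ε m ℤ.* (one m ℤ.+ x)) (const-⊛ (+ 2) sq m) ⟩
  ε m ℤ.* (one m ℤ.+ + 2 ℤ.* sq m)   ≡⟨ cong (λ x → ε m ℤ.* (one m ℤ.+ + 2 ℤ.* x)) (θ-sq K m m≤K) ⟨
  ε m ℤ.* (one m ℤ.+ + 2 ℤ.* θ K m)   ≡⟨ cong (λ x → ε m ℤ.* (one m ℤ.+ x)) (const-⊛ (+ 2) (θ K) m) ⟨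
  ε m ℤ.* (one m ℤ.+ (const (+ 2) ⊛ θ K) m)   ≡⟨ twist-coeff (one ⊕ const (+ 2) ⊛ θ K) m ⟨
  T K m ∎
  where open ≡-Reasoning

-- Shanks's finite form of Gauss's identity

P Q : ℕ → Series
P = partialProduct 1ℤ 1
Q = partialProduct -1ℤ 1

factor-1 : ∀ n → factor 1ℤ 1 n ≗ one ⊖ q^ suc n
factor-1 n m = cong (λ k → one m ℤ.- (q^ suc k) m) (ℕ.+-identityʳ n)

factor-neg : ∀ j n → factor -1ℤ j n ≗ one ⊕ q^ (j + j * n)
factor-neg j n m = cong (λ y → one m ℤ.+ y) (trans (cong ℤ.-_ (·q^-neg 1ℤ (j + j * n) m)) (ℤ.neg-involutive _))

P-suc : ∀ n → P (suc n) ≗ (one ⊖ q^ suc n) ⊛ P n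
P-suc n = ≗-trans (·-⊛ (factor 1ℤ 1 n) (P n)) (⊛-cong {h = P n} (factor-1 n) ≗-refl)

Q-suc : ∀ n → Q (suc n) ≗ (one ⊕ q^ suc n) ⊛ Q n
Q-suc n = ≗-trans (·-⊛ (factor -1ℤ 1 n) (Q n)) (⊛-cong {h = Q n} (≗-trans (factor-neg 1 n) (λ m →
  cong (λ k → one m ℤ.+ (q^ suc k) m) (ℕ.+-identityʳ n))) ≗-refl)

D : ℕ → ℕ → Series
D s zero    = one
D s (suc d) = (one ⊖ q^ suc s) ⊛ D (suc s) d

D-top : ∀ s d → D s (suc d) ≗ (one ⊖ q^ suc (s + d)) ⊛ D s d
D-top s zero    m = cong (λ k → ((one ⊖ q^ suc k) ⊛ one) m) (sym (ℕ.+-identityʳ s))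
D-top s (suc d) = begin
  (one ⊖ q^ suc s) ⊛ D (suc s) (suc d)
    ≈⟨ ⊛-congˡ {one ⊖ q^ suc s} (D-top (suc s) d) ⟩
  (one ⊖ q^ suc s) ⊛ ((one ⊖ q^ suc (suc s + d)) ⊛ D (suc s) d)
    ≈⟨ solve 3 (λ a b c → a :* (b :* c) := b :* (a :* c)) ≗-refl (one ⊖ q^ suc s) (one ⊖ q^ suc (suc s + d)) (D (suc s) d) ⟩
  (one ⊖ q^ suc (suc s + d)) ⊛ D s (suc d)
    ≈⟨ (λ m → cong (λ k → ((one ⊖ q^ suc k) ⊛ D s (suc d)) m) (ℕ.+-suc s d)) ⟨
  (one ⊖ q^ suc (s + suc d)) ⊛ D s (suc d) ∎
  where open ≗-Reasoning

D-P : ∀ n → D 0 n ≗ P n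
D-P zero    = ≗-refl
D-P (suc n) = ≗-trans (D-top 0 n) (≗-trans (⊛-congˡ {one ⊖ q^ suc n} (D-P n)) (≗-sym (P-suc n)))

-- After Shanks: Q n ⊛ T n = P n + 2 Σ_{1 ≤ i ≤ n} (-1)^i (P n / P i) Q (i-1) q^(i(n+1)).
-- For n = s + d, W n s d is the part of this sum with i > s, without the factor
-- 2 and with the first sign positive; D s d is P n / P s.
W : ℕ → ℕ → ℕ → Series
W n s zero    = 0ₛ
W n s (suc d) = q^ (suc s * suc n) ⊛ (D (suc s) d ⊛ Q s) ⊖ W n (suc s) d

-- Every term carries q^(i (n + 1)) with i ≥ 1.
W-low : ∀ n s d m → m ≤ n → W n s d m ≡ 0ℤ
W-low n s zero    m m≤n = refl
W-low n s (suc d) m m≤n = cong₂ ℤ._-_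
  (q^-low (suc s * suc n) (D (suc s) d ⊛ Q s) m (ℕ.≤-trans (s≤s m≤n) (ℕ.m≤n*m (suc n) (suc s))))
  (W-low n (suc s) d m m≤n)

-- A telescoping sum: comparing the terms for n + 1 with 1 + q^(n+1) times those for n trades the
-- boundary term at s for the one at s + 1, up to s = n, where the new square exponent (n + 1)²
-- appears.
W-step : ∀ n s d → n ≡ s + d →
  W (suc n) s (suc d) ⊕ q^ (suc s * suc n) ⊛ (D s d ⊛ Q s) ≗
  (one ⊕ q^ suc n) ⊛ W n s d ⊕ const (ε d) ⊛ (Q (suc n) ⊛ q^ (suc n * suc n))
W-step n s zero n≡s+0 with refl ← trans n≡s+0 (ℕ.+-identityʳ s) = begin
  q^ (suc n * suc (suc n)) ⊛ (one ⊛ Q n) ⊖ 0ₛ ⊕ z ⊛ (one ⊛ Q n)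
    ≈⟨ ⊕-cong (⊕-cong (⊛-cong {h = one ⊛ Q n} exponent ≗-refl) (≗-refl {⊝ 0ₛ})) (≗-refl {z ⊛ (one ⊛ Q n)}) ⟩
  x ⊛ z ⊛ (one ⊛ Q n) ⊖ 0ₛ ⊕ z ⊛ (one ⊛ Q n)
    ≈⟨ ⊕-cong (⊕-cong (≗-refl {x ⊛ z ⊛ (one ⊛ Q n)}) (⊝-cong 0-con)) (≗-refl {z ⊛ (one ⊛ Q n)}) ⟩
  x ⊛ z ⊛ (one ⊛ Q n) ⊖ const 0ℤ ⊕ z ⊛ (one ⊛ Q n)
    ≈⟨ solve 3 (λ x z p → x :* z :* (con 1ℤ :* p) :- con 0ℤ :+ z :* (con 1ℤ :* p) :=
         (con 1ℤ :+ x) :* con 0ℤ :+ con 1ℤ :* (((con 1ℤ :+ x) :* p) :* z)) ≗-refl x z (Q n) ⟩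
  (one ⊕ x) ⊛ const 0ℤ ⊕ one ⊛ ((one ⊕ x) ⊛ Q n ⊛ z)
    ≈⟨ ⊕-cong (⊛-congˡ {one ⊕ x} (≗-sym 0-con)) (⊛-congˡ {one} (⊛-cong {h = z} (≗-sym (Q-suc n)) ≗-refl)) ⟩
  (one ⊕ x) ⊛ 0ₛ ⊕ one ⊛ (Q (suc n) ⊛ z) ∎
  where
  open ≗-Reasoning
  x = q^ suc n
  z = q^ (suc n * suc n)
  0-con : 0ₛ ≗ const 0ℤ
  0-con zero    = refl
  0-con (suc n) = refl
  exponent : q^ (suc n * suc (suc n)) ≗ x ⊛ z
  exponent m = trans (cong (λ k → (q^ k) m) (ℕ.*-suc (suc n) (suc n))) (q^-+ (suc n) (suc n * suc n) m)
W-step n s (suc d) n≡ = begin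
  q^ (suc s * suc (suc n)) ⊛ (D (suc s) (suc d) ⊛ Q s) ⊖ W (suc n) (suc s) (suc d) ⊕ z ⊛ (D s (suc d) ⊛ Q s)
    ≈⟨ ⊕-cong (⊕-cong (⊛-cong exponent (⊛-cong {h = Q s} top ≗-refl)) (⊝-cong rest)) (≗-refl {z ⊛ (D s (suc d) ⊛ Q s)}) ⟩
  x ⊛ z ⊛ ((one ⊖ y) ⊛ Dd ⊛ Q s) ⊖ ((one ⊕ y) ⊛ W n (suc s) d ⊕ const (ε d) ⊛ R ⊖ y ⊛ z ⊛ (Dd ⊛ ((one ⊕ x) ⊛ Q s)))
    ⊕ z ⊛ ((one ⊖ x) ⊛ Dd ⊛ Q s)
    -- The coefficients of z d p add up to x (1 - y) + y (1 + x) + (1 - x) = 1 + y.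
    ≈⟨ solve 8 (λ x y z d p w e r → x :* z :* ((con 1ℤ :- y) :* d :* p)
           :- ((con 1ℤ :+ y) :* w :+ e :* r :- y :* z :* (d :* ((con 1ℤ :+ x) :* p))) :+ z :* ((con 1ℤ :- x) :* d :* p)
           := (con 1ℤ :+ y) :* (z :* (d :* p) :- w) :+ (:- e) :* r) ≗-refl
         x y z Dd (Q s) (W n (suc s) d) (const (ε d)) R ⟩
  (one ⊕ y) ⊛ W n s (suc d) ⊕ (⊝ const (ε d)) ⊛ R
    ≈⟨ ⊕-cong (≗-refl {(one ⊕ y) ⊛ W n s (suc d)}) (⊛-cong {h = R} (·q^-neg (ε d) 0) ≗-refl) ⟨
  (one ⊕ y) ⊛ W n s (suc d) ⊕ const (ε (suc d)) ⊛ R ∎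
  where
  open ≗-Reasoning
  n≡′ : n ≡ suc s + d
  n≡′ = trans n≡ (ℕ.+-suc s d)
  x = q^ suc s
  y = q^ suc n
  z = q^ (suc s * suc n)
  Dd = D (suc s) d
  R = Q (suc n) ⊛ q^ (suc n * suc n)
  exponent : q^ (suc s * suc (suc n)) ≗ x ⊛ z
  exponent m = trans (cong (λ k → (q^ k) m) (ℕ.*-suc (suc s) (suc n))) (q^-+ (suc s) (suc s * suc n) m)
  top : D (suc s) (suc d) ≗ (one ⊖ y) ⊛ Dd
  top = ≗-trans (D-top (suc s) d) (λ m → cong (λ k → ((one ⊖ q^ suc k) ⊛ Dd) m) (sym n≡′))
  rest : W (suc n) (suc s) (suc d) ≗
         (one ⊕ y) ⊛ W n (suc s) d ⊕ const (ε d) ⊛ R ⊖ y ⊛ z ⊛ (Dd ⊛ ((one ⊕ x) ⊛ Q s))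
  rest = begin
    W (suc n) (suc s) (suc d)
      ≈⟨ solve 2 (λ w t → w := w :+ t :- t) ≗-refl (W (suc n) (suc s) (suc d)) (q^ (suc (suc s) * suc n) ⊛ (Dd ⊛ Q (suc s))) ⟩
    W (suc n) (suc s) (suc d) ⊕ q^ (suc (suc s) * suc n) ⊛ (Dd ⊛ Q (suc s)) ⊖ q^ (suc (suc s) * suc n) ⊛ (Dd ⊛ Q (suc s))
      ≈⟨ ⊕-cong (W-step n (suc s) d n≡′) (⊝-cong (⊛-cong (q^-+ (suc n) (suc s * suc n)) (⊛-congˡ {Dd} (Q-suc s)))) ⟩
    (one ⊕ y) ⊛ W n (suc s) d ⊕ const (ε d) ⊛ R ⊖ y ⊛ z ⊛ (Dd ⊛ ((one ⊕ x) ⊛ Q s)) ∎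

shanks : ∀ n → Q n ⊛ T n ≗ P n ⊖ const (+ 2) ⊛ W n 0 n
shanks zero = begin
  one ⊛ twist (one ⊕ const (+ 2) ⊛ 0ₛ)  ≈⟨ ⊛-congˡ {one} (≗-trans (twist-cong base) (twist-const 1ℤ)) ⟩
  one ⊛ one                             ≈⟨ ≗-trans (⊛-identityˡ one) (≗-sym base′) ⟩
  one ⊖ const (+ 2) ⊛ 0ₛ                ∎
  where
  open ≗-Reasoning
  zero′ : const (+ 2) ⊛ 0ₛ ≗ 0ₛ
  zero′ = const-⊛ (+ 2) 0ₛ
  base : one ⊕ const (+ 2) ⊛ 0ₛ ≗ one
  base n = trans (cong (λ y → one n ℤ.+ y) (zero′ n)) (ℤ.+-identityʳ (one n))
  base′ : one ⊖ const (+ 2) ⊛ 0ₛ ≗ one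
  base′ n = trans (cong (λ y → one n ℤ.- y) (zero′ n)) (ℤ.+-identityʳ (one n))
shanks (suc n) = begin
  Q (suc n) ⊛ T (suc n)
    ≈⟨ ⊛-congˡ {Q (suc n)} (T-suc n) ⟩
  Q (suc n) ⊛ (T n ⊕ const (+ 2) ⊛ (const (ε (suc n)) ⊛ z))
    ≈⟨ solve 4 (λ a t e z → a :* (t :+ con (+ 2) :* (e :* z)) := a :* t :+ con (+ 2) :* e :* (a :* z))
         ≗-refl (Q (suc n)) (T n) (const (ε (suc n))) z ⟩
  Q (suc n) ⊛ T n ⊕ const (+ 2) ⊛ const (ε (suc n)) ⊛ (Q (suc n) ⊛ z)
    ≈⟨ ⊕-cong first (⊛-cong {h = R} (⊛-congˡ {const (+ 2)} (·q^-neg (ε n) 0)) ≗-refl) ⟩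
  (one ⊕ y) ⊛ (P n ⊖ const (+ 2) ⊛ W n 0 n) ⊕ const (+ 2) ⊛ (⊝ const (ε n)) ⊛ R
    -- (1 + y) P n exceeds (1 - y) P n by 2 y P n, and y P n is the boundary term of `W-step` at s =
    -- 0.
    ≈⟨ solve 5 (λ y p w e r → (con 1ℤ :+ y) :* (p :- con (+ 2) :* w) :+ con (+ 2) :* (:- e) :* r :=
          (con 1ℤ :- y) :* p :- con (+ 2) :* ((con 1ℤ :+ y) :* w :+ e :* r :- y :* (p :* con 1ℤ))) ≗-refl
          y (P n) (W n 0 n) (const (ε n)) R ⟩
  (one ⊖ y) ⊛ P n ⊖ const (+ 2) ⊛ ((one ⊕ y) ⊛ W n 0 n ⊕ const (ε n) ⊛ R ⊖ y ⊛ (P n ⊛ one))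
    ≈⟨ ⊕-cong (P-suc n) (⊝-cong (⊛-congˡ {const (+ 2)} last)) ⟨
  P (suc n) ⊖ const (+ 2) ⊛ W (suc n) 0 (suc n) ∎
  where
  open ≗-Reasoning
  y = q^ suc n
  z = q^ (suc n * suc n)
  R = Q (suc n) ⊛ z
  first : Q (suc n) ⊛ T n ≗ (one ⊕ y) ⊛ (P n ⊖ const (+ 2) ⊛ W n 0 n)
  first = begin
    Q (suc n) ⊛ T n          ≈⟨ ⊛-cong {h = T n} (Q-suc n) ≗-refl ⟩
    (one ⊕ y) ⊛ Q n ⊛ T n    ≈⟨ ⊛-assoc (one ⊕ y) (Q n) (T n) ⟩
    (one ⊕ y) ⊛ (Q n ⊛ T n)  ≈⟨ ⊛-congˡ {one ⊕ y} (shanks n) ⟩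
    (one ⊕ y) ⊛ (P n ⊖ const (+ 2) ⊛ W n 0 n) ∎
  last : W (suc n) 0 (suc n) ≗ (one ⊕ y) ⊛ W n 0 n ⊕ const (ε n) ⊛ R ⊖ y ⊛ (P n ⊛ one)
  last = begin
    W (suc n) 0 (suc n)
      ≈⟨ solve 2 (λ w t → w := w :+ t :- t) ≗-refl (W (suc n) 0 (suc n)) (y ⊛ (P n ⊛ one)) ⟩
    W (suc n) 0 (suc n) ⊕ y ⊛ (P n ⊛ one) ⊖ y ⊛ (P n ⊛ one)
      ≈⟨ ⊕-cong (⊕-cong (≗-refl {W (suc n) 0 (suc n)}) tidy) (≗-refl {⊝ (y ⊛ (P n ⊛ one))}) ⟩
    W (suc n) 0 (suc n) ⊕ q^ (1 * suc n) ⊛ (D 0 n ⊛ Q 0) ⊖ y ⊛ (P n ⊛ one)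
      ≈⟨ ⊕-cong (W-step n 0 n refl) (≗-refl {⊝ (y ⊛ (P n ⊛ one))}) ⟩
    (one ⊕ y) ⊛ W n 0 n ⊕ const (ε n) ⊛ R ⊖ y ⊛ (P n ⊛ one) ∎
    where
    tidy : y ⊛ (P n ⊛ one) ≗ q^ (1 * suc n) ⊛ (D 0 n ⊛ Q 0)
    tidy = ⊛-cong (λ m → cong (λ k → (q^ suc k) m) (sym (ℕ.+-identityʳ n)))
             (⊛-cong {h = one} (≗-sym (D-P n)) ≗-refl)

-- For the coefficient of index n, products and theta series may be cut off at n, and the error term
-- `W n 0 n` starts beyond n.
gauss : [ -1ℤ q^ 1 ]∞ ⊛ φ⁻ ≗ [ 1ℤ q^ 1 ]∞
gauss n = begin
  ([ -1ℤ q^ 1 ]∞ ⊛ φ⁻) n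
    ≡⟨ ⊛-cong-≤ n (λ m m≤n → ∞-coeff -1ℤ 1 m m≤n) (λ m m≤n → T-φ⁻ n m m≤n) ⟩
  (Q n ⊛ T n) n
    ≡⟨ shanks n n ⟩
  P n n ℤ.- (const (+ 2) ⊛ W n 0 n) n
    ≡⟨ cong (λ y → P n n ℤ.- y) (trans (const-⊛ (+ 2) (W n 0 n) n) (cong (+ 2 ℤ.*_) (W-low n 0 n n ℕ.≤-refl))) ⟩
  P n n ℤ.+ 0ℤ
    ≡⟨ ℤ.+-identityʳ _ ⟩
  P n n ∎
  where open ≡-Reasoning

-- The product φ(q) φ(-q) and the inverse of the series of b̄

E₁ Q₁ E₂ Q₂ : Series
E₁ = [ 1ℤ q^ 1 ]∞
Q₁ = [ -1ℤ q^ 1 ]∞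
E₂ = [ 1ℤ q^ 2 ]∞
Q₂ = [ -1ℤ q^ 2 ]∞

dilate-monomial : ∀ c n → δ₂ (c ·q^ n) ≗ c ·q^ (n * 2)
dilate-monomial c zero                = spread-const 1 c
dilate-monomial c (suc n) zero          = refl
dilate-monomial c (suc n) (suc zero)    = refl
dilate-monomial c (suc n) (suc (suc m)) = dilate-monomial c n m

dilate-factor : ∀ c n → δ₂ (factor c 1 n) ≗ factor c 2 n
dilate-factor c n m = begin
  δ₂ (one ⊖ c ·q^ (1 + 1 * n)) m
    ≡⟨ spread-cong 1 0 {g = one ⊕ (ℤ.- c) ·q^ (1 + 1 * n)}
         (λ i → cong (λ y → one i ℤ.+ y) (sym (·q^-neg c (1 + 1 * n) i))) m ⟩
  δ₂ (one ⊕ (ℤ.- c) ·q^ (1 + 1 * n)) m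
    ≡⟨ dilate-⊕ 1 one ((ℤ.- c) ·q^ (1 + 1 * n)) m ⟩
  δ₂ one m ℤ.+ δ₂ ((ℤ.- c) ·q^ (1 + 1 * n)) m
    ≡⟨ cong₂ ℤ._+_ (spread-const 1 1ℤ m) (dilate-monomial (ℤ.- c) (1 + 1 * n) m) ⟩
  one m ℤ.+ ((ℤ.- c) ·q^ ((1 + 1 * n) * 2)) m
    ≡⟨ cong (λ k → one m ℤ.+ ((ℤ.- c) ·q^ k) m)
         (trans (ℕ.*-comm (1 + 1 * n) 2) (trans (ℕ.*-suc 2 (1 * n)) (cong (λ k → 2 + 2 * k) (ℕ.*-identityˡ n)))) ⟩
  one m ℤ.+ ((ℤ.- c) ·q^ (2 + 2 * n)) m
    ≡⟨ cong (λ y → one m ℤ.+ y) (·q^-neg c (2 + 2 * n) m) ⟩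
  factor c 2 n m ∎
  where open ≡-Reasoning

dilate-partialProduct : ∀ c n → δ₂ (partialProduct c 1 n) ≗ partialProduct c 2 n
dilate-partialProduct c zero    = spread-const 1 1ℤ
dilate-partialProduct c (suc n) = begin
  δ₂ (factor c 1 n · partialProduct c 1 n)               ≈⟨ spread-cong 1 0 (·-⊛ (factor c 1 n) (partialProduct c 1 n)) ⟩
  δ₂ (factor c 1 n ⊛ partialProduct c 1 n)               ≈⟨ dilate-⊛ 1 (factor c 1 n) (partialProduct c 1 n) ⟩
  δ₂ (factor c 1 n) ⊛ δ₂ (partialProduct c 1 n)    ≈⟨ ⊛-cong (dilate-factor c n) (dilate-partialProduct c n) ⟩
  factor c 2 n ⊛ partialProduct c 2 n                          ≈⟨ ·-⊛ (factor c 2 n) (partialProduct c 2 n) ⟨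
  factor c 2 n · partialProduct c 2 n                          ∎
  where open ≗-Reasoning

dilate-∞ : ∀ c → δ₂ [ c q^ 1 ]∞ ≗ [ c q^ 2 ]∞
dilate-∞ c = parity-ext
  (λ n → begin
    δ₂ [ c q^ 1 ]∞ (n * 2)                      ≡⟨ even-dilate [ c q^ 1 ]∞ n ⟩
    [ c q^ 1 ]∞ n                                     ≡⟨ ∞-coeff c 1 n (ℕ.m≤m*n n 2) ⟩
    partialProduct c 1 (n * 2) n                      ≡⟨ even-dilate (partialProduct c 1 (n * 2)) n ⟨
    δ₂ (partialProduct c 1 (n * 2)) (n * 2)     ≡⟨ dilate-partialProduct c (n * 2) (n * 2) ⟩
    [ c q^ 2 ]∞ (n * 2)                               ∎)
  (λ n → begin
    δ₂ [ c q^ 1 ]∞ (suc (n * 2))                           ≡⟨ odd-dilate [ c q^ 1 ]∞ n ⟩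
    0ℤ                                                           ≡⟨ odd-dilate (partialProduct c 1 (suc (n * 2))) n ⟨
    δ₂ (partialProduct c 1 (suc (n * 2))) (suc (n * 2))    ≡⟨ dilate-partialProduct c (suc (n * 2)) (suc (n * 2)) ⟩
    [ c q^ 2 ]∞ (suc (n * 2))                                    ∎)
  where open ≡-Reasoning

gauss₂ : Q₂ ⊛ δ₂ φ⁻ ≗ E₂
gauss₂ = begin
  Q₂ ⊛ δ₂ φ⁻           ≈⟨ ⊛-cong {h = δ₂ φ⁻} (dilate-∞ -1ℤ) ≗-refl ⟨
  δ₂ Q₁ ⊛ δ₂ φ⁻  ≈⟨ dilate-⊛ 1 Q₁ φ⁻ ⟨
  δ₂ (Q₁ ⊛ φ⁻)         ≈⟨ spread-cong 1 0 gauss ⟩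
  δ₂ E₁                ≈⟨ dilate-∞ 1ℤ ⟩
  E₂                         ∎
  where open ≗-Reasoning

P₂ R₂ : ℕ → Series
P₂ = partialProduct 1ℤ 2
R₂ = partialProduct -1ℤ 2

twist-odd : ∀ N → twist (q^ suc (N * 2)) ≗ ⊝ q^ suc (N * 2)
twist-odd N m = begin
  twist (q^ suc (N * 2)) m                    ≡⟨ twist-q^ (suc (N * 2)) m ⟩
  (const (ℤ.- ε (N * 2)) ⊛ q^ suc (N * 2)) m  ≡⟨ cong (λ s → (const (ℤ.- s) ⊛ q^ suc (N * 2)) m) (ε-double N) ⟩
  (const -1ℤ ⊛ q^ suc (N * 2)) m              ≡⟨ const-⊛ -1ℤ (q^ suc (N * 2)) m ⟩
  -1ℤ ℤ.* (q^ suc (N * 2)) m                  ≡⟨ ℤ.-1*i≡-i _ ⟩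
  ℤ.- (q^ suc (N * 2)) m                      ∎
  where open ≡-Reasoning

twist-even : ∀ N → twist (q^ (N * 2)) ≗ q^ (N * 2)
twist-even N m = begin
  twist (q^ (N * 2)) m                ≡⟨ twist-q^ (N * 2) m ⟩
  (const (ε (N * 2)) ⊛ q^ (N * 2)) m  ≡⟨ cong (λ s → (const s ⊛ q^ (N * 2)) m) (ε-double N) ⟩
  (one ⊛ q^ (N * 2)) m                ≡⟨ ⊛-identityˡ (q^ (N * 2)) m ⟩
  (q^ (N * 2)) m                      ∎
  where open ≡-Reasoning

private
  x y : ℕ → Series
  x N = q^ suc (N * 2)
  y N = q^ suc (suc (N * 2))

  P-2 : ∀ N → P (suc N * 2) ≗ (one ⊖ y N) ⊛ ((one ⊖ x N) ⊛ P (N * 2))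
  P-2 N = ≗-trans (P-suc (suc (N * 2))) (⊛-congˡ {one ⊖ y N} (P-suc (N * 2)))

  Q-2 : ∀ N → Q (suc N * 2) ≗ (one ⊕ y N) ⊛ ((one ⊕ x N) ⊛ Q (N * 2))
  Q-2 N = ≗-trans (Q-suc (suc (N * 2))) (⊛-congˡ {one ⊕ y N} (Q-suc (N * 2)))

twist-one⊕ : ∀ f → twist (one ⊕ f) ≗ one ⊕ twist f
twist-one⊕ f = ≗-trans (twist-⊕ one f) (⊕-cong {v = twist f} (twist-const 1ℤ) ≗-refl)

twist-one⊖ : ∀ f → twist (one ⊖ f) ≗ one ⊖ twist f
twist-one⊖ f = ≗-trans (twist-one⊕ (⊝ f)) (⊕-cong (≗-refl {one}) (twist-⊝ f))

private
  tP-2 : ∀ N → twist (P (suc N * 2)) ≗ (one ⊖ y N) ⊛ ((one ⊕ x N) ⊛ twist (P (N * 2)))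
  tP-2 N = begin
    twist (P (suc N * 2))
      ≈⟨ twist-cong (P-2 N) ⟩
    twist ((one ⊖ y N) ⊛ ((one ⊖ x N) ⊛ P (N * 2)))
      ≈⟨ ≗-trans (twist-⊛ (one ⊖ y N) _) (⊛-congˡ {twist (one ⊖ y N)} (twist-⊛ (one ⊖ x N) (P (N * 2)))) ⟩
    twist (one ⊖ y N) ⊛ (twist (one ⊖ x N) ⊛ twist (P (N * 2)))
      ≈⟨ ⊛-cong (≗-trans (twist-one⊖ (y N)) (⊕-cong (≗-refl {one}) (⊝-cong (twist-even (suc N)))))
           (⊛-cong {h = twist (P (N * 2))} (≗-trans (twist-one⊖ (x N))
              (⊕-cong (≗-refl {one}) (≗-trans (⊝-cong (twist-odd N)) (λ m → ℤ.neg-involutive _)))) ≗-refl) ⟩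
    (one ⊖ y N) ⊛ ((one ⊕ x N) ⊛ twist (P (N * 2))) ∎
    where open ≗-Reasoning

  tQ-2 : ∀ N → twist (Q (suc N * 2)) ≗ (one ⊕ y N) ⊛ ((one ⊖ x N) ⊛ twist (Q (N * 2)))
  tQ-2 N = begin
    twist (Q (suc N * 2))
      ≈⟨ twist-cong (Q-2 N) ⟩
    twist ((one ⊕ y N) ⊛ ((one ⊕ x N) ⊛ Q (N * 2)))
      ≈⟨ ≗-trans (twist-⊛ (one ⊕ y N) _) (⊛-congˡ {twist (one ⊕ y N)} (twist-⊛ (one ⊕ x N) (Q (N * 2)))) ⟩
    twist (one ⊕ y N) ⊛ (twist (one ⊕ x N) ⊛ twist (Q (N * 2)))
      ≈⟨ ⊛-cong (≗-trans (twist-one⊕ (y N)) (⊕-cong (≗-refl {one}) (twist-even (suc N))))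
           (⊛-cong {h = twist (Q (N * 2))} (≗-trans (twist-one⊕ (x N))
              (⊕-cong (≗-refl {one}) (twist-odd N))) ≗-refl) ⟩
    (one ⊕ y N) ⊛ ((one ⊖ x N) ⊛ twist (Q (N * 2))) ∎
    where open ≗-Reasoning

  P₂-suc : ∀ N → P₂ (suc N) ≗ (one ⊖ y N) ⊛ P₂ N
  P₂-suc N = ≗-trans (·-⊛ (factor 1ℤ 2 N) (P₂ N)) (⊛-cong {h = P₂ N} (λ m → cong (λ k → one m ℤ.- (q^ k) m) (2+2N N)) ≗-refl)
    where
    2+2N : ∀ N → 2 + 2 * N ≡ suc (suc (N * 2))
    2+2N N = cong (λ k → suc (suc k)) (ℕ.*-comm 2 N)

  R₂-suc : ∀ N → R₂ (suc N) ≗ (one ⊕ y N) ⊛ R₂ N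
  R₂-suc N = ≗-trans (·-⊛ (factor -1ℤ 2 N) (R₂ N)) (⊛-cong {h = R₂ N} (≗-trans (factor-neg 2 N)
    (λ m → cong (λ k → one m ℤ.+ (q^ suc (suc k)) m) (ℕ.*-comm 2 N))) ≗-refl)

-- Twisting fixes 1 ± q^(2j+2) and exchanges 1 - q^(2j+1) with 1 + q^(2j+1), so both sides are the
-- product of (1 - q^(4j+4))² (1 - q^(4j+2)) over j < N. Two factors are added at a time because the
-- twist depends on parity.
finite-φφ⁻ : ∀ N → P (N * 2) ⊛ twist (P (N * 2)) ⊛ R₂ N ^2 ≗ Q (N * 2) ⊛ twist (Q (N * 2)) ⊛ P₂ N ^2
finite-φφ⁻ zero    = ≗-refl
finite-φφ⁻ (suc N) = begin
  P (suc N * 2) ⊛ twist (P (suc N * 2)) ⊛ R₂ (suc N) ^2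
    ≈⟨ ⊛-cong (⊛-cong (P-2 N) (tP-2 N)) (⊛-cong (R₂-suc N) (R₂-suc N)) ⟩
  (one ⊖ y N) ⊛ ((one ⊖ x N) ⊛ p) ⊛ ((one ⊖ y N) ⊛ ((one ⊕ x N) ⊛ p′)) ⊛ (((one ⊕ y N) ⊛ r) ⊛ ((one ⊕ y N) ⊛ r))
    ≈⟨ split-finite (one ⊖ y N) (one ⊖ x N) (one ⊕ x N) (one ⊕ y N) p p′ r ⟩
  u ⊛ (p ⊛ p′ ⊛ r ^2)
    ≈⟨ ⊛-congˡ {u} (finite-φφ⁻ N) ⟩
  u ⊛ (s ⊛ s′ ⊛ t ^2)
    ≈⟨ swap-scale (one ⊖ y N) (one ⊖ x N) (one ⊕ x N) (one ⊕ y N) (s ⊛ s′ ⊛ t ^2) ⟩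
  (one ⊕ y N) ^2 ⊛ (one ⊖ y N) ^2 ⊛ ((one ⊕ x N) ⊛ (one ⊖ x N)) ⊛ (s ⊛ s′ ⊛ t ^2)
    ≈⟨ split-finite (one ⊕ y N) (one ⊕ x N) (one ⊖ x N) (one ⊖ y N) s s′ t ⟨
  (one ⊕ y N) ⊛ ((one ⊕ x N) ⊛ s) ⊛ ((one ⊕ y N) ⊛ ((one ⊖ x N) ⊛ s′)) ⊛ (((one ⊖ y N) ⊛ t) ⊛ ((one ⊖ y N) ⊛ t))
    ≈⟨ ⊛-cong (⊛-cong (Q-2 N) (tQ-2 N)) (⊛-cong (P₂-suc N) (P₂-suc N)) ⟨
  Q (suc N * 2) ⊛ twist (Q (suc N * 2)) ⊛ P₂ (suc N) ^2 ∎
  where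
  open ≗-Reasoning
  p = P (N * 2)
  p′ = twist (P (N * 2))
  r = R₂ N
  s = Q (N * 2)
  s′ = twist (Q (N * 2))
  t = P₂ N
  u = (one ⊖ y N) ^2 ⊛ (one ⊕ y N) ^2 ⊛ ((one ⊖ x N) ⊛ (one ⊕ x N))

twist-≤ : ∀ {f g : Series} N → (∀ m → m ≤ N → f m ≡ g m) → ∀ m → m ≤ N → twist f m ≡ twist g m
twist-≤ {f} {g} N f≡g m m≤N =
  trans (twist-coeff f m) (trans (cong (ε m ℤ.*_) (f≡g m m≤N)) (sym (twist-coeff g m)))

monic-⊛ : ∀ f g → f 0 ≡ 1ℤ → g 0 ≡ 1ℤ → (f ⊛ g) 0 ≡ 1ℤ
monic-⊛ f g f₀ g₀ = trans (⊛-zero f g) (cong₂ ℤ._*_ f₀ g₀)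

∞-φφ⁻ : E₁ ⊛ twist E₁ ⊛ Q₂ ^2 ≗ Q₁ ⊛ twist Q₁ ⊛ E₂ ^2
∞-φφ⁻ n = begin
  (E₁ ⊛ twist E₁ ⊛ Q₂ ^2) n
    ≡⟨ limit 1ℤ -1ℤ ⟩
  (P (n * 2) ⊛ twist (P (n * 2)) ⊛ R₂ n ^2) n
    ≡⟨ finite-φφ⁻ n n ⟩
  (Q (n * 2) ⊛ twist (Q (n * 2)) ⊛ P₂ n ^2) n
    ≡⟨ limit -1ℤ 1ℤ ⟨
  (Q₁ ⊛ twist Q₁ ⊛ E₂ ^2) n ∎
  where
  open ≡-Reasoning
  -- The lengths 2 n and n match in `finite-φφ⁻`, and both are at least n, as the coefficient of
  -- index n requires.
  limit : ∀ c d → ([ c q^ 1 ]∞ ⊛ twist [ c q^ 1 ]∞ ⊛ [ d q^ 2 ]∞ ^2) n ≡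
          (partialProduct c 1 (n * 2) ⊛ twist (partialProduct c 1 (n * 2)) ⊛ partialProduct d 2 n ^2) n
  limit c d = ⊛-cong-≤ n (⊛-cong-≤-all n low (twist-≤ n low)) (⊛-cong-≤-all n low₂ low₂)
    where
    low : ∀ m → m ≤ n → [ c q^ 1 ]∞ m ≡ partialProduct c 1 (n * 2) m
    low m m≤n = ∞-coeff c 1 m (ℕ.≤-trans m≤n (ℕ.m≤m*n n 2))
    low₂ : ∀ m → m ≤ n → [ d q^ 2 ]∞ m ≡ partialProduct d 2 n m
    low₂ m m≤n = ∞-coeff d 2 m m≤n

twist-gauss : twist Q₁ ⊛ φ ≗ twist E₁
twist-gauss = begin
  twist Q₁ ⊛ φ          ≈⟨ ⊛-congˡ {twist Q₁} (twist-twist φ) ⟨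
  twist Q₁ ⊛ twist φ⁻   ≈⟨ twist-⊛ Q₁ φ⁻ ⟨
  twist (Q₁ ⊛ φ⁻)       ≈⟨ twist-cong gauss ⟩
  twist E₁              ∎
  where open ≗-Reasoning

-- Gauss's identity at q, -q and q² turns the claim, multiplied by a monic product, into `∞-φφ⁻`.
φ·φ⁻ : φ ⊛ φ⁻ ≗ δ₂ (φ⁻ ^2)
φ·φ⁻ = ⊛-cancelˡ (Q₁ ⊛ twist Q₁ ⊛ Q₂ ^2) (monic-⊛ (Q₁ ⊛ twist Q₁) (Q₂ ^2) (monic-⊛ Q₁ (twist Q₁) refl refl)
  (monic-⊛ Q₂ Q₂ refl refl)) (begin
  Q₁ ⊛ twist Q₁ ⊛ Q₂ ^2 ⊛ (φ ⊛ φ⁻)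
    ≈⟨ pair-factors Q₁ (twist Q₁) Q₂ φ φ⁻ ⟩
  (Q₁ ⊛ φ⁻) ⊛ (twist Q₁ ⊛ φ) ⊛ Q₂ ^2
    ≈⟨ ⊛-cong {h = Q₂ ^2} (⊛-cong gauss twist-gauss) ≗-refl ⟩
  E₁ ⊛ twist E₁ ⊛ Q₂ ^2
    ≈⟨ ∞-φφ⁻ ⟩
  Q₁ ⊛ twist Q₁ ⊛ E₂ ^2
    ≈⟨ ⊛-congˡ {Q₁ ⊛ twist Q₁} (⊛-cong gauss₂ gauss₂) ⟨
  Q₁ ⊛ twist Q₁ ⊛ (Q₂ ⊛ δ₂ φ⁻) ^2
    ≈⟨ pull-square Q₁ (twist Q₁) Q₂ (δ₂ φ⁻) ⟩
  Q₁ ⊛ twist Q₁ ⊛ Q₂ ^2 ⊛ δ₂ φ⁻ ^2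
    ≈⟨ ⊛-congˡ {Q₁ ⊛ twist Q₁ ⊛ Q₂ ^2} (dilate-⊛ 1 φ⁻ φ⁻) ⟨
  Q₁ ⊛ twist Q₁ ⊛ Q₂ ^2 ⊛ δ₂ (φ⁻ ^2) ∎)
  where open ≗-Reasoning

squares-⊛ : ∀ f g → Defs._² f · Defs._² g ≗ f ^2 ⊛ g ^2
squares-⊛ f g = ≗-trans (·-⊛ (f · f) (g · g)) (⊛-cong (·-⊛ f f) (·-⊛ g g))

-- By Gauss's identity at q and q², the numerator times φ(-q)² φ(-q²)² is the denominator.
b̄-φ⁻ : b̄ ⊛ (φ⁻ ^2 ⊛ δ₂ φ⁻ ^2) ≗ one
b̄-φ⁻ = ⊛-cancelˡ numerator refl (begin
  numerator ⊛ (b̄ ⊛ (φ⁻ ^2 ⊛ δ₂ φ⁻ ^2))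
    ≈⟨ ⊛-cong {h = b̄ ⊛ (φ⁻ ^2 ⊛ δ₂ φ⁻ ^2)} (squares-⊛ Q₁ Q₂) ≗-refl ⟩
  Q₁ ^2 ⊛ Q₂ ^2 ⊛ (b̄ ⊛ (φ⁻ ^2 ⊛ δ₂ φ⁻ ^2))
    ≈⟨ pair-squares Q₁ Q₂ b̄ φ⁻ (δ₂ φ⁻) ⟩
  (Q₁ ⊛ φ⁻) ^2 ⊛ (Q₂ ⊛ δ₂ φ⁻) ^2 ⊛ b̄
    ≈⟨ ⊛-cong {h = b̄} (⊛-cong (⊛-cong gauss gauss) (⊛-cong gauss₂ gauss₂)) ≗-refl ⟩
  E₁ ^2 ⊛ E₂ ^2 ⊛ b̄
    ≈⟨ ⊛-cong {h = b̄} (squares-⊛ E₁ E₂) ≗-refl ⟨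
  denominator ⊛ b̄
    ≈⟨ ·-⊛ denominator b̄ ⟨
  denominator · b̄
    ≈⟨ denominator·b̄ ⟩
  numerator
    ≈⟨ ≗-trans (⊛-comm numerator one) (⊛-identityˡ numerator) ⟨
  numerator ⊛ one ∎)
  where open ≗-Reasoning

-- Dissections

even-sq : even sq ≗ δ₂ sq
even-sq = parity-ext (λ n → trans (sq-4n n) (sym (even-dilate sq n)))
                     (λ n → trans (sq-4n+2 n) (sym (odd-dilate sq n)))

-- Odd squares are 1 modulo 8, so in the odd part only the indices divisible by 4 survive.
odd-sq : odd sq ≗ δ₂ (δ₂ ψ)
odd-sq = parity-ext
  (λ n → trans (parity-ext {even (odd sq)} {δ₂ ψ}
    (λ m → trans (cong (λ k → sq (suc k)) (trans (ℕ.*-assoc (m * 2) 2 2) (ℕ.*-assoc m 2 4))) (sym (even-dilate ψ m)))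
    (λ m → trans (sq-8n+5 m) (sym (odd-dilate ψ m))) n) (sym (even-dilate (δ₂ ψ) n)))
  (λ n → trans (sq-4n+3 n) (sym (odd-dilate (δ₂ ψ) n)))

-- Dissection by 3

third₀ third₁ third₂ : Series → Series
third₀ f n = f (n * 3)
third₁ f n = f (suc (n * 3))
third₂ f n = f (suc (suc (n * 3)))

third₀-dilate : ∀ f → third₀ (δ₃ f) ≗ f
third₀-dilate f zero    = refl
third₀-dilate f (suc n) = third₀-dilate (tail f) n

third₁-dilate : ∀ f → third₁ (δ₃ f) ≗ 0ₛ
third₁-dilate f zero    = refl
third₁-dilate f (suc n) = third₁-dilate (tail f) n

third₂-dilate : ∀ f → third₂ (δ₃ f) ≗ 0ₛ
third₂-dilate f zero    = refl
third₂-dilate f (suc n) = third₂-dilate (tail f) n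

third-ext : ∀ {f g} → third₀ f ≗ third₀ g → third₁ f ≗ third₁ g → third₂ f ≗ third₂ g → f ≗ g
third-ext a b c zero             = a 0
third-ext a b c (suc zero)       = b 0
third-ext a b c (suc (suc zero)) = c 0
third-ext {f} {g} a b c (suc (suc (suc n))) =
  third-ext {tail (tail (tail f))} {tail (tail (tail g))} (λ m → a (suc m)) (λ m → b (suc m)) (λ m → c (suc m)) n

_+q_+q²_ : Series → Series → Series → Series
f +q g +q² h = δ₃ f ⊕ (q ⊛ δ₃ g ⊕ q ⊛ (q ⊛ δ₃ h))

third₁-q· : ∀ f → third₁ (q ⊛ f) ≗ third₀ f
third₁-q· f n = q⊛-suc f (n * 3)

third₂-q· : ∀ f → third₂ (q ⊛ f) ≗ third₁ f
third₂-q· f n = q⊛-suc f (suc (n * 3))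

third₀-q· : ∀ f → third₂ f ≗ 0ₛ → third₀ (q ⊛ f) ≗ 0ₛ
third₀-q· f f₂≗0 zero    = q⊛-zero f
third₀-q· f f₂≗0 (suc n) = trans (q⊛-suc f (suc (suc (n * 3)))) (f₂≗0 n)

third₀-dissected : ∀ f g h → third₀ (f +q g +q² h) ≗ f
third₀-dissected f g h n = trans (cong₂ ℤ._+_ (third₀-dilate f n) (cong₂ ℤ._+_
  (third₀-q· (δ₃ g) (third₂-dilate g) n)
  (third₀-q· (q ⊛ δ₃ h) (λ m → trans (third₂-q· (δ₃ h) m) (third₁-dilate h m)) n))) (ℤ.+-identityʳ (f n))

third₁-dissected : ∀ f g h → third₁ (f +q g +q² h) ≗ g
third₁-dissected f g h n = trans (cong₂ ℤ._+_ (third₁-dilate f n) (cong₂ ℤ._+_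
  (trans (third₁-q· (δ₃ g) n) (third₀-dilate g n))
  (trans (third₁-q· (q ⊛ δ₃ h) n) (third₀-q· (δ₃ h) (third₂-dilate h) n))))
  (trans (ℤ.+-identityˡ _) (ℤ.+-identityʳ (g n)))

third₂-dissected : ∀ f g h → third₂ (f +q g +q² h) ≗ h
third₂-dissected f g h n = trans (cong₂ ℤ._+_ (third₂-dilate f n) (cong₂ ℤ._+_
  (trans (third₂-q· (δ₃ g) n) (third₁-dilate g n))
  (trans (third₂-q· (q ⊛ δ₃ h) n) (trans (third₁-q· (δ₃ h) n) (third₀-dilate h n)))))
  (trans (ℤ.+-identityˡ _) (ℤ.+-identityˡ (h n)))

3-dissect : ∀ {f a b c} → third₀ f ≗ a → third₁ f ≗ b → third₂ f ≗ c → f ≗ a +q b +q² c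
3-dissect {f} {a} {b} {c} p q r = third-ext
  (λ n → trans (p n) (sym (third₀-dissected a b c n)))
  (λ n → trans (q n) (sym (third₁-dissected a b c n)))
  (λ n → trans (r n) (sym (third₂-dissected a b c n)))

w A : Series
w = third₁ sq
A = third₀ ψ

third₀-sq : third₀ sq ≗ δ₃ sq
third₀-sq = third-ext
  (λ n → trans (sq-9n n) (sym (third₀-dilate sq n)))
  (λ n → trans (sq-3n (suc (n * 3)) (λ k → 3m≢3n+1 k n)) (sym (third₁-dilate sq n)))
  (λ n → trans (sq-3n (suc (suc (n * 3))) (λ k → 3m≢3n+2 k n)) (sym (third₂-dilate sq n)))

third₁-ψ : third₁ ψ ≗ δ₃ ψ
third₁-ψ = third-ext
  (λ n → trans (cong sq (24[3n]+9 n))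
    (trans (sq-9n (suc (n * 8))) (sym (third₀-dilate ψ n))))
  (λ n → trans (cong sq (24[3n+1]+9 n))
    (trans (sq-3n (suc (suc ((3 + 8 * n) * 3))) (λ k → 3m≢3n+2 k (3 + 8 * n))) (sym (third₁-dilate ψ n))))
  (λ n → trans (cong sq (24[3n+2]+9 n))
    (trans (sq-3n (suc ((6 + 8 * n) * 3)) (λ k → 3m≢3n+1 k (6 + 8 * n))) (sym (third₂-dilate ψ n))))

third₂-ψ : third₂ ψ ≗ 0ₛ
third₂-ψ n = trans (cong sq (24n+17 n))
  (sq-3n+2 (5 + 8 * n))

-- The congruence modulo 256

δ₂-cong : ∀ {f g} → f ≗ g → δ₂ f ≗ δ₂ g
δ₂-cong = spread-cong 1 0

δ₂-injective : ∀ f g → δ₂ f ≗ δ₂ g → f ≗ g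
δ₂-injective f g df≗dg n = trans (sym (even-dilate f n)) (trans (df≗dg (n * 2)) (even-dilate g n))

q·q : q ⊛ q ≗ δ₂ q
q·q zero                = q⊛-zero q
q·q (suc zero)          = q⊛-suc q 0
q·q (suc (suc zero))    = q⊛-suc q 1
q·q (suc (suc (suc n))) = trans (q⊛-suc q (suc (suc n))) (sym (spread-const 1 1ℤ (suc n)))

-- β is ψ(q⁴) and v is φ(q²) ψ(q⁴); v turns out to be ψ(q²)² in `v-ψ`.
β v : Series
β = δ₂ (δ₂ ψ)
v = δ₂ φ ⊛ β

φ-dissect : φ ≗ δ₂ (δ₂ φ) ⊕ const (+ 2) ⊛ (q ⊛ δ₂ β)
φ-dissect = begin
  one ⊕ const (+ 2) ⊛ sq
    ≈⟨ ⊕-cong (≗-trans (≗-sym (spread-const 1 1ℤ)) (δ₂-cong (≗-sym (spread-const 1 1ℤ))))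
         (⊛-congˡ {const (+ 2)} (2-dissect {sq} {δ₂ sq} {β} even-sq odd-sq)) ⟩
  δ₂ (δ₂ one) ⊕ const (+ 2) ⊛ (δ₂ (δ₂ sq) ⊕ q ⊛ δ₂ β)
    ≈⟨ solve 3 (λ a b c → a :+ con (+ 2) :* (b :+ c) := (a :+ con (+ 2) :* b) :+ con (+ 2) :* c) ≗-refl (δ₂ (δ₂ one))
         (δ₂ (δ₂ sq)) (q ⊛ δ₂ β) ⟩
  (δ₂ (δ₂ one) ⊕ const (+ 2) ⊛ δ₂ (δ₂ sq)) ⊕ const (+ 2) ⊛ (q ⊛ δ₂ β)
    ≈⟨ ⊕-cong (≗-trans (⊕-cong (≗-refl {δ₂ (δ₂ one)}) (≗-sym (≗-trans (δ₂-cong (dilate-const· 1 (+ 2) sq))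
         (dilate-const· 1 (+ 2) (δ₂ sq)))))
         (≗-trans (≗-sym (dilate-⊕ 1 (δ₂ one) (δ₂ (const (+ 2) ⊛ sq)))) (δ₂-cong (≗-sym (dilate-⊕ 1 one (const (+ 2) ⊛ sq))))))
         (≗-refl {const (+ 2) ⊛ (q ⊛ δ₂ β)}) ⟩
  δ₂ (δ₂ φ) ⊕ const (+ 2) ⊛ (q ⊛ δ₂ β) ∎
  where open ≗-Reasoning

φ⁻-dissect : φ⁻ ≗ δ₂ (δ₂ φ) ⊖ const (+ 2) ⊛ (q ⊛ δ₂ β)
φ⁻-dissect = begin
  twist φ
    ≈⟨ twist-cong φ-dissect ⟩
  twist (δ₂ (δ₂ φ) ⊕ const (+ 2) ⊛ (q ⊛ δ₂ β))
    ≈⟨ twist-⊕ (δ₂ (δ₂ φ)) (const (+ 2) ⊛ (q ⊛ δ₂ β)) ⟩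
  twist (δ₂ (δ₂ φ)) ⊕ twist (const (+ 2) ⊛ (q ⊛ δ₂ β))
    ≈⟨ ⊕-cong (twist-dilate (δ₂ φ)) (≗-trans (twist-const· (+ 2) (q ⊛ δ₂ β))
         (⊛-congˡ {const (+ 2)} (≗-trans (twist-⊛ q (δ₂ β)) (⊛-cong twist-q (twist-dilate β))))) ⟩
  δ₂ (δ₂ φ) ⊕ const (+ 2) ⊛ ((⊝ q) ⊛ δ₂ β)
    ≈⟨ solve 3 (λ a q b → a :+ con (+ 2) :* ((:- q) :* b) := a :- con (+ 2) :* (q :* b)) ≗-refl (δ₂ (δ₂ φ)) q (δ₂ β) ⟩
  δ₂ (δ₂ φ) ⊖ const (+ 2) ⊛ (q ⊛ δ₂ β) ∎
  where open ≗-Reasoning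

δ₂-⊝ : ∀ f → δ₂ (⊝ f) ≗ ⊝ δ₂ f
δ₂-⊝ f = begin
  δ₂ (⊝ f)              ≈⟨ δ₂-cong (solve 1 (λ f → :- f := con -1ℤ :* f) ≗-refl f) ⟩
  δ₂ (const -1ℤ ⊛ f)    ≈⟨ dilate-const· 1 -1ℤ f ⟩
  const -1ℤ ⊛ δ₂ f      ≈⟨ solve 1 (λ f → con -1ℤ :* f := :- f) ≗-refl (δ₂ f) ⟩
  ⊝ δ₂ f                ∎
  where open ≗-Reasoning

δ₂-² : ∀ f → δ₂ (f ^2) ≗ δ₂ f ^2
δ₂-² f = dilate-⊛ 1 f f

δ₂-4q : ∀ f → δ₂ (const (+ 4) ⊛ (q ⊛ f)) ≗ const (+ 4) ⊛ (q ⊛ q ⊛ δ₂ f)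
δ₂-4q f = begin
  δ₂ (const (+ 4) ⊛ (q ⊛ f))      ≈⟨ dilate-const· 1 (+ 4) (q ⊛ f) ⟩
  const (+ 4) ⊛ δ₂ (q ⊛ f)        ≈⟨ ⊛-congˡ {const (+ 4)} (≗-trans (dilate-⊛ 1 q f) (⊛-cong {h = δ₂ f} (≗-sym q·q) ≗-refl)) ⟩
  const (+ 4) ⊛ (q ⊛ q ⊛ δ₂ f)    ∎
  where open ≗-Reasoning

-- φ(q) and φ(-q) are conjugate with respect to their odd part 2 q ψ(q⁸), so their product, known to
-- be φ(-q²)², is visibly a series in q², and q may be put for q². The next identity is this one at
-- -q.
φ⁻² : φ⁻ ^2 ≗ δ₂ φ ^2 ⊖ const (+ 4) ⊛ (q ⊛ β ^2)
φ⁻² = δ₂-injective (φ⁻ ^2) _ (begin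
  δ₂ (φ⁻ ^2)
    ≈⟨ φ·φ⁻ ⟨
  φ ⊛ φ⁻
    ≈⟨ ⊛-cong φ-dissect φ⁻-dissect ⟩
  (δ₂ (δ₂ φ) ⊕ const (+ 2) ⊛ (q ⊛ δ₂ β)) ⊛ (δ₂ (δ₂ φ) ⊖ const (+ 2) ⊛ (q ⊛ δ₂ β))
    ≈⟨ conjugates (δ₂ (δ₂ φ)) q (δ₂ β) ⟩
  δ₂ (δ₂ φ) ^2 ⊖ const (+ 4) ⊛ (q ⊛ q ⊛ δ₂ β ^2)
    ≈⟨ ⊕-cong (δ₂-² (δ₂ φ)) (⊝-cong (≗-trans (δ₂-4q (β ^2)) (⊛-congˡ {const (+ 4)} (⊛-congˡ {q ⊛ q} (δ₂-² β))))) ⟨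
  δ₂ (δ₂ φ ^2) ⊖ δ₂ (const (+ 4) ⊛ (q ⊛ β ^2))
    ≈⟨ ⊕-cong (≗-refl {δ₂ (δ₂ φ ^2)}) (δ₂-⊝ (const (+ 4) ⊛ (q ⊛ β ^2))) ⟨
  δ₂ (δ₂ φ ^2) ⊕ δ₂ (⊝ (const (+ 4) ⊛ (q ⊛ β ^2)))
    ≈⟨ dilate-⊕ 1 (δ₂ φ ^2) (⊝ (const (+ 4) ⊛ (q ⊛ β ^2))) ⟨
  δ₂ (δ₂ φ ^2 ⊖ const (+ 4) ⊛ (q ⊛ β ^2)) ∎)
  where open ≗-Reasoning

φ² : φ ^2 ≗ δ₂ φ ^2 ⊕ const (+ 4) ⊛ (q ⊛ β ^2)
φ² = begin
  φ ^2
    ≈⟨ ⊛-cong (twist-twist φ) (twist-twist φ) ⟨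
  twist φ⁻ ^2
    ≈⟨ twist-⊛ φ⁻ φ⁻ ⟨
  twist (φ⁻ ^2)
    ≈⟨ twist-cong φ⁻² ⟩
  twist (δ₂ φ ^2 ⊖ const (+ 4) ⊛ (q ⊛ β ^2))
    ≈⟨ ≗-trans (twist-⊕ (δ₂ φ ^2) _) (⊕-cong (≗-refl {twist (δ₂ φ ^2)}) (twist-⊝ (const (+ 4) ⊛ (q ⊛ β ^2)))) ⟩
  twist (δ₂ φ ^2) ⊖ twist (const (+ 4) ⊛ (q ⊛ β ^2))
    ≈⟨ ⊕-cong (twist-² φ) (⊝-cong (≗-trans (twist-const· (+ 4) (q ⊛ β ^2))
         (⊛-congˡ {const (+ 4)} (≗-trans (twist-⊛ q (β ^2)) (⊛-cong twist-q (twist-² (δ₂ ψ))))))) ⟩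
  δ₂ φ ^2 ⊖ const (+ 4) ⊛ ((⊝ q) ⊛ β ^2)
    ≈⟨ solve 3 (λ a q b → a :- con (+ 4) :* ((:- q) :* b) := a :+ con (+ 4) :* (q :* b)) ≗-refl (δ₂ φ ^2) q (β ^2) ⟩
  δ₂ φ ^2 ⊕ const (+ 4) ⊛ (q ⊛ β ^2) ∎
  where
  open ≗-Reasoning
  twist-² : ∀ f → twist (δ₂ f ^2) ≗ δ₂ f ^2
  twist-² f = ≗-trans (twist-⊛ (δ₂ f) (δ₂ f)) (⊛-cong (twist-dilate f) (twist-dilate f))

-- The even part of the square is φ(q⁴)² + 4 q² ψ(q⁸)², which is the preceding formula for φ² with
-- q² in place of q.
φ²-dissect : φ ^2 ≗ δ₂ (φ ^2) ⊕ q ⊛ δ₂ (const (+ 4) ⊛ v)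
φ²-dissect = begin
  φ ^2
    ≈⟨ ⊛-cong φ-dissect φ-dissect ⟩
  (δ₂ (δ₂ φ) ⊕ const (+ 2) ⊛ (q ⊛ δ₂ β)) ^2
    ≈⟨ square-dissected (δ₂ (δ₂ φ)) q (δ₂ β) ⟩
  (δ₂ (δ₂ φ) ^2 ⊕ const (+ 4) ⊛ (q ⊛ q ⊛ δ₂ β ^2)) ⊕ q ⊛ (const (+ 4) ⊛ (δ₂ (δ₂ φ) ⊛ δ₂ β))
    ≈⟨ ⊕-cong (⊕-cong (δ₂-² (δ₂ φ)) (≗-trans (δ₂-4q (β ^2)) (⊛-congˡ {const (+ 4)} (⊛-congˡ {q ⊛ q} (δ₂-² β)))))
         (⊛-congˡ {q} (≗-trans (dilate-const· 1 (+ 4) v) (⊛-congˡ {const (+ 4)} (dilate-⊛ 1 (δ₂ φ) β)))) ⟨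
  (δ₂ (δ₂ φ ^2) ⊕ δ₂ (const (+ 4) ⊛ (q ⊛ β ^2))) ⊕ q ⊛ δ₂ (const (+ 4) ⊛ v)
    ≈⟨ ⊕-cong (≗-trans (δ₂-cong φ²) (dilate-⊕ 1 (δ₂ φ ^2) (const (+ 4) ⊛ (q ⊛ β ^2)))) (≗-refl {q ⊛ δ₂ (const (+ 4) ⊛ v)}) ⟨
  δ₂ (φ ^2) ⊕ q ⊛ δ₂ (const (+ 4) ⊛ v) ∎
  where open ≗-Reasoning

-- This is φ(q) ψ(q²) = ψ(q)² at q², obtained by comparing the odd parts of the two formulas for φ²:
-- one has 4 v, the other 4 ψ(q²)².
v-ψ : v ≗ δ₂ (ψ ^2)
v-ψ n = ℤ.*-cancelˡ-≡ (+ 4) (v n) (δ₂ (ψ ^2) n) (begin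
  + 4 ℤ.* v n                                     ≡⟨ const-⊛ (+ 4) v n ⟨
  (const (+ 4) ⊛ v) n                             ≡⟨ odd-dissected (φ ^2) (const (+ 4) ⊛ v) n ⟨
  odd (δ₂ (φ ^2) ⊕ q ⊛ δ₂ (const (+ 4) ⊛ v)) n       ≡⟨ φ²-dissect (suc (n * 2)) ⟨
  odd (φ ^2) n                                     ≡⟨ other (suc (n * 2)) ⟩
  odd (δ₂ (φ ^2) ⊕ q ⊛ δ₂ (const (+ 4) ⊛ δ₂ (ψ ^2))) n ≡⟨ odd-dissected (φ ^2) (const (+ 4) ⊛ δ₂ (ψ ^2)) n ⟩
  (const (+ 4) ⊛ δ₂ (ψ ^2)) n                       ≡⟨ const-⊛ (+ 4) (δ₂ (ψ ^2)) n ⟩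
  + 4 ℤ.* δ₂ (ψ ^2) n                               ∎)
  where
  other : φ ^2 ≗ δ₂ (φ ^2) ⊕ q ⊛ δ₂ (const (+ 4) ⊛ δ₂ (ψ ^2))
  other = begin
    φ ^2
      ≈⟨ φ² ⟩
    δ₂ φ ^2 ⊕ const (+ 4) ⊛ (q ⊛ β ^2)
      ≈⟨ ⊕-cong (≗-sym (δ₂-² φ)) (⊛-congˡ {const (+ 4)} (⊛-congˡ {q}
           (≗-trans (≗-sym (δ₂-² (δ₂ ψ))) (δ₂-cong (≗-sym (δ₂-² ψ)))))) ⟩
    δ₂ (φ ^2) ⊕ const (+ 4) ⊛ (q ⊛ δ₂ (δ₂ (ψ ^2)))
      ≈⟨ ⊕-cong (≗-refl {δ₂ (φ ^2)}) (solve 2 (λ q f → con (+ 4) :* (q :* f) :=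
           q :* (con (+ 4) :* f)) ≗-refl q (δ₂ (δ₂ (ψ ^2)))) ⟩
    δ₂ (φ ^2) ⊕ q ⊛ (const (+ 4) ⊛ δ₂ (δ₂ (ψ ^2)))
      ≈⟨ ⊕-cong (≗-refl {δ₂ (φ ^2)}) (⊛-congˡ {q} (dilate-const· 1 (+ 4) (δ₂ (ψ ^2)))) ⟨
    δ₂ (φ ^2) ⊕ q ⊛ δ₂ (const (+ 4) ⊛ δ₂ (ψ ^2)) ∎
    where open ≗-Reasoning
  open ≡-Reasoning

even-φ² : even (φ ^2) ≗ φ ^2
even-φ² n = trans (φ²-dissect (n * 2)) (even-dissected (φ ^2) (const (+ 4) ⊛ v) n)

-- The coefficients of b̄ of index 8 m + 2

private
  u n₂ : Series
  u  = φ ^2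
  n₂ = φ⁻ ^2

G G₁ : Series
G  = even b̄
G₁ = odd G

open Endomorphism δ₂ (spread-cong 1 0) (dilate-⊕ 1) (dilate-⊛ 1) (spread-const 1)
  using (sixth-power; twelfth-power; fourth-power-dissected)

G-eq : G ⊛ (n₂ ⊛ n₂ ⊛ n₂) ≗ u
G-eq = begin
  G ⊛ (n₂ ⊛ n₂ ⊛ n₂)          ≈⟨ even-⊛-dilate b̄ (n₂ ⊛ n₂ ⊛ n₂) ⟨
  even (b̄ ⊛ δ₂ (n₂ ⊛ n₂ ⊛ n₂)) ≈⟨ (λ n → sixth-power b̄ φ φ⁻ b̄-φ⁻ φ·φ⁻ (n * 2)) ⟩
  even u                      ≈⟨ even-φ² ⟩
  u                           ∎
  where open ≗-Reasoning

G₁-eq : G₁ ⊛ (n₂ ⊛ n₂ ⊛ n₂ ⊛ (n₂ ⊛ n₂ ⊛ n₂)) ≗ const (+ 16) ⊛ (u ⊛ u ⊛ u ⊛ v) ⊕ q ⊛ (const (+ 256) ⊛ (u ⊛ (v ⊛ v ⊛ v)))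
G₁-eq = begin
  G₁ ⊛ n⁶          ≈⟨ odd-⊛-dilate G n⁶ ⟨
  odd (G ⊛ δ₂ n⁶)          ≈⟨ (λ n → twelfth-power G φ φ⁻ G-eq φ·φ⁻ (suc (n * 2))) ⟩
  odd (u ⊛ u ⊛ (u ⊛ u))   ≈⟨ (λ n → trans (proj₂ u⁴ (suc (n * 2))) (odd-dissected (proj₁ u⁴) rhs n)) ⟩
  rhs                     ∎
  where
  open ≗-Reasoning
  n⁶ = n₂ ⊛ n₂ ⊛ n₂ ⊛ (n₂ ⊛ n₂ ⊛ n₂)
  u⁴ = fourth-power-dissected q u v q·q φ²-dissect
  rhs = const (+ 16) ⊛ (u ⊛ u ⊛ u ⊛ v) ⊕ q ⊛ (const (+ 256) ⊛ (u ⊛ (v ⊛ v ⊛ v)))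

G₁-mod-256 : ∃ λ h → G₁ ≗ const (+ 16) ⊛ (u ⊛ v) ⊕ const (+ 256) ⊛ h
-- u⁴ is φ⁸, and φ(q)² and φ(-q)² differ by 8 q ψ(q⁴)².
G₁-mod-256 = mod-256 {y = q ⊛ β ^2} (proj₂ (eighth-power sq)) n≈ G₁-eq
  where
  open ≗-Reasoning
  n≈ : n₂ ≗ u ⊖ const (+ 8) ⊛ (q ⊛ β ^2)
  n≈ = begin
    n₂
      ≈⟨ φ⁻² ⟩
    δ₂ φ ^2 ⊖ const (+ 4) ⊛ (q ⊛ β ^2)
      ≈⟨ solve 2 (λ a b → a :- con (+ 4) :* b := (a :+ con (+ 4) :* b) :- con (+ 8) :* b) ≗-refl (δ₂ φ ^2) (q ⊛ β ^2) ⟩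
    (δ₂ φ ^2 ⊕ const (+ 4) ⊛ (q ⊛ β ^2)) ⊖ const (+ 8) ⊛ (q ⊛ β ^2)
      ≈⟨ ⊕-cong φ² (≗-refl {⊝ (const (+ 8) ⊛ (q ⊛ β ^2))}) ⟨
    u ⊖ const (+ 8) ⊛ (q ⊛ β ^2) ∎

b̄-8m+2 : ∃ λ h → ∀ m → b̄ (suc (m * 2 * 2) * 2) ≡ + 16 ℤ.* (φ ^2 ⊛ ψ ^2) m ℤ.+ + 256 ℤ.* h m
b̄-8m+2 = even h , λ m → begin
  G₁ (m * 2)
    ≡⟨ proj₂ G₁-mod-256 (m * 2) ⟩
  (const (+ 16) ⊛ (u ⊛ v)) (m * 2) ℤ.+ (const (+ 256) ⊛ h) (m * 2)
    ≡⟨ cong₂ ℤ._+_ (const-⊛ (+ 16) (u ⊛ v) (m * 2)) (const-⊛ (+ 256) h (m * 2)) ⟩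
  + 16 ℤ.* (u ⊛ v) (m * 2) ℤ.+ + 256 ℤ.* h (m * 2)
    ≡⟨ cong (λ s → + 16 ℤ.* s ℤ.+ + 256 ℤ.* h (m * 2)) (uv m) ⟩
  + 16 ℤ.* (u ⊛ ψ ^2) m ℤ.+ + 256 ℤ.* h (m * 2) ∎
  where
  open ≡-Reasoning
  h = proj₁ G₁-mod-256
  -- v is a series in q², so only the even part of φ² enters, and that is φ² again.
  uv : even (u ⊛ v) ≗ u ⊛ ψ ^2
  uv m = trans (⊛-congˡ {u} v-ψ (m * 2)) (trans (even-⊛-dilate u (ψ ^2) m) (⊛-cong {h = ψ ^2} even-φ² ≗-refl m))

-- The coefficients of φ² ψ² of index 3 k + 2

drop-third : ∀ f g → (f +q g +q² 0ₛ) ≗ δ₃ f ⊕ q ⊛ δ₃ g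
drop-third f g n = cong (λ y → δ₃ f n ℤ.+ y) (trans
  (cong (λ y → (q ⊛ δ₃ g) n ℤ.+ y) (trans (q⊛-cong (λ m → trans (q⊛-cong (spread-0 2 0) m) (q⊛0 m)) n) (q⊛0 n)))
  (ℤ.+-identityʳ _))
  where
  q⊛-cong : ∀ {f g} → f ≗ g → q ⊛ f ≗ q ⊛ g
  q⊛-cong = ⊛-congˡ {q}
  q⊛0 : q ⊛ 0ₛ ≗ 0ₛ
  q⊛0 n = trans (⊛-comm q 0ₛ n) (⊛-zeroˡ q n)

third₀-φ : third₀ φ ≗ δ₃ φ
third₀-φ n = begin
  one (n * 3) ℤ.+ (const (+ 2) ⊛ sq) (n * 3)
    ≡⟨ cong₂ ℤ._+_ (trans (sym (spread-const 2 1ℤ (n * 3))) (trans (third₀-dilate one n) (sym (spread-const 2 1ℤ n))))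
         (trans (const-⊛ (+ 2) sq (n * 3)) (cong (+ 2 ℤ.*_) (third₀-sq n))) ⟩
  δ₃ one n ℤ.+ + 2 ℤ.* δ₃ sq n
    ≡⟨ cong (λ y → δ₃ one n ℤ.+ y) (trans (dilate-const· 2 (+ 2) sq n) (const-⊛ (+ 2) (δ₃ sq) n)) ⟨
  δ₃ one n ℤ.+ δ₃ (const (+ 2) ⊛ sq) n
    ≡⟨ dilate-⊕ 2 one (const (+ 2) ⊛ sq) n ⟨
  δ₃ φ n ∎
  where open ≡-Reasoning

φ-thirds : φ ≗ δ₃ (δ₃ φ) ⊕ q ⊛ δ₃ (const (+ 2) ⊛ w)
φ-thirds = ≗-trans
  (3-dissect {φ} {δ₃ φ} {const (+ 2) ⊛ w} {0ₛ} third₀-φ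
    (λ n → trans (ℤ.+-identityˡ _) (trans (const-⊛ (+ 2) sq (suc (n * 3))) (sym (const-⊛ (+ 2) w n))))
    (λ n → trans (ℤ.+-identityˡ _) (trans (const-⊛ (+ 2) sq (suc (suc (n * 3)))) (cong (+ 2 ℤ.*_) (sq-3n+2 n)))))
  (drop-third (δ₃ φ) (const (+ 2) ⊛ w))

ψ-thirds : ψ ≗ δ₃ A ⊕ q ⊛ δ₃ (δ₃ ψ)
ψ-thirds = ≗-trans (3-dissect {ψ} {A} {δ₃ ψ} {0ₛ} ≗-refl third₁-ψ third₂-ψ) (drop-third A (δ₃ ψ))

q³ : q ⊛ q ⊛ q ≗ δ₃ q
q³ = begin
  q ⊛ q ⊛ q             ≈⟨ ⊛-assoc q q q ⟩
  q ⊛ (q ⊛ q)           ≈⟨ cubed ⟩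
  δ₃ q                   ∎
  where
  open ≗-Reasoning
  cubed : q ⊛ (q ⊛ q) ≗ δ₃ q
  cubed zero                      = q⊛-zero (q ⊛ q)
  cubed (suc zero)                = trans (q⊛-suc (q ⊛ q) 0) (q⊛-zero q)
  cubed (suc (suc zero))          = trans (q⊛-suc (q ⊛ q) 1) (q⊛-suc q 0)
  cubed (suc (suc (suc n)))       = trans (q⊛-suc (q ⊛ q) (suc (suc n))) (trans (q⊛-suc q (suc n)) (sym (spread-const 2 1ℤ n)))

third₂-φ²ψ² : third₂ (φ ^2 ⊛ ψ ^2) ≗
  const (+ 4) ⊛ (w ⊛ A ⊕ δ₃ φ ⊛ δ₃ ψ) ^2 ⊖ const (+ 3) ⊛ (δ₃ φ ⊛ δ₃ ψ) ^2
third₂-φ²ψ² n = trans (eq (suc (suc (n * 3)))) (third₂-dissected e₀ e₁ e₂ n)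
  where
  open Endomorphism δ₃ (spread-cong 2 0) (dilate-⊕ 2) (dilate-⊛ 2) (spread-const 2)
  thirds = thirds-of-square q φ ψ (δ₃ φ) w A (δ₃ ψ) q³ φ-thirds ψ-thirds
  e₀ e₁ e₂ : Series
  e₀ = proj₁ thirds
  e₁ = proj₁ (proj₂ thirds)
  e₂ = const (+ 4) ⊛ (w ⊛ A ⊕ δ₃ φ ⊛ δ₃ ψ) ^2 ⊖ const (+ 3) ⊛ (δ₃ φ ⊛ δ₃ ψ) ^2
  eq : φ ^2 ⊛ ψ ^2 ≗ δ₃ e₀ ⊕ (q ⊛ δ₃ e₁ ⊕ q ⊛ (q ⊛ δ₃ e₂))
  eq = proj₂ (proj₂ thirds)

-- A series with even coefficients off the multiples of 3 is a series in q³
-- modulo 2, hence its square is one modulo 4.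
square-mod-4 : ∀ f → (∃ λ g → third₁ f ≗ const (+ 2) ⊛ g) → (∃ λ g → third₂ f ≗ const (+ 2) ⊛ g) →
               ∃ λ g → ∃ λ h → f ^2 ≗ δ₃ g ⊕ const (+ 4) ⊛ h
square-mod-4 f (g₁ , f₁) (g₂ , f₂) = t ^2 , δ₃ t ⊛ h ⊕ h ^2 , (begin
  f ^2
    ≈⟨ ⊛-cong f≗ f≗ ⟩
  (δ₃ t ⊕ const (+ 2) ⊛ h) ^2
    ≈⟨ solve 2 (λ t h → (t :+ con (+ 2) :* h) :* (t :+ con (+ 2) :* h) :=
         t :* t :+ con (+ 4) :* (t :* h :+ h :* h)) ≗-refl (δ₃ t) h ⟩
  δ₃ t ^2 ⊕ const (+ 4) ⊛ (δ₃ t ⊛ h ⊕ h ^2)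
    ≈⟨ ⊕-cong (dilate-⊛ 2 t t) (≗-refl {const (+ 4) ⊛ (δ₃ t ⊛ h ⊕ h ^2)}) ⟨
  δ₃ (t ^2) ⊕ const (+ 4) ⊛ (δ₃ t ⊛ h ⊕ h ^2) ∎)
  where
  open ≗-Reasoning
  t h : Series
  t = third₀ f
  h = q ⊛ δ₃ g₁ ⊕ q ⊛ (q ⊛ δ₃ g₂)
  f≗ : f ≗ δ₃ t ⊕ const (+ 2) ⊛ h
  f≗ = begin
    f
      ≈⟨ 3-dissect {f} {t} {const (+ 2) ⊛ g₁} {const (+ 2) ⊛ g₂} ≗-refl f₁ f₂ ⟩
    δ₃ t ⊕ (q ⊛ δ₃ (const (+ 2) ⊛ g₁) ⊕ q ⊛ (q ⊛ δ₃ (const (+ 2) ⊛ g₂)))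
      ≈⟨ ⊕-cong (≗-refl {δ₃ t}) (⊕-cong (⊛-congˡ {q} (dilate-const· 2 (+ 2) g₁))
           (⊛-congˡ {q} (⊛-congˡ {q} (dilate-const· 2 (+ 2) g₂)))) ⟩
    δ₃ t ⊕ (q ⊛ (const (+ 2) ⊛ δ₃ g₁) ⊕ q ⊛ (q ⊛ (const (+ 2) ⊛ δ₃ g₂)))
      ≈⟨ solve 4 (λ t q a b → t :+ (q :* (con (+ 2) :* a) :+ q :* (q :* (con (+ 2) :* b))) :=
           t :+ con (+ 2) :* (q :* a :+ q :* (q :* b))) ≗-refl (δ₃ t) q (δ₃ g₁) (δ₃ g₂) ⟩
    δ₃ t ⊕ const (+ 2) ⊛ h ∎

module _ (wA-even₁ : ∃ λ g → third₁ (w ⊛ A) ≗ const (+ 2) ⊛ g)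
         (wA-even₂ : ∃ λ g → third₂ (w ⊛ A) ≗ const (+ 2) ⊛ g) where

  private
    Y : Series
    Y = δ₃ φ ⊛ δ₃ ψ

    Y≗ : Y ≗ δ₃ (φ ⊛ ψ)
    Y≗ = ≗-sym (dilate-⊛ 2 φ ψ)

    square : ∃ λ g → ∃ λ h → (w ⊛ A ⊕ Y) ^2 ≗ δ₃ g ⊕ const (+ 4) ⊛ h
    square = square-mod-4 (w ⊛ A ⊕ Y)
      (proj₁ wA-even₁ , λ n → trans (cong₂ ℤ._+_ (proj₂ wA-even₁ n)
        (trans (Y≗ (suc (n * 3))) (third₁-dilate (φ ⊛ ψ) n))) (ℤ.+-identityʳ _))
      (proj₁ wA-even₂ , λ n → trans (cong₂ ℤ._+_ (proj₂ wA-even₂ n)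
        (trans (Y≗ (suc (suc (n * 3)))) (third₂-dilate (φ ⊛ ψ) n))) (ℤ.+-identityʳ _))

  -- `Y` is a series in q³: adding it to `w ⊛ A` does not disturb evenness off the multiples of 3,
  -- and its square goes into `f`. The 4 in front and the modulus 4 of `square-mod-4` make 16.
  third₂-mod-16 : ∃ λ f → ∃ λ h → third₂ (φ ^2 ⊛ ψ ^2) ≗ δ₃ f ⊕ const (+ 16) ⊛ h
  third₂-mod-16 = f , h , (begin
    third₂ (φ ^2 ⊛ ψ ^2)
      ≈⟨ third₂-φ²ψ² ⟩
    const (+ 4) ⊛ (w ⊛ A ⊕ Y) ^2 ⊖ const (+ 3) ⊛ Y ^2
      ≈⟨ ⊕-cong (⊛-congˡ {const (+ 4)} (proj₂ (proj₂ square))) (⊝-cong (⊛-congˡ {const (+ 3)} (⊛-cong Y≗ Y≗))) ⟩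
    const (+ 4) ⊛ (δ₃ g ⊕ const (+ 4) ⊛ h) ⊖ const (+ 3) ⊛ δ₃ (φ ⊛ ψ) ^2
      ≈⟨ solve 3 (λ g h y → con (+ 4) :* (g :+ con (+ 4) :* h) :- con (+ 3) :* y :=
           (con (+ 4) :* g :+ con (ℤ.- + 3) :* y) :+ con (+ 16) :* h) ≗-refl
           (δ₃ g) h (δ₃ (φ ⊛ ψ) ^2) ⟩
    (const (+ 4) ⊛ δ₃ g ⊕ const (ℤ.- + 3) ⊛ δ₃ (φ ⊛ ψ) ^2) ⊕ const (+ 16) ⊛ h
      ≈⟨ ⊕-cong (⊕-cong (dilate-const· 2 (+ 4) g) (≗-trans (dilate-const· 2 (ℤ.- + 3) ((φ ⊛ ψ) ^2))
           (⊛-congˡ {const (ℤ.- + 3)} (dilate-⊛ 2 (φ ⊛ ψ) (φ ⊛ ψ)))))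
           (≗-refl {const (+ 16) ⊛ h}) ⟨
    (δ₃ (const (+ 4) ⊛ g) ⊕ δ₃ (const (ℤ.- + 3) ⊛ (φ ⊛ ψ) ^2)) ⊕ const (+ 16) ⊛ h
      ≈⟨ ⊕-cong (dilate-⊕ 2 (const (+ 4) ⊛ g) (const (ℤ.- + 3) ⊛ (φ ⊛ ψ) ^2)) (≗-refl {const (+ 16) ⊛ h}) ⟨
    δ₃ f ⊕ const (+ 16) ⊛ h ∎)
    where
    open ≗-Reasoning
    g h f : Series
    g = proj₁ square
    h = proj₁ (proj₂ square)
    f = const (+ 4) ⊛ g ⊕ const (ℤ.- + 3) ⊛ (φ ⊛ ψ) ^2

wA-even : ∀ N → ¬ 3 ℕ.∣ N → ∃ λ c → (w ⊛ A) N ≡ + 2 ℤ.* c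
wA-even N 3∤N = c , trans (sym (·-⊛ w A N)) c-half
  where
  half = Representations.even-count N 3∤N
  c = proj₁ half
  c-half = proj₂ half

wA-even₁ : ∃ λ g → third₁ (w ⊛ A) ≗ const (+ 2) ⊛ g
wA-even₁ = (λ n → proj₁ (half n)) , λ n → trans (proj₂ (half n)) (sym (const-⊛ (+ 2) (λ n → proj₁ (half n)) n))
  where
  half : ∀ n → ∃ λ c → (w ⊛ A) (suc (n * 3)) ≡ + 2 ℤ.* c
  half n = wA-even (suc (n * 3)) (λ (ℕ.divides k eq) → 3m≢3n+1 k n (sym eq))

wA-even₂ : ∃ λ g → third₂ (w ⊛ A) ≗ const (+ 2) ⊛ g
wA-even₂ = (λ n → proj₁ (half n)) , λ n → trans (proj₂ (half n)) (sym (const-⊛ (+ 2) (λ n → proj₁ (half n)) n))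
  where
  half : ∀ n → ∃ λ c → (w ⊛ A) (suc (suc (n * 3))) ≡ + 2 ℤ.* c
  half n = wA-even (suc (suc (n * 3))) (λ (ℕ.divides k eq) → 3m≢3n+2 k n (sym eq))

256∣16s+256g : ∀ x s h g → x ≡ + 16 ℤ.* s ℤ.+ + 256 ℤ.* g → s ≡ 0ℤ ℤ.+ + 16 ℤ.* h → + 256 ∣ x
256∣16s+256g x s h g x≡ s≡ = Signed.∣⇒∣ᵤ {+ 256} {x} (subst (+ 256 Signed.∣_) (sym x≡)
  (Signed.∣m∣n⇒∣m+n (divides h 16s) (Signed.∣m⇒∣m*n g Signed.∣-refl)))
  where
  open ≡-Reasoning
  16s : + 16 ℤ.* s ≡ h ℤ.* + 256
  16s = begin
    + 16 ℤ.* s             ≡⟨ cong (+ 16 ℤ.*_) (trans s≡ (ℤ.+-identityˡ (+ 16 ℤ.* h))) ⟩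
    + 16 ℤ.* (+ 16 ℤ.* h)  ≡⟨ ℤ.*-assoc (+ 16) (+ 16) h ⟨
    + 256 ℤ.* h            ≡⟨ ℤ.*-comm (+ 256) h ⟩
    h ℤ.* + 256            ∎

-- For an arbitrary series in place of b̄, which would unfold at a successor.
256∣ : ∀ (f : Series) → (∃ λ (g : Series) → ∀ m → f (suc (m * 2 * 2) * 2) ≡ + 16 ℤ.* (φ ^2 ⊛ ψ ^2) m ℤ.+ + 256 ℤ.* g m) →
       (∃ λ (e : Series) → ∃ λ (h : Series) → third₂ (φ ^2 ⊛ ψ ^2) ≗ δ₃ e ⊕ const (+ 16) ⊛ h) →
       ∀ k → (∀ e → δ₃ e k ≡ 0ℤ) → ∀ N → suc (suc (suc (k * 3)) * 2 * 2) * 2 ≡ N → + 256 ∣ f N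
256∣ f (g , f≡) (e , h , mod-16) k off-thirds _ refl =
  256∣16s+256g (f (suc (suc (suc (k * 3)) * 2 * 2) * 2)) ((φ ^2 ⊛ ψ ^2) (suc (suc (k * 3)))) (h k) (g (suc (suc (k * 3))))
    (f≡ (suc (suc (k * 3)))) (trans (mod-16 k) (cong₂ ℤ._+_ (off-thirds e) (const-⊛ (+ 16) h k)))

theorem1p2 : (n t : ℕ) → t ≡ 42 ⊎ t ≡ 66 → + 256 ∣ b̄ (72 * n + t)
theorem1p2 n t (inj₁ refl) =
  256∣ b̄ b̄-8m+2 (third₂-mod-16 wA-even₁ wA-even₂) (suc (n * 3)) (λ h → third₁-dilate h n) (72 * n + 42) (72n+42 n)
theorem1p2 n t (inj₂ refl) =
  256∣ b̄ b̄-8m+2 (third₂-mod-16 wA-even₁ wA-even₂) (suc (suc (n * 3))) (λ h → third₂-dilate h n) (72 * n + 66) (72n+66 n)
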